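{- Let $\alpha$ be a badly approximable real number, i.e. $\inf_{q\ge 1} q\,\|q\alpha\|>0$. Then the set of real numbers $\beta$ such that $$\liminf_{q\to+\infty}\, q\,(\log q)^2\,\|q\alpha\|\,\|q\beta\|>0$$ (where $q$ runs over positive integers) has Hausdorff dimension $1$.
   Context: For a real number $x$, $\|x\|$ denotes the distance from $x$ to the nearest integer. -}

module Defs where

open import Algebra.Apartness.Bundles using (HeytingCommutativeRing; HeytingField)
open import Algebra.Bundles using (CommutativeRing; Semiring)
import Algebra.Construct.NaturalChoice.Max as Max
import Algebra.Definitions.RawSemiring as RawSemiring
open import Axiom.ExcludedMiddle using (ExcludedMiddle)
open import Data.Fin.Base using (toℕ)
open import Data.Integer.Base using (ℤ; +_; -[1+_])
open import Data.Nat.Base as ℕ using (ℕ; suc; _!)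
open import Data.Product.Base using (∃; ∃₂; _×_; _,_)
open import Data.Sum.Base using (_⊎_)
open import Function.Base using (flip)
open import Level using (Level; 0ℓ; _⊔_) renaming (suc to lsuc)
open import Relation.Binary.Bundles using (TotalOrder)
open import Relation.Binary.Core using (Rel)
open import Relation.Binary.PropositionalEquality.Core using (_≡_)
open import Relation.Binary.Structures using (IsTotalOrder)
import Relation.Binary.Construct.Add.Extrema.Equality as AddExtremaEquality
import Relation.Binary.Construct.Add.Extrema.NonStrict as AddExtremaNonStrict
import Relation.Binary.Construct.Add.Extrema.Strict as AddExtremaStrict
import Relation.Binary.Construct.NonStrictToStrict as NonStrictToStrict
open import Relation.Nullary.Construct.Add.Extrema using (_±; [_])
open import Relation.Nullary.Decidable.Core using (yes; no)
open import Relation.Unary using (Pred; _∈_)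

private
  variable
    a ℓ r : Level

module _ {A : Set a} (_≤_ : Rel A r) where

  IsLUB : Pred A ℓ → A → Set (a ⊔ ℓ ⊔ r)
  IsLUB S s = (∀ x → x ∈ S → x ≤ s)
            × (∀ b → (∀ x → x ∈ S → x ≤ b) → s ≤ b)

IsGLB : {A : Set a} (_≤_ : Rel A r) → Pred A ℓ → A → Set (a ⊔ ℓ ⊔ r)
IsGLB _≤_ = IsLUB (flip _≤_)

-- The real numbers, given axiomatically: classically, a Dedekind-complete
-- ordered field exists and is unique up to isomorphism. In a Heyting field
-- x # y holds exactly when x - y is invertible, so under excluded middle
-- tightness makes every nonzero element invertible; also 1# # 0#.
record CompleteOrderedField : Set₁ where
  infix 4 _≤_
  field
    heytingField : HeytingField 0ℓ 0ℓ 0ℓ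

  open HeytingField heytingField public
    using (Carrier; _≈_; _#_; _+_; _*_; -_; 0#; 1#; isHeytingField)

  field
    _≤_          : Rel Carrier 0ℓ
    isTotalOrder : IsTotalOrder _≈_ _≤_
    +-monoˡ-≤    : ∀ {x y} z → x ≤ y → x + z ≤ y + z
    *-nonNeg     : ∀ {x y} → 0# ≤ x → 0# ≤ y → 0# ≤ x * y
    lub          : ∀ (S : Pred Carrier 0ℓ) →
                   ∃ (λ x → x ∈ S) →
                   ∃ (λ b → ∀ x → x ∈ S → x ≤ b) →
                   ∃ (λ s → IsLUB _≤_ S s)

  commutativeRing : CommutativeRing 0ℓ 0ℓ
  commutativeRing = HeytingCommutativeRing.commutativeRing
    (HeytingField.heytingCommutativeRing heytingField)

  open CommutativeRing commutativeRing public
    using (_-_; semiring)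

  totalOrder : TotalOrder 0ℓ 0ℓ 0ℓ
  totalOrder = record { isTotalOrder = isTotalOrder }

module RealAnalysis
  (em : ∀ ℓ → ExcludedMiddle ℓ)
  (𝓡 : CompleteOrderedField)
  where

  open CompleteOrderedField 𝓡 public
  open NonStrictToStrict _≈_ _≤_ public using (_<_)
  open Max totalOrder public using () renaming (_⊔_ to max)
  open RawSemiring (Semiring.rawSemiring semiring) public
    using (_^_; sum) renaming (_×_ to _×ℕ_)

  ℝ : Set
  ℝ = Carrier

  -- The element described by P, or a default if there is none. Every use
  -- below has a description that determines the element up to equality.
  the : {A : Set} → A → Pred A ℓ → A
  the {ℓ} default P with em ℓ {∃ P}
  ... | yes (x , _) = x
  ... | no  _       = default

  fromℕ : ℕ → ℝ
  fromℕ n = n ×ℕ 1#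

  fromℤ : ℤ → ℝ
  fromℤ (+ n)    = fromℕ n
  fromℤ -[1+ n ] = - fromℕ (suc n)

  ∣_∣ : ℝ → ℝ
  ∣ x ∣ = max x (- x)

  -- Only used for nonzero arguments.
  infix 8 _⁻¹
  _⁻¹ : ℝ → ℝ
  x ⁻¹ = the 0# λ y → x * y ≈ 1#

  -- Only used for nonempty sets bounded above, respectively below.
  sup inf : Pred ℝ ℓ → ℝ
  sup S = the 0# (IsLUB _≤_ S)
  inf S = the 0# (IsGLB _≤_ S)

  ‖_‖ : ℝ → ℝ
  ‖ x ‖ = inf λ d → ∃ λ (n : ℤ) → d ≈ ∣ x - fromℤ n ∣

  partialSum : (ℕ → ℝ) → ℕ → ℝ
  partialSum f n = sum {n} λ i → f (toℕ i)

  infix 4 _⟶_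
  _⟶_ : (ℕ → ℝ) → ℝ → Set
  f ⟶ l = ∀ ε → 0# < ε → ∃ λ N → ∀ n → N ℕ.≤ n → ∣ f n - l ∣ < ε

  exp : ℝ → ℝ
  exp x = the 0# λ y → partialSum (λ k → x ^ k * fromℕ (k !) ⁻¹) ⟶ y

  -- Only used for positive arguments.
  log : ℝ → ℝ
  log x = the 0# λ y → exp y ≈ x

  -- Only used for x ≥ 0 and s > 0, so that 0 ^ʳ s = 0.
  infixr 8 _^ʳ_
  _^ʳ_ : ℝ → ℝ → ℝ
  x ^ʳ s with em 0ℓ {x ≈ 0#}
  ... | yes _ = 0#
  ... | no  _ = exp (s * log x)

  ℝ± : Set
  ℝ± = ℝ ±

  open AddExtremaEquality _≈_ public using (_≈±_)
  open AddExtremaNonStrict _≤_ public using (_≤±_)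
  open AddExtremaStrict _<_ public using (_<±_)

  sup± inf± : Pred ℝ± ℓ → ℝ±
  sup± S = the [ 0# ] (IsLUB _≤±_ S)
  inf± S = the [ 0# ] (IsGLB _≤±_ S)

  -- The lower limit as q runs over the positive integers.
  liminf : (ℕ → ℝ) → ℝ±
  liminf f = sup± λ t → ∃ λ N →
    t ≡ inf± (λ u → ∃ λ q → 1 ℕ.≤ q × N ℕ.≤ q × u ≡ [ f q ])

  -- The sum of a series of nonnegative terms, possibly infinite.
  series : (ℕ → ℝ) → ℝ±
  series f = sup± λ t → ∃ λ n → t ≡ [ partialSum f n ]

  -- The alternative d ≈ 0# makes the diameter of the empty set 0.
  diam : Pred ℝ 0ℓ → ℝ
  diam U = sup λ d →
    d ≈ 0# ⊎ ∃₂ λ x y → x ∈ U × y ∈ U × d ≈ ∣ x - y ∣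

  record IsCover (δ : ℝ) (E : Pred ℝ ℓ) (U : ℕ → Pred ℝ 0ℓ) : Set ℓ where
    field
      covers : ∀ x → x ∈ E → ∃ λ i → x ∈ U i
      small  : ∀ i x y → x ∈ U i → y ∈ U i → ∣ x - y ∣ ≤ δ

  hausdorffPremeasure : ℝ → ℝ → Pred ℝ ℓ → ℝ±
  hausdorffPremeasure s δ E = inf± λ h → ∃ λ (U : ℕ → Pred ℝ 0ℓ) →
    IsCover δ E U × h ≡ series (λ i → diam (U i) ^ʳ s)

  hausdorffMeasure : ℝ → Pred ℝ ℓ → ℝ±
  hausdorffMeasure s E = sup± λ h → ∃ λ δ →
    0# < δ × h ≡ hausdorffPremeasure s δ E

  -- Taking s > 0 rather than s ≥ 0 leaves the infimum unchanged and avoids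
  -- a convention for 0 to the power 0.
  hausdorffDimension : Pred ℝ ℓ → ℝ±
  hausdorffDimension E = inf± λ t → ∃ λ s →
    0# < s × hausdorffMeasure s E ≈± [ 0# ] × t ≡ [ s ]

  BadlyApproximable : Pred ℝ 0ℓ
  BadlyApproximable α =
    [ 0# ] <± inf± (λ t → ∃ λ q → 1 ℕ.≤ q × t ≡ [ fromℕ q * ‖ fromℕ q * α ‖ ])

{-# OPTIONS --safe #-}

-- Upper bound: for s > 1 the whole line has s-dimensional measure zero.
--
-- Lower bound (the Peres-Schlag sieve with the cover as additional obstacle): let s < 1 and let a
-- cover of the exceptional set by sets of diameter at most 2^-M have s-dimensional cost at most 1.
-- For q = 2^j + r < 2^(j+1) with ‖qα‖ about 2^-t, remove from the unit interval the neighbourhoods of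
-- the fractions with denominator q of radius 2^-l, l = 2j + 2 log j - t + K, and remove also the
-- dyadic intervals of length 2^-l that meet a set of the cover of diameter about 2^-l.
-- As the fractions with denominator q are spread evenly over intervals of length 2^-j, removing the
-- neighbourhoods costs at most a constant times 2^-l/2^-j of the measure that is left at level j.
-- As α is badly approximable, ‖qα‖ is about 2^-t for only about 2^(j-t) of the q < 2^(j+1). Hence the
-- level l costs at most the proportion 1/l of the measure left, so that at least about 1/l survives,
-- against which the cover, of measure 2^-l(1-s), does not count. A point that survives all levels lies
-- in the exceptional set but not in the cover.

module Submission where

open import Defs
open import Axiom.ExcludedMiddle using (ExcludedMiddle)
open import Relation.Nullary.Construct.Add.Extrema using (⊥±; ⊤±; [_])
open import Algebra.Apartness.Bundles using (HeytingField)
open import Algebra.Bundles using (CommutativeRing; RawRing)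
import Algebra.Construct.NaturalChoice.Max as Max
open import Algebra.Solver.Ring.AlmostCommutativeRing using (fromCommutativeRing; _-Raw-AlmostCommutative⟶_)
open import Data.Empty using (⊥-elim)
import Data.Integer.Properties as ℤₚ
open import Data.Maybe.Base using (Maybe; just; nothing)
open import Data.Nat.Base as ℕ using (ℕ; zero; suc; _!)
import Data.Nat.Properties as ℕₚ
open import Data.Nat.Tactic.RingSolver using (solve-∀)
open import Data.Product.Base using (∃; ∃₂; _×_; _,_; proj₁; proj₂)
open import Data.Sum.Base using (_⊎_; inj₁; inj₂; [_,_]′)
open import Level using (0ℓ)
import Relation.Binary.Construct.Add.Extrema.NonStrict as NonStrict
import Relation.Binary.Construct.Add.Extrema.Strict as StrictExtrema
import Relation.Binary.Construct.Add.Supremum.NonStrict as Supremum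
import Relation.Binary.Construct.Add.Supremum.Strict as StrictSupremum
import Relation.Binary.Construct.NonStrictToStrict as Strict
open import Relation.Binary.PropositionalEquality.Core as ≡ using (_≡_)
open import Relation.Binary.Structures using (IsTotalOrder)
open import Relation.Nullary using (¬_; Dec; yes; no; contradiction)
open import Relation.Nullary.Decidable using (True; toWitness; fromWitness)
open import Relation.Unary using (Pred; _∈_)

-- The removals caused by the denominators of size 2^j are counted at level j, where the fractions
-- are spread evenly, but they take place at a later level l, after the survivors have been thinned
-- in ways that need not be even. The proof therefore carries along that the density of survivors
-- times the level never decreases. As l is at most 5j, the density falls by at most a factor 5
-- between the two levels, so the loss can be charged to the survivors of level l. The invariant
-- reproduces itself because losing the proportion 1/(l+1) leaves l/(l+1), and this product
-- telescopes. The exponent 2 of the logarithm makes the loss that small: up to l + 1 values of j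
-- act on the same level, and each may cost only about 1/l^2. No measure on the exceptional set is
-- built. The sieve only counts dyadic intervals in natural numbers, which is why the cover has to
-- be an obstacle inside it; real numbers return when an infinite branch of surviving intervals is
-- turned into a point.

module Counting (em : ∀ ℓ → ExcludedMiddle ℓ) where

  open import Data.Nat.Base
  open import Data.Nat.Properties
  open import Relation.Binary.PropositionalEquality.Core using (_≡_; refl; sym; trans; cong; cong₂; subst)
  open import Relation.Binary.PropositionalEquality.Properties using (module ≡-Reasoning)

  -- Counting, union bounds and double counting

  bit : Set → ℕ
  bit P with em 0ℓ {P}
  ... | yes _ = 1
  ... | no  _ = 0

  bit-mono : ∀ {P Q : Set} → (P → Q) → bit P ≤ bit Q
  bit-mono {P} {Q} f with em 0ℓ {P} | em 0ℓ {Q}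
  ... | yes p | yes _ = ≤-refl
  ... | yes p | no ¬q = contradiction (f p) ¬q
  ... | no _  | _     = z≤n

  bit≤1 : ∀ P → bit P ≤ 1
  bit≤1 P with em 0ℓ {P}
  ... | yes _ = ≤-refl
  ... | no  _ = z≤n

  bit-yes : ∀ {P} → P → bit P ≡ 1
  bit-yes {P} p with em 0ℓ {P}
  ... | yes _ = refl
  ... | no ¬p = contradiction p ¬p

  bit-no : ∀ {P} → ¬ P → bit P ≡ 0
  bit-no {P} ¬p with em 0ℓ {P}
  ... | yes p = contradiction p ¬p
  ... | no _  = refl

  bit-⊎ : ∀ {P Q R : Set} → (P → Q ⊎ R) → bit P ≤ bit Q + bit R
  bit-⊎ {P} {Q} {R} f with em 0ℓ {P} | em 0ℓ {Q} | em 0ℓ {R}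
  ... | no _  | _     | _     = z≤n
  ... | yes _ | yes _ | _     = s≤s z≤n
  ... | yes _ | no _  | yes _ = ≤-refl
  ... | yes p | no ¬q | no ¬r = ⊥-elim ([ ¬q , ¬r ]′ (f p))

  ∑ : ℕ → (ℕ → ℕ) → ℕ
  ∑ zero    f = 0
  ∑ (suc n) f = ∑ n f + f n

  count : ℕ → (ℕ → Set) → ℕ
  count n P = ∑ n λ a → bit (P a)

  ∑-mono : ∀ n {f g : ℕ → ℕ} → (∀ a → a < n → f a ≤ g a) → ∑ n f ≤ ∑ n g
  ∑-mono zero    h = z≤n
  ∑-mono (suc n) h = +-mono-≤ (∑-mono n λ a a<n → h a (m<n⇒m<1+n a<n)) (h n ≤-refl)

  ∑-+ : ∀ n f g → ∑ n (λ a → f a + g a) ≡ ∑ n f + ∑ n g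
  ∑-+ zero    f g = refl
  ∑-+ (suc n) f g = trans (cong (_+ (f n + g n)) (∑-+ n f g))
    (interchange (∑ n f) (∑ n g) (f n) (g n))
    where
    interchange : ∀ a b c d → (a + b) + (c + d) ≡ (a + c) + (b + d)
    interchange = solve-∀

  ∑-*ˡ : ∀ n c f → ∑ n (λ a → c * f a) ≡ c * ∑ n f
  ∑-*ˡ zero    c f = sym (*-zeroʳ c)
  ∑-*ˡ (suc n) c f = trans (cong (_+ c * f n) (∑-*ˡ n c f)) (sym (*-distribˡ-+ c _ _))

  ∑-const : ∀ n c → ∑ n (λ _ → c) ≡ n * c
  ∑-const zero    c = refl
  ∑-const (suc n) c = trans (cong (_+ c) (∑-const n c)) (+-comm (n * c) c)

  count-mono : ∀ n {P Q : ℕ → Set} → (∀ a → a < n → P a → Q a) → count n P ≤ count n Q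
  count-mono n h = ∑-mono n λ a a<n → bit-mono (h a a<n)

  count-⊎ : ∀ n {P Q R : ℕ → Set} → (∀ a → a < n → P a → Q a ⊎ R a) → count n P ≤ count n Q + count n R
  count-⊎ n {P} {Q} {R} h = ≤-trans (∑-mono n λ a a<n → bit-⊎ (h a a<n))
                                (≤-reflexive (∑-+ n (λ a → bit (Q a)) (λ a → bit (R a))))

  count-none : ∀ n {P : ℕ → Set} → (∀ a → a < n → ¬ P a) → count n P ≡ 0
  count-none zero    h = refl
  count-none (suc n) h = cong₂ _+_ (count-none n λ a a<n → h a (m<n⇒m<1+n a<n)) (bit-no (h n ≤-refl))

  count-all : ∀ n {P : ℕ → Set} → (∀ a → a < n → P a) → count n P ≡ n
  count-all zero    h = refl
  count-all (suc n) h = trans (cong₂ _+_ (count-all n λ a a<n → h a (m<n⇒m<1+n a<n)) (bit-yes (h n ≤-refl)))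
                          (+-comm n 1)

  count-some : ∀ n {P : ℕ → Set} → 0 < count n P → ∃ λ a → a < n × P a
  count-some n {P} 0<# with em 0ℓ {∃ λ a → a < n × P a}
  ... | yes p = p
  ... | no ¬p = contradiction 0<# (<-irrefl (sym (count-none n λ a a<n pa → ¬p (a , a<n , pa))))

  union-bound : ∀ n m (S : ℕ → ℕ → Set) →
                count n (λ a → ∃ λ b → b < m × S b a) ≤ ∑ m (λ b → count n (S b))
  union-bound n zero    S = ≤-reflexive (count-none n λ { _ _ (_ , () , _) })
  union-bound n (suc m) S = ≤-trans (count-⊎ n split) (+-monoˡ-≤ (count n (S m)) (union-bound n m S))
    where
    split : ∀ a → a < n → (∃ λ b → b < suc m × S b a) → (∃ λ b → b < m × S b a) ⊎ S m a
    split a _ (b , b<sm , s) with m≤n⇒m<n∨m≡n (≤-pred b<sm)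
    ... | inj₁ b<m  = inj₁ (b , b<m , s)
    ... | inj₂ refl = inj₂ s

  -- The union bound over b, with fibres of size at most c. Later, intervals are charged to
  -- fractions, struck intervals to denominators, and intervals that meet the cover to its sets.
  double-count : ∀ n m c {P Q : ℕ → Set} (R : ℕ → ℕ → Set) →
                 (∀ a → a < n → P a → ∃ λ b → b < m × Q b × R b a) →
                 (∀ b → b < m → Q b → count n (R b) ≤ c) → count n P ≤ c * count m Q
  double-count n m c {P} {Q} R h k = begin
    count n P                                          ≤⟨ count-mono n h ⟩
    count n (λ a → ∃ λ b → b < m × Q b × R b a)        ≤⟨ union-bound n m _ ⟩
    ∑ m (λ b → count n (λ a → Q b × R b a))            ≤⟨ ∑-mono m fibre ⟩
    ∑ m (λ b → c * bit (Q b))                      ≡⟨ ∑-*ˡ m c _ ⟩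
    c * count m Q                                      ∎
    where
    open ≤-Reasoning
    fibre : ∀ b → b < m → count n (λ a → Q b × R b a) ≤ c * bit (Q b)
    fibre b b<m with em 0ℓ {Q b}
    ... | yes q = ≤-trans (count-mono n λ _ _ → proj₂) (≤-trans (k b b<m q) (≤-reflexive (sym (*-identityʳ c))))
    ... | no ¬q = ≤-trans (≤-reflexive (count-none n λ _ _ qr → ¬q (proj₁ qr))) z≤n

  count-+ : ∀ c n (P : ℕ → Set) → count (c + n) P ≤ c + count n P
  count-+ zero    n P = ≤-refl
  count-+ (suc c) n P = ≤-trans (+-mono-≤ (count-+ c n P) (bit≤1 (P (c + n))))
                            (≤-reflexive (+-comm (c + count n P) 1))

  count≤n : ∀ n (P : ℕ → Set) → count n P ≤ n
  count≤n zero    P = z≤n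
  count≤n (suc n) P = ≤-trans (+-mono-≤ (count≤n n P) (bit≤1 (P n))) (≤-reflexive (+-comm n 1))

  -- The largest element n confines all others to the c numbers ending at n. This turns an estimate
  -- for pairs into a count.
  cluster : ∀ n c {P : ℕ → Set} → (∀ a a′ → P a → P a′ → a < c + a′) → count n P ≤ c
  cluster zero    c {P} h = z≤n
  cluster (suc n) c {P} h with em 0ℓ {P n}
  ... | no ¬p = ≤-trans (≤-reflexive (+-identityʳ (count n P))) (cluster n c h)
  ... | yes p with ≤-total c (suc n)
  ...   | inj₂ n<c = ≤-trans (+-monoˡ-≤ 1 (count≤n n P)) (≤-trans (≤-reflexive (+-comm n 1)) n<c)
  ...   | inj₁ c≤n with m≤n⇒∃[o]m+o≡n c≤n
  ...     | d , c+d≡1+n = begin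
    count n P + 1       ≡⟨ cong (count n P +_) (bit-yes p) ⟨
    count (suc n) P     ≡⟨ cong (λ k → count k P) c+d≡1+n ⟨
    count (c + d) P     ≤⟨ count-+ c d P ⟩
    c + count d P       ≡⟨ cong (c +_) (count-none d below) ⟩
    c + 0           ≡⟨ +-identityʳ c ⟩
    c               ∎
    where
    open ≤-Reasoning
    below : ∀ a → a < d → ¬ P a
    below a a<d pa = <-irrefl refl (begin-strict
      n           <⟨ h n a p pa ⟩
      c + a       ≤⟨ ≤-pred (≤-trans (+-monoʳ-< c a<d) (≤-reflexive c+d≡1+n)) ⟩
      n           ∎)

  -- Dyadic intervals, their ancestors and nearby fractions

  count-half : ∀ n (P : ℕ → Set) → count (n * 2) (λ a → P ⌊ a /2⌋) ≡ count n P * 2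
  count-half zero    P = refl
  count-half (suc n) P = begin
    count (n * 2) Q + bit (P ⌊ n * 2 /2⌋) + bit (P ⌊ suc (n * 2) /2⌋)
      ≡⟨ cong₂ (λ x y → count (n * 2) Q + bit (P x) + bit (P y)) (even n) (odd n) ⟩
    count (n * 2) Q + bit (P n) + bit (P n)
      ≡⟨ cong (λ x → x + bit (P n) + bit (P n)) (count-half n P) ⟩
    count n P * 2 + bit (P n) + bit (P n)
      ≡⟨ lem (count n P) (bit (P n)) ⟩
    (count n P + bit (P n)) * 2 ∎
    where
    open ≡-Reasoning
    Q : ℕ → Set
    Q a = P ⌊ a /2⌋
    lem : ∀ x y → x * 2 + y + y ≡ (x + y) * 2
    lem = solve-∀
    even : ∀ n → ⌊ n * 2 /2⌋ ≡ n
    even zero    = refl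
    even (suc n) = cong suc (even n)
    odd : ∀ n → ⌊ suc (n * 2) /2⌋ ≡ n
    odd zero    = refl
    odd (suc n) = cong suc (odd n)

  half-lower : ∀ a → ⌊ a /2⌋ * 2 ≤ a
  half-lower zero          = z≤n
  half-lower (suc zero)    = z≤n
  half-lower (suc (suc a)) = s≤s (s≤s (half-lower a))

  half-upper : ∀ a → a < suc ⌊ a /2⌋ * 2
  half-upper zero          = s≤s z≤n
  half-upper (suc zero)    = s≤s (s≤s z≤n)
  half-upper (suc (suc a)) = s≤s (s≤s (half-upper a))

  half-cases : ∀ a → a ≡ ⌊ a /2⌋ * 2 ⊎ a ≡ suc (⌊ a /2⌋ * 2)
  half-cases zero          = inj₁ refl
  half-cases (suc zero)    = inj₂ refl
  half-cases (suc (suc a)) = [ (λ e → inj₁ (cong (λ k → suc (suc k)) e)) , (λ e → inj₂ (cong (λ k → suc (suc k)) e)) ]′ (half-cases a)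

  -- The index of the dyadic interval d levels up that contains the interval with index a.
  ancestor : ℕ → ℕ → ℕ
  ancestor zero    a = a
  ancestor (suc d) a = ancestor d ⌊ a /2⌋

  ancestor-lower : ∀ d a → ancestor d a * 2 ^ d ≤ a
  ancestor-lower zero    a = ≤-reflexive (*-identityʳ a)
  ancestor-lower (suc d) a = begin
    ancestor d ⌊ a /2⌋ * (2 * 2 ^ d) ≡⟨ lem (ancestor d ⌊ a /2⌋) (2 ^ d) ⟩
    ancestor d ⌊ a /2⌋ * 2 ^ d * 2   ≤⟨ *-monoˡ-≤ 2 (ancestor-lower d ⌊ a /2⌋) ⟩
    ⌊ a /2⌋ * 2                      ≤⟨ half-lower a ⟩
    a                                ∎
    where
    open ≤-Reasoning
    lem : ∀ x y → x * (2 * y) ≡ x * y * 2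
    lem = solve-∀

  ancestor-upper : ∀ d a → a < suc (ancestor d a) * 2 ^ d
  ancestor-upper zero    a = ≤-reflexive (sym (*-identityʳ (suc a)))
  ancestor-upper (suc d) a = begin-strict
    a                                      <⟨ half-upper a ⟩
    suc ⌊ a /2⌋ * 2                        ≤⟨ *-monoˡ-≤ 2 (ancestor-upper d ⌊ a /2⌋) ⟩
    suc (ancestor d ⌊ a /2⌋) * 2 ^ d * 2   ≡⟨ lem (suc (ancestor d ⌊ a /2⌋)) (2 ^ d) ⟩
    suc (ancestor d ⌊ a /2⌋) * (2 * 2 ^ d) ∎
    where
    open ≤-Reasoning
    lem : ∀ x y → x * y * 2 ≡ x * (2 * y)
    lem = solve-∀

  -- The interval [a, a+1]/2^l comes within 2^-l of a fraction with denominator q.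
  HitAt : ℕ → ℕ → ℕ → ℕ → Set
  HitAt q l p a = a * q ≤ 2 ^ l * p + q × 2 ^ l * p ≤ (a + 2) * q

  Hit : ℕ → ℕ → ℕ → Set
  Hit q l a = ∃ λ p → HitAt q l p a

  -- Counts in two stages that meet in the fractions p/q. A fraction lies within 2^-(d+j) of at most
  -- 4 intervals of level d + j, and since q < 2^(j+1) an interval of level j has at most 6
  -- fractions within 2^-j. Only level j sees `P`, and the bound does not depend on d.
  hit-bound : ∀ q j d (P : ℕ → Set) → 2 ^ j ≤ q → q < 2 * 2 ^ j →
              count (2 ^ (d + j)) (λ a → P (ancestor d a) × Hit q (d + j) a) ≤ 24 * count (2 ^ j) P
  hit-bound q j d P lo hi = begin
    count (2 ^ (d + j)) (λ a → P (ancestor d a) × Hit q (d + j) a)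
      ≤⟨ double-count (2 ^ (d + j)) (suc (2 * q)) 4 (HitAt q (d + j)) step₁ fibre₁ ⟩
    4 * count (suc (2 * q)) Near
      ≤⟨ *-monoʳ-≤ 4 (double-count (suc (2 * q)) (2 ^ j) 6 near (λ { p _ (b , b< , pb , n) → b , b< , pb , n }) fibre₂) ⟩
    4 * (6 * count (2 ^ j) P)
      ≡⟨ lem (count (2 ^ j) P) ⟩
    24 * count (2 ^ j) P ∎
    where
    open ≤-Reasoning
    lem : ∀ x → 4 * (6 * x) ≡ 24 * x
    lem = solve-∀
    instance
      q≢0 : NonZero q
      q≢0 = >-nonZero (≤-trans (m^n>0 2 j) lo)
    2^j≢0 : NonZero (2 ^ j)
    2^j≢0 = >-nonZero (m^n>0 2 j)
    2^d≢0 : NonZero (2 ^ d)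
    2^d≢0 = >-nonZero (m^n>0 2 d)
    near : ℕ → ℕ → Set
    near b p = b * q ≤ 2 ^ j * p + q × 2 ^ j * p ≤ (b + 2) * q
    Near : ℕ → Set
    Near p = ∃ λ b → b < 2 ^ j × P b × near b p
    2^ = ^-distribˡ-+-* 2 d j
    step₁ : ∀ a → a < 2 ^ (d + j) → P (ancestor d a) × Hit q (d + j) a →
            ∃ λ p → p < suc (2 * q) × Near p × HitAt q (d + j) p a
    step₁ a a< (pa , p , h₁ , h₂) = p , s≤s p≤2q , (b , b< , pa , n₁ , n₂) , h₁ , h₂
      where
      b = ancestor d a
      b< : b < 2 ^ j
      b< = *-cancelʳ-< (2 ^ d) b (2 ^ j) (begin-strict
        b * 2 ^ d      ≤⟨ ancestor-lower d a ⟩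
        a              <⟨ a< ⟩
        2 ^ (d + j)    ≡⟨ trans 2^ (*-comm (2 ^ d) (2 ^ j)) ⟩
        2 ^ j * 2 ^ d  ∎)
      n₁ : b * q ≤ 2 ^ j * p + q
      n₁ = *-cancelˡ-≤ (2 ^ d) {{2^d≢0}} (begin
        2 ^ d * (b * q)             ≡⟨ (λ x y z → trans (sym (*-assoc x y z)) (cong (_* z) (*-comm x y))) (2 ^ d) b q ⟩
        b * 2 ^ d * q               ≤⟨ *-monoˡ-≤ q (ancestor-lower d a) ⟩
        a * q                       ≤⟨ h₁ ⟩
        2 ^ (d + j) * p + q         ≤⟨ +-monoʳ-≤ _ (m≤n*m q (2 ^ d) {{2^d≢0}}) ⟩
        2 ^ (d + j) * p + 2 ^ d * q ≡⟨ cong (λ k → k * p + 2 ^ d * q) 2^ ⟩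
        2 ^ d * 2 ^ j * p + 2 ^ d * q ≡⟨ l2 (2 ^ d) (2 ^ j) p q ⟩
        2 ^ d * (2 ^ j * p + q)     ∎)
        where
        l2 : ∀ x y p q → x * y * p + x * q ≡ x * (y * p + q)
        l2 = solve-∀
      n₂ : 2 ^ j * p ≤ (b + 2) * q
      n₂ = *-cancelˡ-≤ (2 ^ d) {{2^d≢0}} (begin
        2 ^ d * (2 ^ j * p)    ≡⟨ sym (*-assoc (2 ^ d) (2 ^ j) p) ⟩
        2 ^ d * 2 ^ j * p      ≡⟨ cong (_* p) (sym 2^) ⟩
        2 ^ (d + j) * p        ≤⟨ h₂ ⟩
        (a + 2) * q            ≡⟨ cong (_* q) (+-suc a 1) ⟩
        (suc a + 1) * q        ≤⟨ *-monoˡ-≤ q (+-mono-≤ (ancestor-upper d a) (m^n>0 2 d)) ⟩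
        (suc b * 2 ^ d + 2 ^ d) * q ≡⟨ l3 b (2 ^ d) q ⟩
        2 ^ d * ((b + 2) * q)  ∎)
        where
        l3 : ∀ b x q → ((1 + b) * x + x) * q ≡ x * ((b + 2) * q)
        l3 = solve-∀
      -- The interval b lies in the unit interval, so b + 2 is at most 2^j + 1 and hence at most
      -- twice 2^j.
      p≤2q : p ≤ 2 * q
      p≤2q = *-cancelˡ-≤ (2 ^ j) {{2^j≢0}} (begin
        2 ^ j * p       ≤⟨ n₂ ⟩
        (b + 2) * q     ≡⟨ cong (_* q) (+-comm b 2) ⟩
        (1 + suc b) * q ≤⟨ *-monoˡ-≤ q (+-mono-≤ (m^n>0 2 j) b<) ⟩
        (2 ^ j + 2 ^ j) * q ≡⟨ l4 (2 ^ j) q ⟩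
        2 ^ j * (2 * q) ∎)
        where
        l4 : ∀ x q → (x + x) * q ≡ x * (2 * q)
        l4 = solve-∀
    fibre₁ : ∀ p → p < suc (2 * q) → Near p → count (2 ^ (d + j)) (HitAt q (d + j) p) ≤ 4
    fibre₁ p _ _ = cluster (2 ^ (d + j)) 4 λ a a′ (h , _) (_ , h′) → s≤s (*-cancelʳ-≤ a (3 + a′) q (begin
      a * q                 ≤⟨ h ⟩
      2 ^ (d + j) * p + q   ≤⟨ +-monoˡ-≤ q h′ ⟩
      (a′ + 2) * q + q      ≡⟨ l5 a′ q ⟩
      (3 + a′) * q          ∎))
      where
      l5 : ∀ a q → (a + 2) * q + q ≡ (3 + a) * q
      l5 = solve-∀
    fibre₂ : ∀ b → b < 2 ^ j → P b → count (suc (2 * q)) (near b) ≤ 6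
    fibre₂ b _ _ = cluster (suc (2 * q)) 6 λ p p′ (_ , h) (h′ , _) → *-cancelˡ-< (2 ^ j) p (6 + p′) (begin-strict
      2 ^ j * p                 ≤⟨ h ⟩
      (b + 2) * q               ≡⟨ *-distribʳ-+ q b 2 ⟩
      b * q + 2 * q             ≤⟨ +-monoˡ-≤ (2 * q) h′ ⟩
      2 ^ j * p′ + q + 2 * q    ≡⟨ l6 (2 ^ j) p′ q ⟩
      2 ^ j * p′ + 3 * q        <⟨ +-monoʳ-< (2 ^ j * p′) (*-monoʳ-< 3 hi) ⟩
      2 ^ j * p′ + 3 * (2 * 2 ^ j) ≡⟨ l7 (2 ^ j) p′ ⟩
      2 ^ j * (6 + p′)          ∎)
      where
      l6 : ∀ x p q → x * p + q + 2 * q ≡ x * p + 3 * q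
      l6 = solve-∀
      l7 : ∀ x p → x * p + 3 * (2 * x) ≡ x * (6 + p)
      l7 = solve-∀

  -- Survivors in the binary tree of dyadic intervals

  module Tree (Bad : ℕ → ℕ → Set) where

    Survives : ℕ → ℕ → Set
    Survives zero    a = ¬ Bad zero a
    Survives (suc l) a = Survives l ⌊ a /2⌋ × ¬ Bad (suc l) a

    survives-good : ∀ l a → Survives l a → ¬ Bad l a
    survives-good zero    a s = s
    survives-good (suc l) a s = proj₂ s

    survives-ancestor : ∀ d l a → Survives (d + l) a → Survives l (ancestor d a)
    survives-ancestor zero    l a s = s
    survives-ancestor (suc d) l a s = survives-ancestor d l ⌊ a /2⌋ (proj₁ s)

    -- Looks down the tree where `Survives` looks up: survivors can be counted level by level, while
    -- an infinite branch needs good lines of descent from the root.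
    Alive : ℕ → ℕ → ℕ → Set
    Alive zero    l a = ¬ Bad l a
    Alive (suc d) l a = ¬ Bad l a × (Alive d (suc l) (a * 2) ⊎ Alive d (suc l) (suc (a * 2)))

    alive-good : ∀ d l a → Alive d l a → ¬ Bad l a
    alive-good zero    l a x = x
    alive-good (suc d) l a x = proj₁ x

    alive-≤ : ∀ {d e} l a → d ≤ e → Alive e l a → Alive d l a
    alive-≤ {zero}  {e}     l a z≤n       x              = alive-good e l a x
    alive-≤ {suc d} {suc e} l a (s≤s d≤e) (g , inj₁ x) = g , inj₁ (alive-≤ (suc l) (a * 2) d≤e x)
    alive-≤ {suc d} {suc e} l a (s≤s d≤e) (g , inj₂ x) = g , inj₂ (alive-≤ (suc l) (suc (a * 2)) d≤e x)

    -- Each step to the parent turns one generation of `Survives` into one of `Alive`, so the sum of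
    -- level and depth stays the same.
    climb : ∀ l d a → a < 2 ^ l → Survives l a → Alive d l a → Alive (l + d) 0 0
    climb zero    d zero    a< s x = x
    climb zero    d (suc a) (s≤s ()) s x
    climb (suc l) d a       a< (s , _) x =
      subst (λ k → Alive k 0 0) (+-suc l d)
        (climb l (suc d) ⌊ a /2⌋ h< s (survives-good l _ s , children (half-cases a)))
      where
      children : a ≡ ⌊ a /2⌋ * 2 ⊎ a ≡ suc (⌊ a /2⌋ * 2) →
                 Alive d (suc l) (⌊ a /2⌋ * 2) ⊎ Alive d (suc l) (suc (⌊ a /2⌋ * 2))
      children (inj₁ e) = inj₁ (subst (Alive d (suc l)) e x)
      children (inj₂ e) = inj₂ (subst (Alive d (suc l)) e x)
      h< : ⌊ a /2⌋ < 2 ^ l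
      h< = *-cancelʳ-< 2 ⌊ a /2⌋ (2 ^ l)
        (≤-<-trans (half-lower a) (≤-trans a< (≤-reflexive (*-comm 2 (2 ^ l)))))

    Immortal : ℕ → ℕ → Set
    Immortal l a = ∀ d → Alive d l a

    heir : ∀ l a → Immortal l a → ∃ λ b → (b ≡ a * 2 ⊎ b ≡ suc (a * 2)) × Immortal (suc l) b
    heir l a im with em 0ℓ {Immortal (suc l) (a * 2)} | em 0ℓ {Immortal (suc l) (suc (a * 2))}
    ... | yes i | _     = a * 2 , inj₁ refl , i
    ... | no _  | yes i = suc (a * 2) , inj₂ refl , i
    ... | no ¬i | no ¬j = ⊥-elim (¬i λ d → byContra λ ¬x → ¬j λ e → byContra λ ¬y → both d e ¬x ¬y)
      where
      byContra : ∀ {P : Set} → ¬ ¬ P → P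
      byContra {P} ¬¬p with em 0ℓ {P}
      ... | yes p = p
      ... | no ¬p = contradiction ¬p ¬¬p
      both : ∀ d e → ¬ Alive d (suc l) (a * 2) → ¬ Alive e (suc l) (suc (a * 2)) → _
      -- One depth that refutes both children, since `Alive` passes to smaller depths.
      both d e ¬x ¬y with im (suc (d + e))
      ... | _ , inj₁ x = ¬x (alive-≤ (suc l) _ (m≤m+n d e) x)
      ... | _ , inj₂ y = ¬y (alive-≤ (suc l) _ (m≤n+m e d) y)

    Branch : Set
    Branch = ∃ λ (f : ℕ → ℕ) → f 0 ≡ 0 × (∀ l → f (suc l) ≡ f l * 2 ⊎ f (suc l) ≡ suc (f l * 2))
                               × (∀ l → ¬ Bad l (f l))

    population : ℕ → ℕ
    population l = count (2 ^ l) (Survives l)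

    -- König's lemma
    branch : (∀ d → ∃ λ l → d ≤ l × 0 < population l) → Branch
    branch populated = (λ l → proj₁ (node l)) , refl , (λ l → proj₁ (proj₂ (heir l _ (proj₂ (node l))))) ,
                       λ l → proj₂ (node l) 0
      where
      root : Immortal 0 0
      root d with populated d
      ... | l , d≤l , 0<# with count-some (2 ^ l) 0<#
      ...   | a , a< , s = alive-≤ 0 0 (≤-trans d≤l (m≤m+n l 0)) (climb l 0 a a< s (survives-good l a s))
      node : ∀ l → ∃ (Immortal l)
      node zero    = 0 , root
      node (suc l) = proj₁ h , proj₂ (proj₂ h)
        where
        h = heir l _ (proj₂ (node l))

  -- The sieve

  module Sieve
    (T j₀ : ℕ) (t : ℕ → ℕ → ℕ) (logSquare : ℕ → ℕ) (Z : ℕ → ℕ → Set)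
    -- The next two bounds are all that the sieve knows about α: how small ‖qα‖ can be, and how many
    -- q share the same order of magnitude.
    (t≤ : ∀ j r → r < 2 ^ j → t j r ≤ T + j)
    (t-count : ∀ j s → count (2 ^ j) (λ r → t j r ≡ s) * 2 ^ s ≤ 2 ^ (T + 2 + j))
    (logSquare≤ : ∀ j → logSquare j ≤ j + j)
    (logSquare≥ : ∀ j → 1 ≤ j → j * j ≤ 4 * 2 ^ logSquare j)
    (1≤j₀ : 1 ≤ j₀) (K≤j₀ : T + 18 ≤ j₀)
    (Z-late : ∀ l a → l ≤ j₀ → ¬ Z l a)
    (Z-few : ∀ l → count (2 ^ l) (Z l) * (2 * (l * l)) ≤ 2 ^ l)
    where

    -- The margin 2^(K - T - 2) = 2^16 absorbs the constants 24, 100, 2 and 5 collected in struck-few.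
    K : ℕ
    K = T + 18

    -- The term t stays on the left to avoid truncated subtraction.
    OnLevel : ℕ → ℕ → ℕ → Set
    OnLevel l j r = l + t j r ≡ j + j + logSquare j + K

    Struck : ℕ → ℕ → ℕ → Set
    Struck l j a = j₀ ≤ j × ∃ λ r → r < 2 ^ j × OnLevel l j r × Hit (2 ^ j + r) l a

    -- The bound j < l makes the union over j finite, as `union-bound` demands; `onLevel-<` supplies
    -- it.
    Bad : ℕ → ℕ → Set
    Bad l a = Z l a ⊎ ∃ λ j → j < l × Struck l j a

    open Tree Bad

    private
      2^≢0 : ∀ n → NonZero (2 ^ n)
      2^≢0 n = >-nonZero (m^n>0 2 n)

    -- As t is at most T + j, the term K = T + 18 pushes l beyond j: the neighbourhoods are removed
    -- below the level at which the fractions are spread evenly.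
    onLevel-< : ∀ l j r → r < 2 ^ j → OnLevel l j r → j < l
    onLevel-< l j r r< on = +-cancelʳ-≤ (t j r) (suc j) l (begin
      suc j + t j r              ≤⟨ +-monoʳ-≤ (suc j) (t≤ j r r<) ⟩
      suc j + (T + j)            ≤⟨ m≤m+n _ (logSquare j + 17) ⟩
      suc j + (T + j) + (logSquare j + 17) ≡⟨ lem j T (logSquare j) ⟩
      j + j + logSquare j + K          ≡⟨ on ⟨
      l + t j r                  ∎)
      where
      open ≤-Reasoning
      lem : ∀ j T x → suc j + (T + j) + (x + 17) ≡ j + j + x + (T + 18)
      lem = solve-∀

    -- Makes j and l comparable, so that a cost of about 1/j^2 is as good as 1/l^2 and the density
    -- drops by at most a factor 5 between the two levels.
    onLevel-≤ : ∀ l j r → j₀ ≤ j → OnLevel l j r → l ≤ 5 * j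
    onLevel-≤ l j r j₀≤j on = begin
      l                       ≤⟨ m≤m+n l (t j r) ⟩
      l + t j r               ≡⟨ on ⟩
      j + j + logSquare j + K       ≤⟨ +-mono-≤ (+-monoʳ-≤ (j + j) (logSquare≤ j)) (≤-trans K≤j₀ j₀≤j) ⟩
      j + j + (j + j) + j     ≡⟨ lem j ⟩
      5 * j                   ∎
      where
      open ≤-Reasoning
      lem : ∀ j → j + j + (j + j) + j ≡ 5 * j
      lem = solve-∀

    -- All r on level l share one value s of t, so `t-count` applies to that s alone. The T in K
    -- cancels the T of `t-count`, and 2^16 is what remains of 2^K.
    level-count : ∀ l j → count (2 ^ j) (OnLevel l j) * 2 ^ j * 2 ^ logSquare j * 2 ^ 16 ≤ 2 ^ l
    level-count l j with em 0ℓ {∃ (OnLevel l j)}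
    ... | no ¬on = ≤-trans (≤-reflexive (cong (λ x → x * 2 ^ j * 2 ^ logSquare j * 2 ^ 16)
                     (count-none (2 ^ j) λ r _ on → ¬on (r , on)))) z≤n
    ... | yes (r₀ , on₀) = *-cancelʳ-≤ _ _ (2 ^ (T + 2 + j)) {{2^≢0 (T + 2 + j)}} (begin
      A * 2 ^ j * 2 ^ logSquare j * 2 ^ 16 * 2 ^ (T + 2 + j) ≡⟨ l1 A (2 ^ j) (2 ^ logSquare j) (2 ^ 16) (2 ^ (T + 2 + j)) ⟩
      A * (2 ^ j * 2 ^ logSquare j * 2 ^ 16 * 2 ^ (T + 2 + j)) ≡⟨ cong (A *_) powers ⟩
      A * 2 ^ (s + l)                 ≡⟨ cong (A *_) (^-distribˡ-+-* 2 s l) ⟩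
      A * (2 ^ s * 2 ^ l)             ≡⟨ *-assoc A _ _ ⟨
      A * 2 ^ s * 2 ^ l               ≤⟨ *-monoˡ-≤ (2 ^ l) (*-monoˡ-≤ (2 ^ s) (count-mono (2 ^ j) same)) ⟩
      count (2 ^ j) (λ r → t j r ≡ s) * 2 ^ s * 2 ^ l ≤⟨ *-monoˡ-≤ (2 ^ l) (t-count j s) ⟩
      2 ^ (T + 2 + j) * 2 ^ l         ≡⟨ *-comm (2 ^ (T + 2 + j)) _ ⟩
      2 ^ l * 2 ^ (T + 2 + j)         ∎)
      where
      open ≤-Reasoning
      A = count (2 ^ j) (OnLevel l j)
      s = t j r₀
      same : ∀ r → r < 2 ^ j → OnLevel l j r → t j r ≡ s
      same r _ on = +-cancelˡ-≡ l _ _ (trans on (sym on₀))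
      l1 : ∀ a b c d e → a * b * c * d * e ≡ a * (b * c * d * e)
      l1 = solve-∀
      l2 : ∀ j x T → j + x + 16 + (T + 2 + j) ≡ j + j + x + (T + 18)
      l2 = solve-∀
      powers : 2 ^ j * 2 ^ logSquare j * 2 ^ 16 * 2 ^ (T + 2 + j) ≡ 2 ^ (s + l)
      powers = trans (cong (λ x → x * 2 ^ 16 * 2 ^ (T + 2 + j)) (sym (^-distribˡ-+-* 2 j (logSquare j))))
              (trans (cong (_* 2 ^ (T + 2 + j)) (sym (^-distribˡ-+-* 2 (j + logSquare j) 16)))
              (trans (sym (^-distribˡ-+-* 2 (j + logSquare j + 16) (T + 2 + j)))
              (cong (2 ^_) (trans (l2 j (logSquare j) T) (trans (sym on₀) (+-comm l s))))))

    early : ∀ l a → l ≤ j₀ → ¬ Bad l a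
    early l a l≤ (inj₁ z) = Z-late l a l≤ z
    early l a l≤ (inj₂ (j , j<l , j₀≤j , _)) = <-irrefl refl (<-≤-trans j<l (≤-trans l≤ j₀≤j))

    early-survives : ∀ l a → l ≤ j₀ → Survives l a
    early-survives zero    a l≤ = early 0 a l≤
    early-survives (suc l) a l≤ = early-survives l _ (≤-trans (n≤1+n l) l≤) , early (suc l) a l≤

    early-population : ∀ l → l ≤ j₀ → population l ≡ 2 ^ l
    early-population l l≤ = count-all (2 ^ l) λ a _ → early-survives l a l≤

    -- The density of survivors times the level is nondecreasing.
    Growing : ℕ → Set
    Growing l = ∀ j → j₀ ≤ j → j ≤ l → j * population j * 2 ^ l ≤ l * population l * 2 ^ j

    -- A survivor of level l has a surviving ancestor at level j, so `hit-bound` bounds the struck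
    -- intervals by 24 times the population of level j for each denominator. `level-count` bounds
    -- the number of denominators, and the invariant exchanges the population of level j for that of
    -- level l.
    struck-few : ∀ l j → Growing l → j ≤ l →
      count (2 ^ suc l) (λ a → Survives l ⌊ a /2⌋ × Struck (suc l) j a) * (suc l * suc l) ≤ population l
    struck-few l j grow j≤l with em 0ℓ {j₀ ≤ j × ∃ λ r → r < 2 ^ j × OnLevel (suc l) j r}
    ... | no ¬on = ≤-trans (≤-reflexive (cong (_* (suc l * suc l))
                     (count-none (2 ^ suc l) λ a _ (_ , j₀≤j , r , r< , on , _) → ¬on (j₀≤j , r , r< , on)))) z≤n
    ... | yes (j₀≤j , r₀ , _ , on₀) with m≤n⇒∃[o]m+o≡n j≤l
    ...   | d , j+d≡l = *-cancelʳ-≤ _ _ (2 ^ j * 2 ^ 16) {{m*n≢0 (2 ^ j) (2 ^ 16) {{2^≢0 j}}}} (begin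
      X * (suc l * suc l) * (2 ^ j * 2 ^ 16)
        ≤⟨ *-monoˡ-≤ (2 ^ j * 2 ^ 16) (*-mono-≤ X≤ squares) ⟩
      24 * P * A * (100 * 2 ^ logSquare j) * (2 ^ j * 2 ^ 16)
        ≡⟨ l1 P A (2 ^ logSquare j) (2 ^ j) (2 ^ 16) ⟩
      2400 * P * (A * 2 ^ j * 2 ^ logSquare j * 2 ^ 16)
        ≤⟨ *-monoʳ-≤ (2400 * P) (level-count (suc l) j) ⟩
      2400 * P * (2 * 2 ^ l)
        ≡⟨ l2 P (2 ^ l) ⟩
      4800 * (P * 2 ^ l)
        ≤⟨ *-monoʳ-≤ 4800 P-grow ⟩
      4800 * (5 * (population l * 2 ^ j))
        ≡⟨ l3 (population l * 2 ^ j) ⟩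
      population l * 2 ^ j * 24000
        -- The number 41536 is 2^16 - 24000.
        ≤⟨ *-monoʳ-≤ (population l * 2 ^ j) (m≤m+n 24000 41536) ⟩
      population l * 2 ^ j * 2 ^ 16
        ≡⟨ *-assoc (population l) (2 ^ j) (2 ^ 16) ⟩
      population l * (2 ^ j * 2 ^ 16) ∎)
      where
      open ≤-Reasoning
      instance
        j≢0 : NonZero j
        j≢0 = >-nonZero (≤-trans 1≤j₀ j₀≤j)
      X = count (2 ^ suc l) (λ a → Survives l ⌊ a /2⌋ × Struck (suc l) j a)
      P = population j
      A = count (2 ^ j) (OnLevel (suc l) j)
      1+l≤ : suc l ≤ 5 * j
      1+l≤ = onLevel-≤ (suc l) j r₀ j₀≤j on₀
      l1 : ∀ p a x y z → 24 * p * a * (100 * x) * (y * z) ≡ 2400 * p * (a * y * x * z)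
      l1 = solve-∀
      l2 : ∀ p x → 2400 * p * (2 * x) ≡ 4800 * (p * x)
      l2 = solve-∀
      l3 : ∀ x → 4800 * (5 * x) ≡ x * 24000
      l3 = solve-∀
      squares : suc l * suc l ≤ 100 * 2 ^ logSquare j
      squares = begin
        suc l * suc l        ≤⟨ *-mono-≤ 1+l≤ 1+l≤ ⟩
        5 * j * (5 * j)      ≡⟨ l4 j ⟩
        25 * (j * j)         ≤⟨ *-monoʳ-≤ 25 (logSquare≥ j (≤-trans 1≤j₀ j₀≤j)) ⟩
        25 * (4 * 2 ^ logSquare j) ≡⟨ *-assoc 25 4 (2 ^ logSquare j) ⟨
        100 * 2 ^ logSquare j      ∎
        where
        l4 : ∀ j → 5 * j * (5 * j) ≡ 25 * (j * j)
        l4 = solve-∀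
      P-grow : P * 2 ^ l ≤ 5 * (population l * 2 ^ j)
      P-grow = *-cancelˡ-≤ j (begin
        j * (P * 2 ^ l)                  ≡⟨ *-assoc j P (2 ^ l) ⟨
        j * P * 2 ^ l                    ≤⟨ grow j j₀≤j j≤l ⟩
        l * population l * 2 ^ j         ≤⟨ *-monoˡ-≤ (2 ^ j) (*-monoˡ-≤ (population l) (≤-trans (n≤1+n l) 1+l≤)) ⟩
        5 * j * population l * 2 ^ j     ≡⟨ l5 j (population l) (2 ^ j) ⟩
        j * (5 * (population l * 2 ^ j)) ∎)
        where
        l5 : ∀ j p x → 5 * j * p * x ≡ j * (5 * (p * x))
        l5 = solve-∀
      suc-d+j : suc d + j ≡ suc l
      suc-d+j = cong suc (trans (+-comm d j) j+d≡l)
      one : ∀ r → r < 2 ^ j →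
            count (2 ^ suc l) (λ a → Survives j (ancestor (suc d) a) × Hit (2 ^ j + r) (suc l) a) ≤ 24 * P
      one r r< = subst (λ k → count (2 ^ k) (λ a → Survives j (ancestor (suc d) a) × Hit (2 ^ j + r) k a) ≤ 24 * P) suc-d+j
        (hit-bound (2 ^ j + r) j (suc d) (Survives j) (m≤m+n _ r)
          (≤-trans (+-monoʳ-< (2 ^ j) r<) (≤-reflexive (cong (2 ^ j +_) (sym (+-identityʳ _))))))
      X≤ : X ≤ 24 * P * A
      X≤ = double-count (2 ^ suc l) (2 ^ j) (24 * P)
        (λ r a → Survives j (ancestor (suc d) a) × Hit (2 ^ j + r) (suc l) a)
        (λ a _ (s , _ , r , r< , on , hit) → r , r< , on ,
          survives-ancestor d j _ (subst (λ k → Survives k ⌊ a /2⌋) (sym (suc-injective suc-d+j)) s) , hit)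
        (λ r r< _ → one r r<)

    module Step (l : ℕ) (j₀≤l : j₀ ≤ l) (grow : Growing l) where
      open ≤-Reasoning
      private
        instance
          l≢0 : NonZero l
          l≢0 = >-nonZero (≤-trans 1≤j₀ j₀≤l)
        N = population l
        Struck′ : ℕ → ℕ → Set
        Struck′ j a = Survives l ⌊ a /2⌋ × Struck (suc l) j a
        z = count (2 ^ suc l) (Z (suc l))
        x = ∑ (suc l) λ j → count (2 ^ suc l) (Struck′ j)

      -- At level `j₀` every interval survives, so density times level starts with the value `j₀`,
      -- which is at least 1.
      dense : 2 ^ l ≤ l * N
      dense = *-cancelʳ-≤ _ _ (2 ^ j₀) {{2^≢0 j₀}} (begin
        2 ^ l * 2 ^ j₀                ≡⟨ *-comm (2 ^ l) (2 ^ j₀) ⟩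
        2 ^ j₀ * 2 ^ l                ≡⟨ cong (_* 2 ^ l) (early-population j₀ ≤-refl) ⟨
        population j₀ * 2 ^ l         ≤⟨ *-monoˡ-≤ (2 ^ l) (m≤n*m (population j₀) j₀ {{>-nonZero 1≤j₀}}) ⟩
        j₀ * population j₀ * 2 ^ l    ≤⟨ grow j₀ ≤-refl j₀≤l ⟩
        l * N * 2 ^ j₀                ∎)

      split : N * 2 ≤ population (suc l) + (z + x)
      split = begin
        N * 2                                     ≡⟨ count-half (2 ^ l) (Survives l) ⟨
        count (2 ^ l * 2) (λ a → Survives l ⌊ a /2⌋)  ≡⟨ cong (λ k → count k (λ a → Survives l ⌊ a /2⌋)) (*-comm (2 ^ l) 2) ⟩
        count (2 ^ suc l) (λ a → Survives l ⌊ a /2⌋)  ≤⟨ count-⊎ (2 ^ suc l) cases ⟩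
        population (suc l) + count (2 ^ suc l) (λ a → Survives l ⌊ a /2⌋ × Bad (suc l) a)
          ≤⟨ +-monoʳ-≤ (population (suc l)) (count-⊎ (2 ^ suc l) λ { a _ (s , inj₁ za) → inj₁ za
                                        ; a _ (s , inj₂ (j , j< , h)) → inj₂ (j , j< , s , h) }) ⟩
        population (suc l) + (z + count (2 ^ suc l) (λ a → ∃ λ j → j < suc l × Struck′ j a))
          ≤⟨ +-monoʳ-≤ (population (suc l)) (+-monoʳ-≤ z (union-bound (2 ^ suc l) (suc l) Struck′)) ⟩
        population (suc l) + (z + x) ∎
        where
        cases : ∀ a → a < 2 ^ suc l → Survives l ⌊ a /2⌋ →
                Survives (suc l) a ⊎ (Survives l ⌊ a /2⌋ × Bad (suc l) a)
        cases a _ s with em 0ℓ {Bad (suc l) a}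
        ... | yes b = inj₂ (s , b)
        ... | no ¬b = inj₁ (s , ¬b)

      -- Each of the l + 1 values of j costs at most N/(l+1)^2; one of the two factors l + 1 is
      -- spent on the sum over j.
      struck-total : suc l * x ≤ N
      struck-total = *-cancelˡ-≤ (suc l) (begin
        suc l * (suc l * x)                ≡⟨ *-assoc (suc l) (suc l) x ⟨
        suc l * suc l * x                  ≡⟨ ∑-*ˡ (suc l) (suc l * suc l) _ ⟨
        ∑ (suc l) (λ j → suc l * suc l * count (2 ^ suc l) (Struck′ j))
          ≤⟨ ∑-mono (suc l) (λ j j< → ≤-trans (≤-reflexive (*-comm (suc l * suc l) _)) (struck-few l j grow (≤-pred j<))) ⟩
        ∑ (suc l) (λ _ → N)                ≡⟨ ∑-const (suc l) N ⟩
        suc l * N                          ∎)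

      -- `Z-few` compares with all intervals instead of the survivors. By `dense` the difference is
      -- a factor l, which is why `Z-few` asks for a square.
      Z-total : suc l * z ≤ N
      Z-total = *-cancelˡ-≤ l (*-cancelˡ-≤ 2 (begin
        2 * (l * (suc l * z))     ≤⟨ *-monoʳ-≤ 2 (*-monoˡ-≤ (suc l * z) (n≤1+n l)) ⟩
        2 * (suc l * (suc l * z)) ≡⟨ l1 (suc l) z ⟩
        z * (2 * (suc l * suc l)) ≤⟨ Z-few (suc l) ⟩
        2 * 2 ^ l                 ≤⟨ *-monoʳ-≤ 2 dense ⟩
        2 * (l * N)               ∎))
        where
        l1 : ∀ m z → 2 * (m * (m * z)) ≡ z * (2 * (m * m))
        l1 = solve-∀

      -- The two obstacles take at most N/(l+1) each from the 2N children of survivors, so at least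
      -- 2N l/(l+1) are left.
      increase : l * N * 2 ≤ suc l * population (suc l)
      increase = +-cancelʳ-≤ (N * 2) _ _ (begin
        l * N * 2 + N * 2                      ≡⟨ l1 l N ⟩
        suc l * (N * 2)                        ≤⟨ *-monoʳ-≤ (suc l) split ⟩
        suc l * (population (suc l) + (z + x)) ≡⟨ l2 (suc l) (population (suc l)) z x ⟩
        suc l * population (suc l) + (suc l * z + suc l * x)
          ≤⟨ +-monoʳ-≤ (suc l * population (suc l)) (+-mono-≤ Z-total struck-total) ⟩
        suc l * population (suc l) + (N + N)   ≡⟨ cong (suc l * population (suc l) +_) (l3 N) ⟩
        suc l * population (suc l) + N * 2     ∎)
        where
        l1 : ∀ l n → l * n * 2 + n * 2 ≡ (1 + l) * (n * 2)
        l1 = solve-∀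
        l2 : ∀ m p z x → m * (p + (z + x)) ≡ m * p + (m * z + m * x)
        l2 = solve-∀
        l3 : ∀ n → n + n ≡ n * 2
        l3 = solve-∀

      grow′ : Growing (suc l)
      grow′ j j₀≤j j≤ with m≤n⇒m<n∨m≡n j≤
      ... | inj₂ refl = ≤-refl
      ... | inj₁ j<   = begin
        j * population j * (2 * 2 ^ l)    ≡⟨ l1 (j * population j) (2 ^ l) ⟩
        j * population j * 2 ^ l * 2      ≤⟨ *-monoˡ-≤ 2 (grow j j₀≤j (≤-pred j<)) ⟩
        l * N * 2 ^ j * 2                 ≡⟨ l2 (l * N) (2 ^ j) ⟩
        l * N * 2 * 2 ^ j                 ≤⟨ *-monoˡ-≤ (2 ^ j) increase ⟩
        suc l * population (suc l) * 2 ^ j ∎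
        where
        l1 : ∀ x y → x * (2 * y) ≡ x * y * 2
        l1 = solve-∀
        l2 : ∀ x y → x * y * 2 ≡ x * 2 * y
        l2 = solve-∀

    growing : ∀ d → Growing (d + j₀)
    growing zero    j j₀≤j j≤ with ≤-antisym j₀≤j j≤
    ... | refl = ≤-refl
    growing (suc d) = Step.grow′ (d + j₀) (m≤n+m j₀ d) (growing d)

    surviving-branch : Branch
    surviving-branch = branch λ d → d + j₀ , m≤m+n d j₀ ,
      0<m*n⇒0<n (d + j₀) (≤-trans (m^n>0 2 (d + j₀)) (Step.dense (d + j₀) (m≤n+m j₀ d) (growing d)))
      where
      0<m*n⇒0<n : ∀ m {n} → 0 < m * n → 0 < n
      0<m*n⇒0<n m {zero}  p = ⊥-elim (<-irrefl (sym (*-zeroʳ m)) p)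
      0<m*n⇒0<n m {suc n} p = s≤s z≤n

  -- Binary logarithms of natural numbers

  n<2^n : ∀ n → n < 2 ^ n
  n<2^n zero    = s≤s z≤n
  n<2^n (suc n) = +-mono-≤ (m^n>0 2 n) (≤-trans (n<2^n n) (≤-reflexive (sym (+-identityʳ _))))

  dyadic : ∀ n → 1 ≤ n → ∃ λ j → ∃ λ r → r < 2 ^ j × 2 ^ j + r ≡ n
  dyadic (suc zero)    _ = 0 , 0 , s≤s z≤n , refl
  dyadic (suc (suc n)) _ = next (dyadic (suc n) (s≤s z≤n))
    where
    next : (∃ λ j → ∃ λ r → r < 2 ^ j × 2 ^ j + r ≡ suc n) → ∃ λ j → ∃ λ r → r < 2 ^ j × 2 ^ j + r ≡ suc (suc n)
    next (j , r , r< , eq) with m≤n⇒m<n∨m≡n r<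
    ... | inj₁ 1+r< = j , suc r , 1+r< , trans (+-suc (2 ^ j) r) (cong suc eq)
    ... | inj₂ 1+r≡ = suc j , 0 , m^n>0 2 (suc j) , trans (lem (2 ^ j)) (trans (cong (2 ^ j +_) (sym 1+r≡))
                        (trans (+-suc (2 ^ j) r) (cong suc eq)))
      where
      lem : ∀ x → 2 * x + 0 ≡ x + x
      lem = solve-∀

  1≤2^+r : ∀ j r → 1 ≤ 2 ^ j + r
  1≤2^+r j r = ≤-trans (m^n>0 2 j) (m≤m+n _ r)

  2^+r< : ∀ j r → r < 2 ^ j → 2 ^ j + r < 2 ^ suc j
  2^+r< j r r< = ≤-trans (+-monoʳ-< (2 ^ j) r<) (≤-reflexive (cong (2 ^ j +_) (sym (+-identityʳ _))))

  -- Twice the binary logarithm, so that 2^logSquare j is about j^2.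
  module LogSquare where
    floorLog : ∀ j → ∃ λ m → m ≤ j × (1 ≤ j → 2 ^ m ≤ j × j < 2 ^ suc m)
    floorLog zero    = 0 , z≤n , λ ()
    floorLog (suc j) = pick (dyadic (suc j) (s≤s z≤n))
      where
      pick : (∃ λ m → ∃ λ r → r < 2 ^ m × 2 ^ m + r ≡ suc j) →
             ∃ λ m → m ≤ suc j × (1 ≤ suc j → 2 ^ m ≤ suc j × suc j < 2 ^ suc m)
      pick (m , r , r< , eq) = m , <⇒≤ (<-≤-trans (n<2^n m) 2^m≤) , λ _ → 2^m≤ , subst (_< 2 ^ suc m) eq (2^+r< m r r<)
        where
        2^m≤ : 2 ^ m ≤ suc j
        2^m≤ = ≤-trans (m≤m+n _ r) (≤-reflexive eq)

    logSquare : ℕ → ℕ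
    logSquare j = proj₁ (floorLog j) + proj₁ (floorLog j)

    logSquare≤ : ∀ j → logSquare j ≤ j + j
    logSquare≤ j = +-mono-≤ (proj₁ (proj₂ (floorLog j))) (proj₁ (proj₂ (floorLog j)))

    2^logSquare : ∀ j → 2 ^ logSquare j ≡ 2 ^ proj₁ (floorLog j) * 2 ^ proj₁ (floorLog j)
    2^logSquare j = ^-distribˡ-+-* 2 (proj₁ (floorLog j)) (proj₁ (floorLog j))

    2^logSquare≤ : ∀ j → 1 ≤ j → 2 ^ logSquare j ≤ j * j
    2^logSquare≤ j 1≤j = ≤-trans (≤-reflexive (2^logSquare j)) (*-mono-≤ m≤ m≤)
      where
      m≤ = proj₁ (proj₂ (proj₂ (floorLog j)) 1≤j)

    2^logSquare≥ : ∀ j → 1 ≤ j → j * j ≤ 4 * 2 ^ logSquare j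
    2^logSquare≥ j 1≤j = ≤-trans (*-mono-≤ (<⇒≤ j<) (<⇒≤ j<)) (≤-reflexive (trans (lem (2 ^ proj₁ (floorLog j))) (cong (4 *_) (sym (2^logSquare j)))))
      where
      j< = proj₂ (proj₂ (proj₂ (floorLog j)) 1≤j)
      lem : ∀ x → 2 * x * (2 * x) ≡ 4 * (x * x)
      lem = solve-∀

-- Real numbers and the embedding of the integers

module Analysis (em : ∀ ℓ → ExcludedMiddle ℓ) (𝓡 : CompleteOrderedField) where

  open import Data.Integer.Base as ℤ using (ℤ; +_; -[1+_])
  open Counting em
  open RealAnalysis em 𝓡

  open CommutativeRing commutativeRing public
    using (+-cong; +-congˡ; +-congʳ; +-comm; +-assoc; +-identityˡ; +-identityʳ; -‿cong; -‿inverseʳ;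
           *-cong; *-congˡ; *-congʳ; *-comm; *-assoc; *-identityˡ; *-identityʳ; zeroˡ; zeroʳ; distribˡ; distribʳ; ring)
    renaming (refl to ≈-refl; reflexive to ≈-reflexive; sym to ≈-sym; trans to ≈-trans)
  open IsTotalOrder isTotalOrder public
    using (≤-respˡ-≈; ≤-respʳ-≈)
    renaming (refl to ≤-refl; reflexive to ≤-reflexive; trans to ≤-trans; antisym to ≤-antisym; total to ≤-total)

  open import Algebra.Properties.Semiring.Mult semiring using (×-homo-+; ×1-homo-*)
  open import Algebra.Properties.Ring ring using (-‿distribˡ-*; -0#≈0#; -‿involutive)

  byContra : ∀ {ℓ} {P : Set ℓ} → ¬ ¬ P → P
  byContra {ℓ} {P} ¬¬p with em ℓ {P}
  ... | yes p = p
  ... | no ¬p = contradiction ¬p ¬¬p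

  the-spec : ∀ {ℓ} {A : Set} (d : A) {P : Pred A ℓ} → ∃ P → P (the d P)
  the-spec {ℓ} d {P} x with em ℓ {∃ P}
  ... | yes (_ , p) = p
  ... | no ¬p       = contradiction x ¬p

  fromℕ-+ : ∀ m n → fromℕ (m ℕ.+ n) ≈ fromℕ m + fromℕ n
  fromℕ-+ m n = ×-homo-+ 1# m n

  fromℕ-* : ∀ m n → fromℕ (m ℕ.* n) ≈ fromℕ m * fromℕ n
  fromℕ-* = ×1-homo-*

  private
    +-cancel-diff : ∀ x y z → (x + y) - (x + z) ≈ y - z
    +-cancel-diff x y z = begin
      (x + y) + - (x + z)       ≈⟨ +-congˡ (⁻¹-∙-comm x z) ⟨
      (x + y) + (- x + - z)     ≈⟨ +-congʳ (+-comm x y) ⟩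
      (y + x) + (- x + - z)     ≈⟨ +-assoc y x _ ⟩
      y + (x + (- x + - z))     ≈⟨ +-congˡ (+-assoc x (- x) (- z)) ⟨
      y + ((x + - x) + - z)     ≈⟨ +-congˡ (+-congʳ (-‿inverseʳ x)) ⟩
      y + (0# + - z)            ≈⟨ +-congˡ (+-identityˡ (- z)) ⟩
      y + - z                   ∎
      where
      open import Algebra.Properties.AbelianGroup (CommutativeRing.+-abelianGroup commutativeRing) using (⁻¹-∙-comm)
      open import Relation.Binary.Reasoning.Setoid (CommutativeRing.setoid commutativeRing)

  fromℤ-neg : ∀ i → fromℤ (ℤ.- i) ≈ - fromℤ i
  fromℤ-neg (+ zero)  = ≈-sym -0#≈0#
  fromℤ-neg (+ suc n) = ≈-refl
  fromℤ-neg -[1+ n ]  = ≈-sym (-‿involutive _)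

  fromℤ-⊖ : ∀ m n → fromℤ (m ℤ.⊖ n) ≈ fromℕ m - fromℕ n
  fromℤ-⊖ zero    zero    = ≈-sym (-‿inverseʳ 0#)
  fromℤ-⊖ zero    (suc n) = ≈-sym (+-identityˡ _)
  fromℤ-⊖ (suc m) zero    = ≈-sym (≈-trans (+-congˡ -0#≈0#) (+-identityʳ _))
  fromℤ-⊖ (suc m) (suc n) = ≈-trans (≈-reflexive (≡.cong fromℤ (ℤₚ.[1+m]⊖[1+n]≡m⊖n m n)))
    (≈-trans (fromℤ-⊖ m n) (≈-sym (+-cancel-diff 1# (fromℕ m) (fromℕ n))))

  fromℤ-+ : ∀ i j → fromℤ (i ℤ.+ j) ≈ fromℤ i + fromℤ j
  fromℤ-+ (+ m)    (+ n)    = fromℕ-+ m n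
  fromℤ-+ (+ m)    -[1+ n ] = fromℤ-⊖ m (suc n)
  fromℤ-+ -[1+ m ] (+ n)    = ≈-trans (fromℤ-⊖ n (suc m)) (+-comm _ _)
  fromℤ-+ -[1+ m ] -[1+ n ] = ≈-trans (-‿cong (≈-trans (+-congˡ (≈-trans (+-congˡ (fromℕ-+ m n)) (≈-sym (+-assoc 1# _ _))))
      (≈-trans (≈-sym (+-assoc 1# (fromℕ (suc m)) (fromℕ n)))
      (≈-trans (+-congʳ (+-comm 1# (fromℕ (suc m)))) (+-assoc (fromℕ (suc m)) 1# (fromℕ n))))))
      (≈-sym (⁻¹-∙-comm _ _))
    where open import Algebra.Properties.AbelianGroup (CommutativeRing.+-abelianGroup commutativeRing) using (⁻¹-∙-comm)

  private
    fromℤ-*⁺ : ∀ m j → fromℤ (+ m ℤ.* j) ≈ fromℕ m * fromℤ j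
    fromℤ-*⁺ m (+ n) = ≈-trans (≈-reflexive (≡.cong fromℤ (≡.sym (ℤₚ.pos-* m n)))) (fromℕ-* m n)
    fromℤ-*⁺ m -[1+ n ] = ≈-trans (≈-reflexive (≡.cong fromℤ (≡.sym (ℤₚ.neg-distribʳ-* (+ m) (+ suc n)))))
      (≈-trans (fromℤ-neg (+ m ℤ.* + suc n)) (≈-trans (-‿cong (fromℤ-*⁺ m (+ suc n))) (-‿distribʳ-* _ _)))
      where
      open import Algebra.Properties.Ring ring using (-‿distribʳ-*)

  fromℤ-* : ∀ i j → fromℤ (i ℤ.* j) ≈ fromℤ i * fromℤ j
  fromℤ-* (+ m)    j = fromℤ-*⁺ m j
  fromℤ-* -[1+ m ] j = ≈-trans (≈-reflexive (≡.cong fromℤ (≡.sym (ℤₚ.neg-distribˡ-* (+ suc m) j))))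
    (≈-trans (fromℤ-neg (+ suc m ℤ.* j)) (≈-trans (-‿cong (fromℤ-*⁺ (suc m) j)) (-‿distribˡ-* _ _)))

  -- Agrees with fromℤ but sends 1 to 1# on the nose, so that solver constants match the goals.
  coefficient : ℤ → ℝ
  coefficient (+ zero)        = 0#
  coefficient (+ suc zero)    = 1#
  coefficient (+ suc (suc n)) = fromℕ (suc (suc n))
  coefficient -[1+ n ]        = - fromℕ (suc n)

  coefficient≈fromℤ : ∀ i → coefficient i ≈ fromℤ i
  coefficient≈fromℤ (+ zero)        = ≈-refl
  coefficient≈fromℤ (+ suc zero)    = ≈-sym (+-identityʳ 1#)
  coefficient≈fromℤ (+ suc (suc n)) = ≈-refl
  coefficient≈fromℤ -[1+ n ]        = ≈-refl

  private
    ℤ-rawRing : RawRing 0ℓ 0ℓ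
    ℤ-rawRing = record { Carrier = ℤ ; _≈_ = _≡_ ; _+_ = ℤ._+_ ; _*_ = ℤ._*_ ; -_ = ℤ.-_ ; 0# = + 0 ; 1# = + 1 }

    ℤ⟶ℝ : ℤ-rawRing -Raw-AlmostCommutative⟶ fromCommutativeRing commutativeRing
    ℤ⟶ℝ = record
      { ⟦_⟧    = coefficient
      ; +-homo = λ i j → hom₂ (i ℤ.+ j) (fromℤ-+ i j) (+-cong (coefficient≈fromℤ i) (coefficient≈fromℤ j))
      ; *-homo = λ i j → hom₂ (i ℤ.* j) (fromℤ-* i j) (*-cong (coefficient≈fromℤ i) (coefficient≈fromℤ j))
      ; -‿homo = λ i → ≈-trans (coefficient≈fromℤ (ℤ.- i)) (≈-trans (fromℤ-neg i) (-‿cong (≈-sym (coefficient≈fromℤ i))))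
      ; 0-homo = ≈-refl
      ; 1-homo = ≈-refl
      }
      where
      hom₂ : ∀ k {x y} → fromℤ k ≈ x → y ≈ x → coefficient k ≈ y
      hom₂ k p q = ≈-trans (coefficient≈fromℤ k) (≈-trans p (≈-sym q))

    coefficient≟ : ∀ i j → Maybe (coefficient i ≈ coefficient j)
    coefficient≟ i j with i ℤₚ.≟ j
    ... | yes ≡.refl = just ≈-refl
    ... | no _       = nothing

  open import Algebra.Solver.Ring ℤ-rawRing (fromCommutativeRing commutativeRing) ℤ⟶ℝ coefficient≟ public
    using (solve; _:=_; _:+_; _:*_; :-_; _:-_; con)


  -- Order, inverses and the Archimedean property

  0≤y-x : ∀ {x y} → x ≤ y → 0# ≤ y - x
  0≤y-x {x} {y} x≤y = ≤-respˡ-≈ (-‿inverseʳ x) (+-monoˡ-≤ (- x) x≤y)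

  -- The standard way to an inequality below: w is a visibly nonnegative expression, and the ring
  -- solver identifies it with the difference.
  ≤-by : ∀ {x y w} → 0# ≤ w → y - x ≈ w → x ≤ y
  ≤-by {x} {y} {w} 0≤w eq = ≤-respˡ-≈ (+-identityˡ x) (≤-respʳ-≈ lem (+-monoˡ-≤ x 0≤w))
    where
    lem : w + x ≈ y
    lem = ≈-trans (+-congʳ (≈-sym eq)) (solve 2 (λ x y → y :- x :+ x := y) ≈-refl x y)

  +-mono-≤ : ∀ {x y u v} → x ≤ y → u ≤ v → x + u ≤ y + v
  +-mono-≤ {x} {y} {u} {v} x≤y u≤v = ≤-trans (+-monoˡ-≤ u x≤y)
    (≤-respˡ-≈ (+-comm u y) (≤-respʳ-≈ (+-comm v y) (+-monoˡ-≤ y u≤v)))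

  +-monoʳ-≤ : ∀ x {u v} → u ≤ v → x + u ≤ x + v
  +-monoʳ-≤ x = +-mono-≤ ≤-refl

  +-nonNeg : ∀ {x y} → 0# ≤ x → 0# ≤ y → 0# ≤ x + y
  +-nonNeg p q = ≤-respˡ-≈ (+-identityˡ 0#) (+-mono-≤ p q)

  neg-mono-≤ : ∀ {x y} → x ≤ y → - y ≤ - x
  neg-mono-≤ {x} {y} x≤y = ≤-by (0≤y-x x≤y) (solve 2 (λ x y → :- x :- :- y := y :- x) ≈-refl x y)

  neg-swap-≤ : ∀ {x y} → - x ≤ y → - y ≤ x
  neg-swap-≤ {x} p = ≤-respʳ-≈ (solve 1 (λ x → :- :- x := x) ≈-refl x) (neg-mono-≤ p)

  *-monoˡ-≤ : ∀ {x y z} → 0# ≤ z → x ≤ y → z * x ≤ z * y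
  *-monoˡ-≤ {x} {y} {z} 0≤z x≤y = ≤-by (*-nonNeg 0≤z (0≤y-x x≤y))
    (solve 3 (λ x y z → z :* y :- z :* x := z :* (y :- x)) ≈-refl x y z)

  *-monoʳ-≤ : ∀ {x y z} → 0# ≤ z → x ≤ y → x * z ≤ y * z
  *-monoʳ-≤ {x} {y} {z} 0≤z x≤y = ≤-respˡ-≈ (*-comm z x) (≤-respʳ-≈ (*-comm z y) (*-monoˡ-≤ 0≤z x≤y))

  *-mono-≤ : ∀ {x y u v} → 0# ≤ x → x ≤ y → 0# ≤ u → u ≤ v → x * u ≤ y * v
  *-mono-≤ 0≤x x≤y 0≤u u≤v = ≤-trans (*-monoʳ-≤ 0≤u x≤y) (*-monoˡ-≤ (≤-trans 0≤x x≤y) u≤v)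

  invertible : ∀ {x} → ¬ x ≈ 0# → ∃ λ y → x * y ≈ 1#
  invertible {x} x≉0 with em 0ℓ {x # 0#}
  ... | no ¬# = contradiction (proj₁ (HeytingField.tight heytingField x 0#) ¬#) x≉0
  ... | yes x#0 with HeytingField.#⇒invertible heytingField x#0
  ...   | y , _ , eq = y , ≈-trans (*-congʳ (solve 1 (λ x → x := x :- con (+ 0)) ≈-refl x)) eq

  1≉0 : ¬ 1# ≈ 0#
  1≉0 eq = proj₂ (HeytingField.tight heytingField 1# 0#) eq (HeytingField.invertible⇒# heytingField
    (1# , solve 0 (con (+ 1) :* (con (+ 1) :- con (+ 0)) := con (+ 1)) ≈-refl
        , solve 0 ((con (+ 1) :- con (+ 0)) :* con (+ 1) := con (+ 1)) ≈-refl))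

  0≤1 : 0# ≤ 1#
  0≤1 with ≤-total 0# 1#
  ... | inj₁ p = p
  -- In this case 0 - 1 is nonnegative, and its square is 1.
  ... | inj₂ p = ≤-respʳ-≈ (solve 0 ((con (+ 0) :- con (+ 1)) :* (con (+ 0) :- con (+ 1)) := con (+ 1)) ≈-refl)
                   (*-nonNeg (0≤y-x p) (0≤y-x p))

  0<1 : 0# < 1#
  0<1 = 0≤1 , λ eq → 1≉0 (≈-sym eq)

  <⇒≤ : ∀ {x y} → x < y → x ≤ y
  <⇒≤ = proj₁

  <⇒≱ : ∀ {x y} → x < y → ¬ y ≤ x
  <⇒≱ (x≤y , x≉y) y≤x = x≉y (≤-antisym x≤y y≤x)

  ≰⇒> : ∀ {x y} → ¬ x ≤ y → y < x
  ≰⇒> = Strict.≰⇒> _≈_ _≤_ ≈-sym ≤-reflexive ≤-total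

  ≮⇒≥ : ∀ {x y} → ¬ x < y → y ≤ x
  ≮⇒≥ ¬p = byContra λ ¬q → ¬p (≰⇒> ¬q)

  <-≤-trans : ∀ {x y z} → x < y → y ≤ z → x < z
  <-≤-trans = Strict.<-≤-trans _≈_ _≤_ ≈-sym ≤-trans ≤-antisym ≤-respʳ-≈

  ≤-<-trans : ∀ {x y z} → x ≤ y → y < z → x < z
  ≤-<-trans = Strict.≤-<-trans _≈_ _≤_ ≤-trans ≤-antisym ≤-respˡ-≈

  <-trans : ∀ {x y z} → x < y → y < z → x < z
  <-trans p q = <-≤-trans p (<⇒≤ q)

  <-irrefl : ∀ {x} → ¬ x < x
  <-irrefl p = proj₂ p ≈-refl

  ≤⊎> : ∀ x y → x ≤ y ⊎ y < x
  ≤⊎> x y with em 0ℓ {x ≤ y}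
  ... | yes p = inj₁ p
  ... | no ¬p = inj₂ (≰⇒> ¬p)

  pos⇒≉0 : ∀ {x} → 0# < x → ¬ x ≈ 0#
  pos⇒≉0 p eq = proj₂ p (≈-sym eq)

  <-respʳ-≈ : ∀ {x y z} → y ≈ z → x < y → x < z
  <-respʳ-≈ eq p = <-≤-trans p (≤-reflexive eq)

  <-respˡ-≈ : ∀ {x y z} → y ≈ z → y < x → z < x
  <-respˡ-≈ eq p = ≤-<-trans (≤-reflexive (≈-sym eq)) p

  0<y-x : ∀ {x y} → x < y → 0# < y - x
  0<y-x {x} {y} x<y = ≰⇒> λ p → <⇒≱ x<y (≤-by (≤-trans 0≤0 (neg-mono-≤ p))
    (solve 2 (λ x y → x :- y := :- (y :- x)) ≈-refl x y))
    where
    0≤0 : 0# ≤ - 0#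
    0≤0 = ≤-reflexive (solve 0 (con (+ 0) := :- con (+ 0)) ≈-refl)

  <-by : ∀ {x y w} → 0# < w → y - x ≈ w → x < y
  <-by {x} {y} 0<w eq = ≤-by (<⇒≤ 0<w) eq ,
    λ x≈y → proj₂ 0<w (≈-sym (≈-trans (≈-sym eq) (≈-trans (+-congˡ (-‿cong x≈y)) (-‿inverseʳ y))))

  *-pos : ∀ {x y} → 0# < x → 0# < y → 0# < x * y
  *-pos {x} {y} 0<x 0<y = *-nonNeg (<⇒≤ 0<x) (<⇒≤ 0<y) , λ 0≈xy → pos⇒≉0 0<y (y≈0 (≈-sym 0≈xy))
    where
    y≈0 : x * y ≈ 0# → y ≈ 0#
    y≈0 eq with invertible (pos⇒≉0 0<x)
    ... | z , xz≈1 = ≈-trans (≈-trans (≈-sym (*-identityˡ y)) (*-congʳ (≈-sym xz≈1)))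
      (≈-trans (solve 3 (λ x y z → x :* z :* y := z :* (x :* y)) ≈-refl x y z) (≈-trans (*-congˡ eq) (zeroʳ z)))

  +-pos-nonNeg : ∀ {x y} → 0# < x → 0# ≤ y → 0# < x + y
  +-pos-nonNeg {x} {y} p q = <-≤-trans p (≤-by q (solve 2 (λ x y → x :+ y :- x := y) ≈-refl x y))

  *-monoˡ-< : ∀ {x y z} → 0# < z → x < y → z * x < z * y
  *-monoˡ-< {x} {y} {z} 0<z x<y = <-by (*-pos 0<z (0<y-x x<y))
    (solve 3 (λ x y z → z :* y :- z :* x := z :* (y :- x)) ≈-refl x y z)

  *-monoʳ-< : ∀ {x y z} → 0# < z → x < y → x * z < y * z
  *-monoʳ-< {x} {y} {z} 0<z x<y = <-respˡ-≈ (*-comm z x) (<-respʳ-≈ (*-comm z y) (*-monoˡ-< 0<z x<y))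

  *-cancelˡ-≤ : ∀ {x y z} → 0# < z → z * x ≤ z * y → x ≤ y
  *-cancelˡ-≤ 0<z p = byContra λ ¬q → <⇒≱ (*-monoˡ-< 0<z (≰⇒> ¬q)) p

  *-cancelˡ-< : ∀ {x y z} → 0# < z → z * x < z * y → x < y
  *-cancelˡ-< 0<z p = ≰⇒> λ q → <⇒≱ p (*-monoˡ-≤ (<⇒≤ 0<z) q)

  +-monoʳ-< : ∀ {x y} z → x < y → z + x < z + y
  +-monoʳ-< {x} {y} z p = <-by (0<y-x p) (solve 3 (λ x y z → z :+ y :- (z :+ x) := y :- x) ≈-refl x y z)

  +-mono-<-≤ : ∀ {x y u v} → x < y → u ≤ v → x + u < y + v
  +-mono-<-≤ {x} {y} {u} {v} p q = <-by (+-pos-nonNeg (0<y-x p) (0≤y-x q))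
    (solve 4 (λ x y u v → y :+ v :- (x :+ u) := (y :- x) :+ (v :- u)) ≈-refl x y u v)

  ⁻¹-inverse : ∀ {x} → ¬ x ≈ 0# → x * x ⁻¹ ≈ 1#
  ⁻¹-inverse x≉0 = the-spec 0# (invertible x≉0)

  ⁻¹-pos : ∀ {x} → 0# < x → 0# < x ⁻¹
  ⁻¹-pos {x} 0<x = *-cancelˡ-< 0<x
    (<-respˡ-≈ (≈-sym (zeroʳ x)) (<-respʳ-≈ (≈-sym (⁻¹-inverse (pos⇒≉0 0<x))) 0<1))

  fromℕ-nonNeg : ∀ n → 0# ≤ fromℕ n
  fromℕ-nonNeg zero    = ≤-refl
  fromℕ-nonNeg (suc n) = +-nonNeg 0≤1 (fromℕ-nonNeg n)

  fromℕ-pos : ∀ {n} → 1 ℕ.≤ n → 0# < fromℕ n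
  fromℕ-pos {suc n} _ = +-pos-nonNeg 0<1 (fromℕ-nonNeg n)

  fromℕ-mono : ∀ {m n} → m ℕ.≤ n → fromℕ m ≤ fromℕ n
  fromℕ-mono {n = n} ℕ.z≤n = fromℕ-nonNeg n
  fromℕ-mono (ℕ.s≤s p)     = +-monoʳ-≤ 1# (fromℕ-mono p)

  fromℕ-mono-< : ∀ {m n} → m ℕ.< n → fromℕ m < fromℕ n
  fromℕ-mono-< {m} p = <-≤-trans (<-by 0<1 (solve 1 (λ x → con (+ 1) :+ x :- x := con (+ 1)) ≈-refl (fromℕ m)))
                                 (fromℕ-mono p)

  fromℕ-cancel : ∀ {m n} → fromℕ m ≤ fromℕ n → m ℕ.≤ n
  fromℕ-cancel p = ℕₚ.≮⇒≥ λ q → <⇒≱ (fromℕ-mono-< q) p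

  fromℕ-cancel-< : ∀ {m n} → fromℕ m < fromℕ n → m ℕ.< n
  fromℕ-cancel-< p = ℕₚ.≰⇒> λ q → <⇒≱ p (fromℕ-mono q)

  -- If the natural numbers had a least upper bound s, then s - 1 would be an upper bound as well.
  archimedean : ∀ x → ∃ λ n → x < fromℕ n
  archimedean x = byContra λ none →
    let bounded : ∃ λ b → ∀ y → (∃ λ n → y ≈ fromℕ n) → y ≤ b
        bounded = x , λ { y (n , eq) → ≤-respˡ-≈ (≈-sym eq) (≮⇒≥ λ p → none (n , p)) }
        s , ub , least = lub (λ y → ∃ λ n → y ≈ fromℕ n) (0# , 0 , ≈-refl) bounded
        smaller : s ≤ s - 1#
        smaller = least (s - 1#) λ { y (n , eq) → ≤-by (0≤y-x (ub (fromℕ (suc n)) (suc n , ≈-refl)))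
          (≈-trans (+-congˡ (-‿cong eq)) (solve 2 (λ s n → s :- con (+ 1) :- n := s :- (con (+ 1) :+ n)) ≈-refl s (fromℕ n))) }
    in <⇒≱ (<-by 0<1 (solve 1 (λ s → s :- (s :- con (+ 1)) := con (+ 1)) ≈-refl s)) smaller

  -- Absolute value, floor and distance to the nearest integer

  private
    module Mx = Max totalOrder

  x≤∣x∣ : ∀ x → x ≤ ∣ x ∣
  x≤∣x∣ x = Mx.x≤x⊔y x (- x)

  -x≤∣x∣ : ∀ x → - x ≤ ∣ x ∣
  -x≤∣x∣ x = Mx.x≤y⊔x x (- x)

  ∣∣-lub : ∀ {x a} → x ≤ a → - x ≤ a → ∣ x ∣ ≤ a
  ∣∣-lub = Mx.⊔-lub

  ∣∣-lub-< : ∀ {x a} → x < a → - x < a → ∣ x ∣ < a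
  ∣∣-lub-< {x} p q with Mx.⊔-sel x (- x)
  ... | inj₁ eq = <-respˡ-≈ (≈-sym eq) p
  ... | inj₂ eq = <-respˡ-≈ (≈-sym eq) q

  ∣∣-cong : ∀ {x y} → x ≈ y → ∣ x ∣ ≈ ∣ y ∣
  ∣∣-cong eq = Mx.⊔-cong eq (-‿cong eq)

  ∣∣-nonNeg : ∀ x → 0# ≤ ∣ x ∣
  ∣∣-nonNeg x with ≤-total 0# x
  ... | inj₁ p = ≤-trans p (x≤∣x∣ x)
  ... | inj₂ p = ≤-trans (≤-respˡ-≈ (solve 0 (:- con (+ 0) := con (+ 0)) ≈-refl) (neg-mono-≤ p)) (-x≤∣x∣ x)

  ∣∣-of-nonNeg : ∀ {x} → 0# ≤ x → ∣ x ∣ ≈ x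
  ∣∣-of-nonNeg {x} p = ≤-antisym (∣∣-lub ≤-refl (≤-by (+-nonNeg p p) (solve 1 (λ x → x :- :- x := x :+ x) ≈-refl x))) (x≤∣x∣ x)

  ∣∣-+ : ∀ x y → ∣ x + y ∣ ≤ ∣ x ∣ + ∣ y ∣
  ∣∣-+ x y = ∣∣-lub (+-mono-≤ (x≤∣x∣ x) (x≤∣x∣ y))
    (≤-respˡ-≈ (solve 2 (λ x y → :- x :+ :- y := :- (x :+ y)) ≈-refl x y) (+-mono-≤ (-x≤∣x∣ x) (-x≤∣x∣ y)))

  private
    unhalve : ∀ {z} → 0# ≤ z + z → 0# ≤ z
    unhalve {z} p = *-cancelˡ-≤ (fromℕ-pos {2} (ℕ.s≤s ℕ.z≤n))
      (≤-respˡ-≈ (≈-sym (zeroʳ _)) (≤-respʳ-≈ (solve 1 (λ z → z :+ z := con (+ 2) :* z) ≈-refl z) p))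

  -- Twice the gap is a sum of two products of the nonnegative numbers |x| ± x and |y| ± y, which
  -- spares a case distinction on signs.
  ∣∣-* : ∀ x y → ∣ x * y ∣ ≤ ∣ x ∣ * ∣ y ∣
  ∣∣-* x y = ∣∣-lub
    (≤-by (unhalve (≤-respʳ-≈ (solve 4 (λ X Y x y → (X :- x) :* (Y :- :- y) :+ (X :- :- x) :* (Y :- y) :=
             (X :* Y :- x :* y) :+ (X :* Y :- x :* y)) ≈-refl (∣ x ∣) (∣ y ∣) x y)
           (+-nonNeg (*-nonNeg x⁻ y⁺) (*-nonNeg x⁺ y⁻)))) ≈-refl)
    (≤-by (unhalve (≤-respʳ-≈ (solve 4 (λ X Y x y → (X :- x) :* (Y :- y) :+ (X :- :- x) :* (Y :- :- y) :=
             (X :* Y :- :- (x :* y)) :+ (X :* Y :- :- (x :* y))) ≈-refl (∣ x ∣) (∣ y ∣) x y)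
           (+-nonNeg (*-nonNeg x⁻ y⁻) (*-nonNeg x⁺ y⁺)))) ≈-refl)
    where
    x⁻ = 0≤y-x (x≤∣x∣ x)
    x⁺ = 0≤y-x (-x≤∣x∣ x)
    y⁻ = 0≤y-x (x≤∣x∣ y)
    y⁺ = 0≤y-x (-x≤∣x∣ y)

  ∣∣-scale : ∀ {a} b → 0# ≤ a → a * ∣ b ∣ ≤ ∣ a * b ∣
  ∣∣-scale {a} b 0≤a = [ nonNeg , nonPos ]′ (≤-total 0# b)
    where
    lem₁ : ∀ a b → - (a * b) ≈ a * - b
    lem₁ = solve 2 (λ a b → :- (a :* b) := a :* :- b) ≈-refl
    lem₂ : ∀ b → 0# - b ≈ - b
    lem₂ = solve 1 (λ b → con (+ 0) :- b := :- b) ≈-refl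
    nonNeg : 0# ≤ b → a * ∣ b ∣ ≤ ∣ a * b ∣
    nonNeg p = ≤-respˡ-≈ (*-congˡ (≈-sym (∣∣-of-nonNeg p))) (x≤∣x∣ (a * b))
    nonPos : b ≤ 0# → a * ∣ b ∣ ≤ ∣ a * b ∣
    nonPos p = ≤-trans (*-monoˡ-≤ 0≤a (∣∣-lub (≤-trans p (≤-respʳ-≈ (lem₂ b) (0≤y-x p))) ≤-refl))
                       (≤-respˡ-≈ (lem₁ a b) (-x≤∣x∣ (a * b)))

  glb : ∀ (S : Pred ℝ 0ℓ) → ∃ (λ x → x ∈ S) → ∃ (λ b → ∀ x → x ∈ S → b ≤ x) → ∃ (IsGLB _≤_ S)
  glb S (x , x∈S) (b , b≤) with lub (λ y → ∃ λ x → x ∈ S × y ≈ - x) (- x , x , x∈S , ≈-refl)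
                                  (- b , λ { y (z , z∈S , eq) → ≤-respˡ-≈ (≈-sym eq) (neg-mono-≤ (b≤ z z∈S)) })
  ... | s , ub , least = - s , (λ z z∈S → neg-swap-≤ (ub (- z) (z , z∈S , ≈-refl))) ,
    λ c c≤ → ≤-respˡ-≈ (-‿involutive c) (neg-mono-≤ (least (- c)
               λ { y (z , z∈S , eq) → ≤-respˡ-≈ (≈-sym eq) (neg-mono-≤ (c≤ z z∈S)) }))

  private
    ‖‖-spec : ∀ x → IsGLB _≤_ (λ d → ∃ λ (n : ℤ) → d ≈ ∣ x - fromℤ n ∣) ‖ x ‖
    ‖‖-spec x = the-spec 0# (glb _ (_ , + 0 , ≈-refl) (0# , λ { d (n , eq) → ≤-respʳ-≈ (≈-sym eq) (∣∣-nonNeg _) }))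

  ‖‖-≤ : ∀ x n → ‖ x ‖ ≤ ∣ x - fromℤ n ∣
  ‖‖-≤ x n = proj₁ (‖‖-spec x) _ (n , ≈-refl)

  ‖‖-glb : ∀ x {c} → (∀ n → c ≤ ∣ x - fromℤ n ∣) → c ≤ ‖ x ‖
  ‖‖-glb x {c} h = proj₂ (‖‖-spec x) c λ { d (n , eq) → ≤-respʳ-≈ (≈-sym eq) (h n) }

  ‖‖-nonNeg : ∀ x → 0# ≤ ‖ x ‖
  ‖‖-nonNeg x = ‖‖-glb x λ n → ∣∣-nonNeg _

  ‖‖-approx : ∀ x {c} → ‖ x ‖ < c → ∃ λ n → ∣ x - fromℤ n ∣ < c
  ‖‖-approx x {c} p = byContra λ none → <⇒≱ p (‖‖-glb x λ n → ≮⇒≥ λ q → none (n , q))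

  floorℕ : ∀ x → 0# ≤ x → ∃ λ n → fromℕ n ≤ x × x < fromℕ (suc n)
  floorℕ x 0≤x = search (proj₁ (archimedean x)) (proj₂ (archimedean x))
    where
    search : ∀ n → x < fromℕ n → ∃ λ n → fromℕ n ≤ x × x < fromℕ (suc n)
    search zero    x<0 = ⊥-elim (<⇒≱ x<0 0≤x)
    search (suc n) x<  with ≤⊎> (fromℕ n) x
    ... | inj₁ p = n , p , x<
    ... | inj₂ p = search n p

  floor : ∀ x → ∃ λ i → fromℤ i ≤ x × x < fromℤ i + 1#
  floor x = shifted (archimedean (- x))
    where
    eq : ∀ n m → fromℤ (+ n ℤ.- + m) ≈ fromℕ n - fromℕ m
    eq n m = ≈-trans (fromℤ-+ (+ n) (ℤ.- + m)) (+-congˡ (fromℤ-neg (+ m)))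
    lem₁ : ∀ x n m → x - (n - m) ≈ x + m - n
    lem₁ = solve 3 (λ x n m → x :- (n :- m) := x :+ m :- n) ≈-refl
    lem₂ : ∀ x n m → n - m + 1# - x ≈ 1# + n - (x + m)
    lem₂ = solve 3 (λ x n m → n :- m :+ con (+ 1) :- x := con (+ 1) :+ n :- (x :+ m)) ≈-refl
    lem₃ : ∀ x m → x + m - 0# ≈ m - - x
    lem₃ = solve 2 (λ x m → x :+ m :- con (+ 0) := m :- :- x) ≈-refl
    unshifted : ∀ m → (∃ λ n → fromℕ n ≤ x + fromℕ m × x + fromℕ m < fromℕ (suc n)) →
                ∃ λ i → fromℤ i ≤ x × x < fromℤ i + 1#
    unshifted m (n , lo , hi) = + n ℤ.- + m ,
      ≤-respˡ-≈ (≈-sym (eq n m)) (≤-by (0≤y-x lo) (lem₁ x (fromℕ n) (fromℕ m))) ,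
      <-respʳ-≈ (+-congʳ (≈-sym (eq n m))) (<-by (0<y-x hi) (lem₂ x (fromℕ n) (fromℕ m)))
    shifted : (∃ λ m → - x < fromℕ m) → ∃ λ i → fromℤ i ≤ x × x < fromℤ i + 1#
    shifted (m , -x<m) = unshifted m (floorℕ (x + fromℕ m) (≤-by (<⇒≤ (0<y-x -x<m)) (lem₃ x (fromℕ m))))

  -- The crude bound 1 in place of 1/2 is all that `scale` asks for.
  ‖‖≤1 : ∀ x → ‖ x ‖ ≤ 1#
  ‖‖≤1 x = bound (floor x)
    where
    lem₁ : ∀ x i → 1# - (x - i) ≈ i + 1# - x
    lem₁ = solve 2 (λ x i → con (+ 1) :- (x :- i) := i :+ con (+ 1) :- x) ≈-refl
    lem₂ : ∀ x i → 0# - - (x - i) ≈ x - i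
    lem₂ = solve 2 (λ x i → con (+ 0) :- :- (x :- i) := x :- i) ≈-refl
    bound : (∃ λ i → fromℤ i ≤ x × x < fromℤ i + 1#) → ‖ x ‖ ≤ 1#
    bound (i , lo , hi) = ≤-trans (‖‖-≤ x i) (∣∣-lub
      (≤-by (<⇒≤ (0<y-x hi)) (lem₁ x (fromℤ i)))
      (≤-trans (≤-by (0≤y-x lo) (lem₂ x (fromℤ i))) 0≤1))

  -- Powers of two and dyadic scales

  pow2 : ℕ → ℝ
  pow2 n = fromℕ (2 ℕ.^ n)

  pow2-pos : ∀ n → 0# < pow2 n
  pow2-pos n = fromℕ-pos (ℕₚ.m^n>0 2 n)

  pow2-suc : ∀ n → pow2 (suc n) ≈ fromℕ 2 * pow2 n
  pow2-suc n = fromℕ-* 2 (2 ℕ.^ n)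

  pow2-+ : ∀ m n → pow2 (m ℕ.+ n) ≈ pow2 m * pow2 n
  pow2-+ m n = ≈-trans (≈-reflexive (≡.cong fromℕ (ℕₚ.^-distribˡ-+-* 2 m n))) (fromℕ-* (2 ℕ.^ m) (2 ℕ.^ n))

  pow2-mono : ∀ {m n} → m ℕ.≤ n → pow2 m ≤ pow2 n
  pow2-mono p = fromℕ-mono (ℕₚ.^-monoʳ-≤ 2 p)

  pow2-cancel-< : ∀ {m n} → pow2 m < pow2 n → m ℕ.< n
  pow2-cancel-< p = ℕₚ.≰⇒> λ q → <⇒≱ p (pow2-mono q)

  pow2-unbounded : ∀ {y} → 0# < y → ∃ λ n → 1# < pow2 n * y
  pow2-unbounded {y} 0<y = bound (archimedean (y ⁻¹))
    where
    bound : (∃ λ n → y ⁻¹ < fromℕ n) → ∃ λ n → 1# < pow2 n * y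
    bound (n , p) = n , <-≤-trans (<-respˡ-≈ (≈-trans (*-comm _ y) (⁻¹-inverse (pos⇒≉0 0<y))) (*-monoʳ-< 0<y p))
                                  (*-monoʳ-≤ (<⇒≤ 0<y) (fromℕ-mono (ℕₚ.<⇒≤ (n<2^n n))))

  -- Makes t the integer part of minus the binary logarithm of y.
  Scale : ℝ → ℕ → Set
  Scale y t = pow2 t * y ≤ 1# × 1# < pow2 (suc t) * y

  scale : ∀ {y} → 0# < y → y ≤ 1# → ∃ (Scale y)
  scale {y} 0<y y≤1 = search (proj₁ (pow2-unbounded 0<y)) (proj₂ (pow2-unbounded 0<y))
    where
    lem : ∀ y → y ≈ (1# + 0#) * y
    lem = solve 1 (λ y → y := (con (+ 1) :+ con (+ 0)) :* y) ≈-refl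
    search : ∀ n → 1# < pow2 n * y → ∃ (Scale y)
    search zero    p = ⊥-elim (<⇒≱ p (≤-respˡ-≈ (lem y) y≤1))
    search (suc n) p = [ (λ q → n , q , p) , search n ]′ (≤⊎> (pow2 n * y) 1#)

  -- Partial sums and Cauchy products

  shift : (ℕ → ℝ) → ℕ → ℝ
  shift f k = f (suc k)

  ps-cong : ∀ {f g : ℕ → ℝ} n → (∀ k → f k ≈ g k) → partialSum f n ≈ partialSum g n
  ps-cong zero    h = ≈-refl
  ps-cong {f} {g} (suc n) h = +-cong (h 0) (ps-cong {shift f} {shift g} n λ k → h (suc k))

  ps-last : ∀ f n → partialSum f (suc n) ≈ partialSum f n + f n
  ps-last f zero    = +-comm (f 0) 0#
  ps-last f (suc n) = ≈-trans (+-congˡ (ps-last (shift f) n)) (≈-sym (+-assoc (f 0) _ _))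

  ps-+ : ∀ f g n → partialSum (λ k → f k + g k) n ≈ partialSum f n + partialSum g n
  ps-+ f g zero    = ≈-sym (+-identityˡ 0#)
  ps-+ f g (suc n) = ≈-trans (+-congˡ (ps-+ (shift f) (shift g) n)) (lem (f 0) (g 0) _ _)
    where
    lem : ∀ a b c d → a + b + (c + d) ≈ a + c + (b + d)
    lem = solve 4 (λ a b c d → a :+ b :+ (c :+ d) := a :+ c :+ (b :+ d)) ≈-refl

  ps-*ˡ : ∀ c f n → partialSum (λ k → c * f k) n ≈ c * partialSum f n
  ps-*ˡ c f zero    = ≈-sym (zeroʳ c)
  ps-*ˡ c f (suc n) = ≈-trans (+-congˡ (ps-*ˡ c (shift f) n)) (≈-sym (distribˡ c _ _))

  ps-mono : ∀ {f g} n → (∀ k → f k ≤ g k) → partialSum f n ≤ partialSum g n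
  ps-mono zero    h = ≤-refl
  ps-mono {f} {g} (suc n) h = +-mono-≤ (h 0) (ps-mono {shift f} {shift g} n λ k → h (suc k))

  ps-nonNeg : ∀ {f} n → (∀ k → 0# ≤ f k) → 0# ≤ partialSum f n
  ps-nonNeg zero    h = ≤-refl
  ps-nonNeg {f} (suc n) h = +-nonNeg (h 0) (ps-nonNeg {shift f} n λ k → h (suc k))

  ps-grow : ∀ {f m n} → (∀ k → 0# ≤ f k) → m ℕ.≤ n → partialSum f m ≤ partialSum f n
  ps-grow {n = n} h ℕ.z≤n  = ps-nonNeg n h
  ps-grow {f} h (ℕ.s≤s p) = +-monoʳ-≤ _ (ps-grow {shift f} (λ k → h (suc k)) p)

  ps-tail : ∀ {f F m n} → (∀ k → f k ≤ F k) → m ℕ.≤ n →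
            partialSum f n - partialSum f m ≤ partialSum F n - partialSum F m
  ps-tail {f} {F} {n = n} h ℕ.z≤n = ≤-by (0≤y-x (ps-mono {f} {F} n h)) (lem _ _)
    where
    lem : ∀ a b → a - 0# - (b - 0#) ≈ a - b
    lem = solve 2 (λ a b → a :- con (+ 0) :- (b :- con (+ 0)) := a :- b) ≈-refl
  ps-tail {f} {F} h (ℕ.s≤s p) = ≤-by (0≤y-x (ps-tail {shift f} {shift F} (λ k → h (suc k)) p)) (lem _ _ _ _ _ _)
    where
    lem : ∀ a b c d x y → x + a - (x + b) - (y + c - (y + d)) ≈ a - b - (c - d)
    lem = solve 6 (λ a b c d x y → x :+ a :- (x :+ b) :- (y :+ c :- (y :+ d)) := a :- b :- (c :- d)) ≈-refl

  neg-sub : ∀ x y → - (x - y) ≈ y - x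
  neg-sub = solve 2 (λ x y → :- (x :- y) := y :- x) ≈-refl

  ps-neg : ∀ f n → partialSum (λ k → - f k) n ≈ - partialSum f n
  ps-neg f zero    = solve 0 (con (+ 0) := :- con (+ 0)) ≈-refl
  ps-neg f (suc n) = ≈-trans (+-congˡ (ps-neg (shift f) n)) (lem _ _)
    where
    lem : ∀ a b → - a + - b ≈ - (a + b)
    lem = solve 2 (λ a b → :- a :+ :- b := :- (a :+ b)) ≈-refl

  ps-∣tail∣ : ∀ {f F m n} → (∀ k → ∣ f k ∣ ≤ F k) → m ℕ.≤ n →
              ∣ partialSum f n - partialSum f m ∣ ≤ partialSum F n - partialSum F m
  ps-∣tail∣ {f} {F} {m} {n} h p = ∣∣-lub (ps-tail {f} {F} (λ k → ≤-trans (x≤∣x∣ _) (h k)) p)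
    (≤-respˡ-≈ (≈-trans (+-cong (ps-neg f n) (-‿cong (ps-neg f m))) (lem _ _))
               (ps-tail {λ k → - f k} {F} (λ k → ≤-trans (-x≤∣x∣ _) (h k)) p))
    where
    lem : ∀ a b → - a - - b ≈ - (a - b)
    lem = solve 2 (λ a b → :- a :- :- b := :- (a :- b)) ≈-refl

  -- The sum of f i * g k over i + k = n.
  conv : (ℕ → ℝ) → (ℕ → ℝ) → ℕ → ℝ
  conv f g zero    = f 0 * g 0
  conv f g (suc n) = f 0 * g (suc n) + conv (shift f) g n

  -- The sum of f i * g k over i + k < n.
  triangle : (ℕ → ℝ) → (ℕ → ℝ) → ℕ → ℝ
  triangle f g zero    = 0#
  triangle f g (suc n) = f 0 * partialSum g (suc n) + triangle (shift f) g n

  conv-congˡ : ∀ {f f′} g n → (∀ k → f k ≈ f′ k) → conv f g n ≈ conv f′ g n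
  conv-congˡ g zero    h = *-congʳ (h 0)
  conv-congˡ {f} {f′} g (suc n) h = +-cong (*-congʳ (h 0)) (conv-congˡ {shift f} {shift f′} g n λ k → h (suc k))

  conv-+ˡ : ∀ f f′ g n → conv (λ k → f k + f′ k) g n ≈ conv f g n + conv f′ g n
  conv-+ˡ f f′ g zero    = distribʳ (g 0) (f 0) (f′ 0)
  conv-+ˡ f f′ g (suc n) = ≈-trans (+-cong (distribʳ (g (suc n)) (f 0) (f′ 0)) (conv-+ˡ (shift f) (shift f′) g n)) (lem _ _ _ _)
    where
    lem : ∀ a b c d → a + b + (c + d) ≈ a + c + (b + d)
    lem = solve 4 (λ a b c d → a :+ b :+ (c :+ d) := a :+ c :+ (b :+ d)) ≈-refl

  conv-*ˡ : ∀ c f g n → conv (λ k → c * f k) g n ≈ c * conv f g n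
  conv-*ˡ c f g zero    = *-assoc c (f 0) (g 0)
  conv-*ˡ c f g (suc n) = ≈-trans (+-cong (*-assoc c (f 0) (g (suc n))) (conv-*ˡ c (shift f) g n)) (≈-sym (distribˡ c _ _))

  triangle-last : ∀ f g n → triangle f g (suc n) ≈ triangle f g n + conv f g n
  triangle-last f g zero    = lem (f 0) (g 0)
    where
    lem : ∀ a b → a * (b + 0#) + 0# ≈ 0# + a * b
    lem = solve 2 (λ a b → a :* (b :+ con (+ 0)) :+ con (+ 0) := con (+ 0) :+ a :* b) ≈-refl
  triangle-last f g (suc n) = ≈-trans (+-cong (*-congˡ (ps-last g (suc n))) (triangle-last (shift f) g n)) (lem _ _ _ _ _)
    where
    lem : ∀ a b c d e → a * (b + c) + (d + e) ≈ a * b + d + (a * c + e)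
    lem = solve 5 (λ a b c d e → a :* (b :+ c) :+ (d :+ e) := a :* b :+ d :+ (a :* c :+ e)) ≈-refl

  -- The Leibniz rule for the derivation f k ↦ k * f k.
  conv-leibniz : ∀ f g n → conv (λ k → fromℕ k * f k) g n + conv f (λ k → fromℕ k * g k) n ≈ fromℕ n * conv f g n
  conv-leibniz f g zero    = lem (f 0) (g 0)
    where
    lem : ∀ a b → 0# * a * b + a * (0# * b) ≈ 0# * (a * b)
    lem = solve 2 (λ a b → con (+ 0) :* a :* b :+ a :* (con (+ 0) :* b) := con (+ 0) :* (a :* b)) ≈-refl
  conv-leibniz f g (suc n) = ≈-trans
    (+-congʳ (+-congˡ (≈-trans (conv-congˡ g n λ k → split (fromℕ k) (f (suc k))) (conv-+ˡ (shift f) (λ k → fromℕ k * shift f k) g n))))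
    (≈-trans (lem₁ (f 0) (g (suc n)) (fromℕ n) _ _ _) (≈-trans (+-congˡ (conv-leibniz (shift f) g n)) (lem₂ _ _ _ _)))
    where
    split : ∀ k x → (1# + k) * x ≈ x + k * x
    split = solve 2 (λ k x → (con (+ 1) :+ k) :* x := x :+ k :* x) ≈-refl
    lem₁ : ∀ a b n c d e → 0# * a * b + (c + d) + (a * ((1# + n) * b) + e) ≈ (1# + n) * a * b + c + (d + e)
    lem₁ = solve 6 (λ a b n c d e → con (+ 0) :* a :* b :+ (c :+ d) :+ (a :* ((con (+ 1) :+ n) :* b) :+ e)
                                 := (con (+ 1) :+ n) :* a :* b :+ c :+ (d :+ e)) ≈-refl
    lem₂ : ∀ a b n c → (1# + n) * a * b + c + n * c ≈ (1# + n) * (a * b + c)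
    lem₂ = solve 4 (λ a b n c → (con (+ 1) :+ n) :* a :* b :+ c :+ n :* c := (con (+ 1) :+ n) :* (a :* b :+ c)) ≈-refl

  -- For generating functions, h = yXg gives fh = yX(fg). The right factor needs an argument of its
  -- own because `conv` recurses on the left one.
  conv-shiftʳ : ∀ f g h y n → h 0 ≈ 0# → (∀ k → h (suc k) ≈ y * g k) → conv f h (suc n) ≈ y * conv f g n
  conv-shiftʳ f g h y zero    h0 hs = ≈-trans (+-cong (*-congˡ (hs 0)) (*-congˡ h0)) (lem _ _ _ _)
    where
    lem : ∀ a b y c → a * (y * b) + c * 0# ≈ y * (a * b)
    lem = solve 4 (λ a b y c → a :* (y :* b) :+ c :* con (+ 0) := y :* (a :* b)) ≈-refl
  conv-shiftʳ f g h y (suc n) h0 hs = ≈-trans (+-cong (*-congˡ (hs (suc n))) (conv-shiftʳ (shift f) g h y n h0 hs)) (lem _ _ _ _)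
    where
    lem : ∀ a b y c → a * (y * b) + y * c ≈ y * (a * b + c)
    lem = solve 4 (λ a b y c → a :* (y :* b) :+ y :* c := y :* (a :* b :+ c)) ≈-refl

  triangle-nonNeg : ∀ {f g} n → (∀ k → 0# ≤ f k) → (∀ k → 0# ≤ g k) → 0# ≤ triangle f g n
  triangle-nonNeg zero    p q = ≤-refl
  triangle-nonNeg {f} {g} (suc n) p q = +-nonNeg (*-nonNeg (p 0) (ps-nonNeg {g} (suc n) q)) (triangle-nonNeg {shift f} n (λ k → p (suc k)) q)

  -- Indices i < n and k < N satisfy i + k < n + N, and all terms are nonnegative.
  rectangle≤triangle : ∀ {f g} n N → (∀ k → 0# ≤ f k) → (∀ k → 0# ≤ g k) →
                       partialSum f n * partialSum g N ≤ triangle f g (n ℕ.+ N)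
  rectangle≤triangle zero    N p q = ≤-respˡ-≈ (≈-sym (zeroˡ _)) (triangle-nonNeg N p q)
  rectangle≤triangle {f} {g} (suc n) N p q = ≤-respˡ-≈ (≈-sym (distribʳ _ _ _))
    (+-mono-≤ (*-monoˡ-≤ (p 0) (ps-grow {g} q (ℕₚ.m≤n+m N (suc n)))) (rectangle≤triangle {shift f} {g} n N (λ k → p (suc k)) q))

  -- As n ≤ N, the triangle lies in the rectangle, and the products in the remaining corner are
  -- dominated one by one. The induction lowers n but not N, hence a rectangle.
  square-triangle : ∀ {f g F G} n N → n ℕ.≤ N → (∀ k → ∣ f k ∣ ≤ F k) → (∀ k → ∣ g k ∣ ≤ G k) →
    ∣ partialSum f n * partialSum g N - triangle f g n ∣ ≤ partialSum F n * partialSum G N - triangle F G n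
  square-triangle {g = g} {G = G} zero N _ p q = ≤-reflexive (≈-trans (∣∣-cong (lem (partialSum g N)))
    (≈-trans (∣∣-of-nonNeg ≤-refl) (≈-sym (lem (partialSum G N)))))
    where
    lem : ∀ a → 0# * a - 0# ≈ 0#
    lem = solve 1 (λ a → con (+ 0) :* a :- con (+ 0) := con (+ 0)) ≈-refl
  square-triangle {f} {g} {F} {G} (suc n) N n≤N p q = ≤-respˡ-≈ (∣∣-cong (≈-sym (lem (f 0) _ _ _ _)))
    (≤-trans (∣∣-+ _ _) (≤-respʳ-≈ (≈-sym (lem (F 0) _ _ _ _)) (+-mono-≤
      (≤-trans (∣∣-* _ _) (*-mono-≤ (∣∣-nonNeg _) (p 0) (∣∣-nonNeg _) (ps-∣tail∣ {g} {G} q n≤N)))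
      (square-triangle {shift f} {g} {shift F} {G} n N (ℕₚ.≤-trans (ℕₚ.n≤1+n n) n≤N) (λ k → p (suc k)) q))))
    where
    lem : ∀ a b c d e → (a + b) * c - (a * d + e) ≈ a * (c - d) + (b * c - e)
    lem = solve 5 (λ a b c d e → (a :+ b) :* c :- (a :* d :+ e) := a :* (c :- d) :+ (b :* c :- e)) ≈-refl

  -- Limits of sequences

  halve : ∀ {ε} → 0# < ε → ∃ λ h → 0# < h × h + h ≈ ε
  halve {ε} 0<ε = ε * fromℕ 2 ⁻¹ , *-pos 0<ε (⁻¹-pos 0<2) ,
    ≈-trans (lem ε _) (≈-trans (*-congˡ (⁻¹-inverse (pos⇒≉0 0<2))) (*-identityʳ ε))
    where
    0<2 : 0# < fromℕ 2
    0<2 = fromℕ-pos {2} (ℕ.s≤s ℕ.z≤n)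
    lem : ∀ d i → d * i + d * i ≈ d * (fromℕ 2 * i)
    lem = solve 2 (λ d i → d :* i :+ d :* i := d :* (con (+ 2) :* i)) ≈-refl

  ⟶-≤ : ∀ {f g l m N} → f ⟶ l → g ⟶ m → (∀ n → N ℕ.≤ n → f n ≤ g n) → l ≤ m
  ⟶-≤ {f} {g} {l} {m} {N} p q f≤g = byContra λ ¬l≤m → contra (0<y-x (≰⇒> ¬l≤m)) (halve (0<y-x (≰⇒> ¬l≤m)))
    where
    lem : ∀ a b x y → (a - x) + (y - b) + (x - y) ≈ a - b
    lem = solve 4 (λ a b x y → (a :- x) :+ (y :- b) :+ (x :- y) := a :- b) ≈-refl
    contra : 0# < l - m → ¬ ∃ λ h → 0# < h × h + h ≈ l - m
    contra 0<d (h , 0<h , hh≈d) = <-irrefl (<-respʳ-≈ hh≈d (<-respˡ-≈ (lem l m (f n) (g n))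
        (≤-<-trans (≤-respʳ-≈ (+-identityʳ _) (+-monoʳ-≤ _ (≤-by (0≤y-x (f≤g n N≤n)) (lem₃ (f n) (g n)))))
          (+-mono-<-≤ (≤-<-trans (≤-respˡ-≈ (neg-sub (f n) l) (-x≤∣x∣ (f n - l))) (proj₂ (p h 0<h) n N₁≤n))
                      (≤-trans (x≤∣x∣ (g n - m)) (<⇒≤ (proj₂ (q h 0<h) n N₂≤n)))))))
      where
      N₁ = proj₁ (p h 0<h)
      N₂ = proj₁ (q h 0<h)
      n = N₁ ℕ.+ N₂ ℕ.+ N
      N₁≤n = ℕₚ.≤-trans (ℕₚ.m≤m+n N₁ N₂) (ℕₚ.m≤m+n _ N)
      N₂≤n = ℕₚ.≤-trans (ℕₚ.m≤n+m N₂ N₁) (ℕₚ.m≤m+n _ N)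
      N≤n = ℕₚ.m≤n+m N (N₁ ℕ.+ N₂)
      lem₃ : ∀ a b → 0# - (a - b) ≈ b - a
      lem₃ = solve 2 (λ a b → con (+ 0) :- (a :- b) := b :- a) ≈-refl

  ⟶-unique : ∀ {f l m} → f ⟶ l → f ⟶ m → l ≈ m
  ⟶-unique p q = ≤-antisym (⟶-≤ {N = 0} p q λ _ _ → ≤-refl) (⟶-≤ {N = 0} q p λ _ _ → ≤-refl)

  ⟶-const : ∀ c → (λ _ → c) ⟶ c
  ⟶-const c ε 0<ε = 0 , λ _ _ → <-respˡ-≈ (≈-sym (≈-trans (∣∣-cong (-‿inverseʳ c)) (∣∣-of-nonNeg ≤-refl))) 0<ε

  ⟶-by : ∀ {f g l m c} → 0# < c → f ⟶ l → (∀ n → ∣ g n - m ∣ ≤ c * ∣ f n - l ∣) → g ⟶ m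
  ⟶-by {f} {g} {l} {m} {c} 0<c p h ε 0<ε = N , λ n N≤n → ≤-<-trans (h n)
      (<-respʳ-≈ cancel (*-monoˡ-< 0<c (proj₂ (p _ 0<ε′) n N≤n)))
    where
    0<ε′ : 0# < c ⁻¹ * ε
    0<ε′ = *-pos (⁻¹-pos 0<c) 0<ε
    N = proj₁ (p _ 0<ε′)
    cancel : c * (c ⁻¹ * ε) ≈ ε
    cancel = ≈-trans (≈-sym (*-assoc c _ ε)) (≈-trans (*-congʳ (⁻¹-inverse (pos⇒≉0 0<c))) (*-identityˡ ε))

  ⟶-+ : ∀ {f g l m} → f ⟶ l → g ⟶ m → (λ n → f n + g n) ⟶ l + m
  ⟶-+ {f} {g} {l} {m} p q ε 0<ε = go (halve 0<ε)
    where
    lem : ∀ a b x y → a + b - (x + y) ≈ (a - x) + (b - y)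
    lem = solve 4 (λ a b x y → a :+ b :- (x :+ y) := (a :- x) :+ (b :- y)) ≈-refl
    go : (∃ λ h → 0# < h × h + h ≈ ε) → ∃ λ N → ∀ n → N ℕ.≤ n → ∣ f n + g n - (l + m) ∣ < ε
    go (h , 0<h , hh≈ε) = proj₁ (p h 0<h) ℕ.+ proj₁ (q h 0<h) , λ n N≤n →
      <-respʳ-≈ hh≈ε (≤-<-trans (≤-respˡ-≈ (∣∣-cong (≈-sym (lem (f n) (g n) l m))) (∣∣-+ _ _))
        (+-mono-<-≤ (proj₂ (p h 0<h) n (ℕₚ.≤-trans (ℕₚ.m≤m+n _ _) N≤n))
                    (<⇒≤ (proj₂ (q h 0<h) n (ℕₚ.≤-trans (ℕₚ.m≤n+m _ (proj₁ (p h 0<h))) N≤n)))))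

  ⟶-*ˡ : ∀ {f l} c → f ⟶ l → (λ n → c * f n) ⟶ c * l
  ⟶-*ˡ {f} {l} c p = ⟶-by {c = 1# + ∣ c ∣} (+-pos-nonNeg 0<1 (∣∣-nonNeg c)) p λ n →
    ≤-trans (≤-respˡ-≈ (∣∣-cong (lem c (f n) l)) (∣∣-* c (f n - l)))
            (*-monoʳ-≤ (∣∣-nonNeg _) (≤-by 0≤1 (lem₂ ∣ c ∣)))
    where
    lem : ∀ c a b → c * (a - b) ≈ c * a - c * b
    lem = solve 3 (λ c a b → c :* (a :- b) := c :* a :- c :* b) ≈-refl
    lem₂ : ∀ c → 1# + c - c ≈ 1#
    lem₂ = solve 1 (λ c → con (+ 1) :+ c :- c := con (+ 1)) ≈-refl

  ⟶-null : ∀ {f g} → f ⟶ 0# → (∀ n → ∣ g n ∣ ≤ f n) → g ⟶ 0#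
  ⟶-null {f} {g} p h ε 0<ε = proj₁ (p ε 0<ε) , λ n N≤n → ≤-<-trans
    (≤-trans (≤-respˡ-≈ (∣∣-cong (≈-sym (lem (g n)))) (h n)) (≤-respˡ-≈ (lem (f n)) (x≤∣x∣ (f n - 0#)))) (proj₂ (p ε 0<ε) n N≤n)
    where
    lem : ∀ x → x - 0# ≈ x
    lem = solve 1 (λ x → x :- con (+ 0) := x) ≈-refl

  ⟶-cong : ∀ {f g l m} → (∀ n → f n ≈ g n) → l ≈ m → f ⟶ l → g ⟶ m
  ⟶-cong f≈g l≈m p ε 0<ε = proj₁ (p ε 0<ε) , λ n N≤n →
    <-respˡ-≈ (∣∣-cong (+-cong (f≈g n) (-‿cong l≈m))) (proj₂ (p ε 0<ε) n N≤n)

  ⟶-* : ∀ {f g l m} → f ⟶ l → g ⟶ m → (λ n → f n * g n) ⟶ l * m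
  ⟶-* {f} {g} {l} {m} p q = ⟶-cong (λ n → lem₁ (f n) (g n) l m) (lem₂ l m)
    (⟶-+ product (⟶-+ (⟶-+ (⟶-*ˡ l q) (⟶-*ˡ m p)) (⟶-const (- (l * m)))))
    where
    lem₁ : ∀ a b l m → (a - l) * (b - m) + (l * b + m * a + - (l * m)) ≈ a * b
    lem₁ = solve 4 (λ a b l m → (a :- l) :* (b :- m) :+ (l :* b :+ m :* a :+ :- (l :* m)) := a :* b) ≈-refl
    lem₂ : ∀ l m → 0# + (l * m + m * l + - (l * m)) ≈ l * m
    lem₂ = solve 2 (λ l m → con (+ 0) :+ (l :* m :+ m :* l :+ :- (l :* m)) := l :* m) ≈-refl
    lem₃ : ∀ x → x - 0# ≈ x
    lem₃ = solve 1 (λ x → x :- con (+ 0) := x) ≈-refl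
    -- The first factor tends to 0 and the second is eventually at most 1.
    product : (λ n → (f n - l) * (g n - m)) ⟶ 0#
    product ε 0<ε = N₁ ℕ.+ N₂ , λ n N≤n → ≤-<-trans
        (≤-respˡ-≈ (∣∣-cong (≈-sym (lem₃ _))) (≤-trans (∣∣-* (f n - l) (g n - m))
          (≤-respʳ-≈ (*-identityʳ _) (*-monoˡ-≤ (∣∣-nonNeg (f n - l))
            (<⇒≤ (proj₂ (q 1# 0<1) n (ℕₚ.≤-trans (ℕₚ.m≤n+m N₂ N₁) N≤n)))))))
        (proj₂ (p ε 0<ε) n (ℕₚ.≤-trans (ℕₚ.m≤m+n N₁ N₂) N≤n))
      where
      N₁ = proj₁ (p ε 0<ε)
      N₂ = proj₁ (q 1# 0<1)

  stays : ∀ {f : ℕ → ℝ} → (∀ n → f n ≤ f (suc n)) → ∀ {m n} → m ℕ.≤ n → f m ≤ f n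
  stays {f} step {m} m≤n = go (ℕₚ.≤⇒≤′ m≤n)
    where
    go : ∀ {n} → m ℕ.≤′ n → f m ≤ f n
    go ℕ.≤′-refl     = ≤-refl
    go (ℕ.≤′-step p) = ≤-trans (go p) (step _)

  monotone-⟶ : ∀ {f : ℕ → ℝ} {b} → (∀ n → f n ≤ f (suc n)) → (∀ n → f n ≤ b) → ∃ λ l → f ⟶ l
  monotone-⟶ {f} {b} step bnd = limit (lub (λ y → ∃ λ n → y ≈ f n) (f 0 , 0 , ≈-refl)
      (b , λ { y (n , eq) → ≤-respˡ-≈ (≈-sym eq) (bnd n) }))
    where
    lem₂ : ∀ s ε → s - (s - ε) ≈ ε
    lem₂ = solve 2 (λ s ε → s :- (s :- ε) := ε) ≈-refl
    lem₃ : ∀ s ε f → ε - - (f - s) ≈ f - (s - ε)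
    lem₃ = solve 3 (λ s ε f → ε :- :- (f :- s) := f :- (s :- ε)) ≈-refl
    lem₄ : ∀ s ε f → ε - (f - s) ≈ ε + (s - f)
    lem₄ = solve 3 (λ s ε f → ε :- (f :- s) := ε :+ (s :- f)) ≈-refl
    limit : ∃ (IsLUB _≤_ (λ y → ∃ λ n → y ≈ f n)) → ∃ λ l → f ⟶ l
    limit (s , ub , least) = s , λ ε 0<ε → close 0<ε (byContra λ none →
        <⇒≱ (<-by 0<ε (lem₂ s ε)) (least (s - ε) λ { y (n , eq) → ≤-respˡ-≈ (≈-sym eq) (≮⇒≥ λ p → none (n , p)) }))
      where
      close : ∀ {ε} → 0# < ε → (∃ λ N → s - ε < f N) → ∃ λ N → ∀ n → N ℕ.≤ n → ∣ f n - s ∣ < ε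
      close {ε} 0<ε (N , p) = N , λ n N≤n → ∣∣-lub-<
        (<-by (+-pos-nonNeg 0<ε (0≤y-x (ub (f n) (n , ≈-refl)))) (lem₄ s ε (f n)))
        (<-by (0<y-x (<-≤-trans p (stays {f} step N≤n))) (lem₃ s ε (f n)))

  -- The exponential series

  term : ℝ → ℕ → ℝ
  term x k = x ^ k * fromℕ (k !) ⁻¹

  expSum : ℝ → ℕ → ℝ
  expSum x = partialSum (term x)

  term-0 : ∀ x → term x 0 ≈ 1#
  term-0 x = ≈-trans (lem _) (⁻¹-inverse (pos⇒≉0 (fromℕ-pos {1} (ℕ.s≤s ℕ.z≤n))))
    where
    lem : ∀ i → 1# * i ≈ (1# + 0#) * i
    lem = solve 1 (λ i → con (+ 1) :* i := (con (+ 1) :+ con (+ 0)) :* i) ≈-refl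

  n!-pos : ∀ n → 1 ℕ.≤ n !
  n!-pos zero    = ℕ.s≤s ℕ.z≤n
  n!-pos (suc n) = ℕₚ.*-mono-≤ (ℕ.s≤s (ℕ.z≤n {n})) (n!-pos n)

  -- Together with `term-0` this recurrence replaces the factorials from here on. In `conv-term` it
  -- lets both sides satisfy the same recursion in n.
  term-suc : ∀ x k → fromℕ (suc k) * term x (suc k) ≈ x * term x k
  term-suc x k = ≈-trans (lem₁ (fromℕ (suc k)) x (x ^ k) _) (*-congˡ rest)
    where
    a = fromℕ (suc k)
    b = fromℕ (k !)
    c = fromℕ (suc k !)
    lem₁ : ∀ a x y i → a * (x * y * i) ≈ x * (y * (a * i))
    lem₁ = solve 4 (λ a x y i → a :* (x :* y :* i) := x :* (y :* (a :* i))) ≈-refl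
    lem₂ : ∀ a b j i → a * i * (b * j) ≈ a * b * i * j
    lem₂ = solve 4 (λ a b j i → a :* i :* (b :* j) := a :* b :* i :* j) ≈-refl
    b≉0 : ¬ b ≈ 0#
    b≉0 = pos⇒≉0 (fromℕ-pos (n!-pos k))
    c≉0 : ¬ c ≈ 0#
    c≉0 = pos⇒≉0 (fromℕ-pos (n!-pos (suc k)))
    inverses : a * c ⁻¹ ≈ b ⁻¹
    inverses = ≈-trans (≈-sym (*-identityʳ _)) (≈-trans (*-congˡ (≈-sym (⁻¹-inverse b≉0)))
      (≈-trans (lem₂ a b (b ⁻¹) (c ⁻¹)) (≈-trans (*-congʳ (≈-trans (*-congʳ (≈-sym (fromℕ-* (suc k) (k !)))) (⁻¹-inverse c≉0)))
        (*-identityˡ _))))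
    rest : x ^ k * (a * c ⁻¹) ≈ x ^ k * b ⁻¹
    rest = *-congˡ inverses

  0<1+n : ∀ n → 0# < fromℕ (suc n)
  0<1+n n = fromℕ-pos (ℕ.s≤s (ℕ.z≤n {n}))

  *-cancelˡ-≈ : ∀ {x y z} → 0# < z → z * x ≈ z * y → x ≈ y
  *-cancelˡ-≈ p eq = ≤-antisym (*-cancelˡ-≤ p (≤-reflexive eq)) (*-cancelˡ-≤ p (≤-reflexive (≈-sym eq)))

  term-mono : ∀ {x y} → 0# ≤ x → x ≤ y → ∀ k → 0# ≤ term x k × term x k ≤ term y k
  term-mono {x} {y} 0≤x x≤y zero    = ≤-respʳ-≈ (≈-sym (term-0 x)) 0≤1 , ≤-reflexive (≈-trans (term-0 x) (≈-sym (term-0 y)))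
  term-mono {x} {y} 0≤x x≤y (suc k) = next (term-mono 0≤x x≤y k)
    where
    next : 0# ≤ term x k × term x k ≤ term y k → 0# ≤ term x (suc k) × term x (suc k) ≤ term y (suc k)
    next (p , q) =
      *-cancelˡ-≤ (0<1+n k) (≤-respˡ-≈ (≈-sym (zeroʳ _)) (≤-respʳ-≈ (≈-sym (term-suc x k)) (*-nonNeg 0≤x p))) ,
      *-cancelˡ-≤ (0<1+n k) (≤-respˡ-≈ (≈-sym (term-suc x k)) (≤-respʳ-≈ (≈-sym (term-suc y k)) (*-mono-≤ 0≤x x≤y p q)))

  term-nonNeg : ∀ {x} → 0# ≤ x → ∀ k → 0# ≤ term x k
  term-nonNeg 0≤x k = proj₁ (term-mono 0≤x ≤-refl k)

  ∣term∣ : ∀ x k → ∣ term x k ∣ ≤ term ∣ x ∣ k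
  ∣term∣ x zero    = ≤-reflexive (≈-trans (∣∣-cong (term-0 x)) (≈-trans (∣∣-of-nonNeg 0≤1) (≈-sym (term-0 ∣ x ∣))))
  ∣term∣ x (suc k) = ∣∣-lub
    (*-cancelˡ-≤ (0<1+n k) (≤-respˡ-≈ (≈-sym (term-suc x k)) (≤-trans (x≤∣x∣ _) bound)))
    (*-cancelˡ-≤ (0<1+n k) (≤-respˡ-≈ (≈-trans (-‿cong (≈-sym (term-suc x k))) (lem _ _)) (≤-trans (-x≤∣x∣ _) bound)))
    where
    lem : ∀ a b → - (a * b) ≈ a * - b
    lem = solve 2 (λ a b → :- (a :* b) := a :* :- b) ≈-refl
    bound : ∣ x * term x k ∣ ≤ fromℕ (suc k) * term ∣ x ∣ (suc k)
    bound = ≤-respʳ-≈ (≈-sym (term-suc ∣ x ∣ k)) (≤-trans (∣∣-* x (term x k)) (*-monoˡ-≤ (∣∣-nonNeg x) (∣term∣ x k)))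

  -- The binomial theorem
  conv-term : ∀ x y n → conv (term x) (term y) n ≈ term (x + y) n
  conv-term x y zero    = ≈-trans (*-cong (term-0 x) (term-0 y)) (≈-trans (*-identityʳ 1#) (≈-sym (term-0 (x + y))))
  conv-term x y (suc n) = *-cancelˡ-≈ (0<1+n n) (≈-trans (≈-sym (conv-leibniz (term x) (term y) (suc n)))
    (≈-trans (+-cong left (conv-shiftʳ (term x) (term y) (λ k → fromℕ k * term y k) y n (zeroˡ _) (term-suc y)))
    (≈-trans (≈-sym (distribʳ _ x y)) (≈-trans (*-congˡ (conv-term x y n)) (≈-sym (term-suc (x + y) n))))))
    where
    lem : ∀ a b c → 0# * a * b + c ≈ c
    lem = solve 3 (λ a b c → con (+ 0) :* a :* b :+ c := c) ≈-refl
    left : conv (λ k → fromℕ k * term x k) (term y) (suc n) ≈ x * conv (term x) (term y) n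
    left = ≈-trans (lem (term x 0) (term y (suc n)) _)
      (≈-trans (conv-congˡ (term y) n (term-suc x)) (conv-*ˡ x (term x) (term y) n))

  triangle-term : ∀ x y n → triangle (term x) (term y) n ≈ expSum (x + y) n
  triangle-term x y zero    = ≈-refl
  triangle-term x y (suc n) = ≈-trans (triangle-last (term x) (term y) n)
    (≈-trans (+-cong (triangle-term x y n) (conv-term x y n)) (≈-sym (ps-last (term (x + y)) n)))

  expSum-step : ∀ {x} → 0# ≤ x → ∀ n → expSum x n ≤ expSum x (suc n)
  expSum-step {x} p n = ps-grow {term x} (term-nonNeg p) (ℕₚ.n≤1+n n)

  expSum-+ : ∀ {x y} → 0# ≤ x → 0# ≤ y → ∀ n → expSum (x + y) n ≤ expSum x n * expSum y n
  expSum-+ {x} {y} p q n = ≤-respˡ-≈ (triangle-term x y n) (≤-by (≤-trans (∣∣-nonNeg _)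
    (square-triangle {term x} {term y} {term x} {term y} n n ℕₚ.≤-refl (nn p) (nn q))) ≈-refl)
    where
    nn : ∀ {x} → 0# ≤ x → ∀ k → ∣ term x k ∣ ≤ term x k
    nn p k = ≤-reflexive (∣∣-of-nonNeg (term-nonNeg p k))

  -- For small h the terms decay at least geometrically.
  expSum-small : ∀ {h} → 0# ≤ h → h + h ≤ 1# → ∀ n → expSum h n ≤ 1# + (h + h)
  expSum-small {h} 0≤h 2h≤1 zero    = +-nonNeg 0≤1 (+-nonNeg 0≤h 0≤h)
  expSum-small {h} 0≤h 2h≤1 (suc n) = +-mono-≤ (≤-reflexive (term-0 h)) (≤-trans (ps-mono {shift (term h)} {λ k → h * term h k} n decay)
    (≤-respˡ-≈ (≈-sym (ps-*ˡ h (term h) n)) (≤-trans (*-monoˡ-≤ 0≤h (expSum-small 0≤h 2h≤1 n))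
      (≤-by (*-nonNeg 0≤h (0≤y-x 2h≤1)) (lem₁ h)))))
    where
    lem₁ : ∀ h → h + h - h * (1# + (h + h)) ≈ h * (1# - (h + h))
    lem₁ = solve 1 (λ h → h :+ h :- h :* (con (+ 1) :+ (h :+ h)) := h :* (con (+ 1) :- (h :+ h))) ≈-refl
    lem₂ : ∀ n e → (1# + n) * e - e ≈ n * e
    lem₂ = solve 2 (λ n e → (con (+ 1) :+ n) :* e :- e := n :* e) ≈-refl
    decay : ∀ k → term h (suc k) ≤ h * term h k
    decay k = ≤-respʳ-≈ (term-suc h k) (≤-by (*-nonNeg (fromℕ-nonNeg k) (term-nonNeg 0≤h (suc k))) (lem₂ (fromℕ k) (term h (suc k))))

  Bounded : ℝ → Set
  Bounded x = ∃ λ b → ∀ n → expSum x n ≤ b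

  expSum-nonNeg : ∀ {x} → 0# ≤ x → ∀ n → 0# ≤ expSum x n
  expSum-nonNeg {x} p n = ps-nonNeg {term x} n (term-nonNeg p)

  bounded-+ : ∀ {x y} → 0# ≤ x → 0# ≤ y → Bounded x → Bounded y → Bounded (x + y)
  bounded-+ {x} {y} p q (b , bx) (c , cy) = b * c , λ n →
    ≤-trans (expSum-+ p q n) (*-mono-≤ (expSum-nonNeg p n) (bx n) (expSum-nonNeg q n) (cy n))

  -- Only small arguments are estimated directly: x is at most some number of halves, and
  -- `bounded-+` multiplies their bounds.
  bounded : ∀ {x} → 0# ≤ x → Bounded x
  bounded {x} 0≤x = go (halve 0<1) (archimedean (x + x))
    where
    go : (∃ λ h → 0# < h × h + h ≈ 1#) → (∃ λ n → x + x < fromℕ n) → Bounded x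
    go (h , 0<h , hh≈1) (N , xx<N) = proj₁ (multiple N) , λ n →
        ≤-trans (ps-mono {term x} {term (fromℕ N * h)} n (λ k → proj₂ (term-mono 0≤x x≤Nh k))) (proj₂ (multiple N) n)
      where
      lem₁ : ∀ x h → (h + h) * x ≈ h * (x + x)
      lem₁ = solve 2 (λ x h → (h :+ h) :* x := h :* (x :+ x)) ≈-refl
      lem₂ : ∀ N h → h + N * h ≈ (1# + N) * h
      lem₂ = solve 2 (λ N h → h :+ N :* h := (con (+ 1) :+ N) :* h) ≈-refl
      x≤Nh : x ≤ fromℕ N * h
      x≤Nh = ≤-respˡ-≈ (≈-trans (≈-sym (lem₁ x h)) (≈-trans (*-congʳ hh≈1) (*-identityˡ x)))
               (≤-respʳ-≈ (*-comm h _) (*-monoˡ-≤ (<⇒≤ 0<h) (<⇒≤ xx<N)))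
      expSum-cong : ∀ {x y} → 0# ≤ x → 0# ≤ y → x ≈ y → ∀ n → expSum x n ≤ expSum y n
      expSum-cong {x} {y} p _ eq n = ps-mono {term x} {term y} n λ k → proj₂ (term-mono p (≤-reflexive eq) k)
      Nh-nonNeg : ∀ N → 0# ≤ fromℕ N * h
      Nh-nonNeg N = *-nonNeg (fromℕ-nonNeg N) (<⇒≤ 0<h)
      multiple : ∀ N → Bounded (fromℕ N * h)
      multiple zero    = 1# + (h + h) , λ n → ≤-trans
        (ps-mono {term (0# * h)} {term h} n (λ k → proj₂ (term-mono (Nh-nonNeg 0) (≤-respˡ-≈ (≈-sym (zeroˡ h)) (<⇒≤ 0<h)) k)))
        (expSum-small (<⇒≤ 0<h) (≤-reflexive hh≈1) n)
      multiple (suc N) = proj₁ both , λ n → ≤-trans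
        (expSum-cong (Nh-nonNeg (suc N)) (+-nonNeg (<⇒≤ 0<h) (Nh-nonNeg N)) (≈-sym (lem₂ (fromℕ N) h)) n) (proj₂ both n)
        where
        both = bounded-+ (<⇒≤ 0<h) (Nh-nonNeg N)
          (1# + (h + h) , expSum-small (<⇒≤ 0<h) (≤-reflexive hh≈1)) (multiple N)

  -- The exponential function

  -- The partial sums need not be monotone when x is negative. Those of `term x k + term X k` and of
  -- `term X k` with X = |x| are, and they are bounded, so both converge; the series of x is their
  -- difference.
  exp-spec : ∀ x → expSum x ⟶ exp x
  exp-spec x = the-spec 0# (limit (bounded (∣∣-nonNeg x)))
    where
    X = ∣ x ∣
    lem : ∀ a b → a + b + - 1# * b ≈ a
    lem = solve 2 (λ a b → a :+ b :+ :- con (+ 1) :* b := a) ≈-refl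
    lem₂ : ∀ a b → a - - b ≈ b + a
    lem₂ = solve 2 (λ a b → a :- :- b := b :+ a) ≈-refl
    both : ℕ → ℝ
    both k = term x k + term X k
    both-nonNeg : ∀ k → 0# ≤ both k
    both-nonNeg k = ≤-respʳ-≈ (lem₂ _ _) (0≤y-x (≤-trans (-x≤∣x∣ (term x k)) (∣term∣ x k)))
    both≤ : ∀ k → both k ≤ term X k + term X k
    both≤ k = +-mono-≤ (≤-trans (x≤∣x∣ _) (∣term∣ x k)) ≤-refl
    limit : Bounded X → ∃ λ y → expSum x ⟶ y
    limit (b , bX) = combine
      (monotone-⟶ {λ n → expSum x n + expSum X n} {b + b}
        (λ n → ≤-respˡ-≈ (ps-+ (term x) (term X) n) (≤-respʳ-≈ (ps-+ (term x) (term X) (suc n)) (ps-grow {both} both-nonNeg (ℕₚ.n≤1+n n))))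
        (λ n → ≤-respˡ-≈ (ps-+ (term x) (term X) n) (≤-trans (ps-mono {both} n both≤)
          (≤-respˡ-≈ (≈-sym (ps-+ (term X) (term X) n)) (+-mono-≤ (bX n) (bX n))))))
      (monotone-⟶ {expSum X} (expSum-step (∣∣-nonNeg x)) bX)
      where
      combine : (∃ λ l → (λ n → expSum x n + expSum X n) ⟶ l) → (∃ λ l → expSum X ⟶ l) → ∃ λ y → expSum x ⟶ y
      combine (l , p) (m , q) = l + - 1# * m , ⟶-cong (λ n → lem (expSum x n) (expSum X n)) ≈-refl (⟶-+ p (⟶-*ˡ (- 1#) q))

  double-⟶ : ∀ {f l} → f ⟶ l → (λ n → f (n ℕ.+ n)) ⟶ l
  double-⟶ p ε 0<ε = proj₁ (p ε 0<ε) , λ n N≤n → proj₂ (p ε 0<ε) (n ℕ.+ n) (ℕₚ.≤-trans N≤n (ℕₚ.m≤m+n n n))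

  -- The product of the partial sums up to n exceeds the triangle by a corner. Passing to |x| and
  -- |y|, this corner is at most the part of the series at |x| + |y| between n and 2n, which tends
  -- to 0.
  exp-+ : ∀ x y → exp (x + y) ≈ exp x * exp y
  exp-+ x y = ≈-sym (⟶-unique (⟶-* (exp-spec x) (exp-spec y))
    (⟶-cong (λ n → lem (expSum x n * expSum y n) (expSum (x + y) n)) (+-identityˡ _) (⟶-+ null (exp-spec (x + y)))))
    where
    X = ∣ x ∣
    Y = ∣ y ∣
    lem : ∀ a b → a - b + b ≈ a
    lem = solve 2 (λ a b → a :- b :+ b := a) ≈-refl
    lem₂ : ∀ a → a + - 1# * a ≈ 0#
    lem₂ = solve 1 (λ a → a :+ :- con (+ 1) :* a := con (+ 0)) ≈-refl
    lem₃ : ∀ a b → a - b ≈ a + - 1# * b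
    lem₃ = solve 2 (λ a b → a :- b := a :+ :- con (+ 1) :* b) ≈-refl
    E = exp-spec (X + Y)
    gap : ℕ → ℝ
    gap n = expSum (X + Y) (n ℕ.+ n) + - 1# * expSum (X + Y) n
    gap⟶0 : gap ⟶ 0#
    gap⟶0 = ⟶-cong (λ n → ≈-refl) (lem₂ (exp (X + Y))) (⟶-+ (double-⟶ E) (⟶-*ˡ (- 1#) E))
    null : (λ n → expSum x n * expSum y n - expSum (x + y) n) ⟶ 0#
    null = ⟶-null gap⟶0 λ n → ≤-respˡ-≈ (∣∣-cong (+-congˡ (-‿cong (triangle-term x y n))))
      (≤-trans (square-triangle {term x} {term y} {term X} {term Y} n n ℕₚ.≤-refl (∣term∣ x) (∣term∣ y))
        (≤-respʳ-≈ (lem₃ _ _) (+-mono-≤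
          (≤-respʳ-≈ (triangle-term X Y (n ℕ.+ n)) (rectangle≤triangle {term X} {term Y} n n
            (term-nonNeg (∣∣-nonNeg x)) (term-nonNeg (∣∣-nonNeg y))))
          (≤-reflexive (-‿cong (triangle-term X Y n))))))

  exp≥1+x : ∀ {x} → 0# ≤ x → 1# + x ≤ exp x
  exp≥1+x {x} 0≤x = ⟶-≤ {N = 2} (⟶-const (1# + x)) (exp-spec x) λ n 2≤n → ≤-respˡ-≈ two-terms (ps-grow {term x} (term-nonNeg 0≤x) 2≤n)
    where
    lem₂ : ∀ a b → a + (b + 0#) ≈ a + b
    lem₂ = solve 2 (λ a b → a :+ (b :+ con (+ 0)) := a :+ b) ≈-refl
    lem₃ : ∀ b → b ≈ (1# + 0#) * b
    lem₃ = solve 1 (λ b → b := (con (+ 1) :+ con (+ 0)) :* b) ≈-refl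
    two-terms : expSum x 2 ≈ 1# + x
    two-terms = ≈-trans (lem₂ (term x 0) (term x 1)) (+-cong (term-0 x)
      (≈-trans (lem₃ (term x 1)) (≈-trans (term-suc x 0) (≈-trans (*-congˡ (term-0 x)) (*-identityʳ x)))))

  exp-small : ∀ {h} → 0# ≤ h → h + h ≤ 1# → exp h ≤ 1# + (h + h)
  exp-small {h} p q = ⟶-≤ {N = 0} (exp-spec h) (⟶-const (1# + (h + h))) λ n _ → expSum-small p q n

  exp≥1 : ∀ {x} → 0# ≤ x → 1# ≤ exp x
  exp≥1 {x} p = ≤-trans (≤-by p (lem x)) (exp≥1+x p)
    where
    lem : ∀ x → 1# + x - 1# ≈ x
    lem = solve 1 (λ x → con (+ 1) :+ x :- con (+ 1) := x) ≈-refl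

  -- Compares limits because `exp-cong` still lies ahead: it is derived from `exp-mono`, which rests
  -- on this identity.
  exp-split : ∀ x y → exp y ≈ exp x * exp (y - x)
  exp-split x y = ≈-trans (⟶-unique (exp-spec y) (⟶-cong same ≈-refl (exp-spec (x + (y - x))))) (exp-+ x (y - x))
    where
    lem : ∀ x y → x + (y - x) ≈ y
    lem = solve 2 (λ x y → x :+ (y :- x) := y) ≈-refl
    ^-cong : ∀ {x y} k → x ≈ y → x ^ k ≈ y ^ k
    ^-cong zero    eq = ≈-refl
    ^-cong (suc k) eq = *-cong eq (^-cong k eq)
    same : ∀ n → expSum (x + (y - x)) n ≈ expSum y n
    same n = ps-cong {term (x + (y - x))} {term y} n λ k → *-congʳ (^-cong k (lem x y))

  exp-0 : exp 0# ≈ 1#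
  exp-0 = ≤-antisym (≤-respʳ-≈ (solve 0 (con (+ 1) :+ (con (+ 0) :+ con (+ 0)) := con (+ 1)) ≈-refl)
            (exp-small ≤-refl (≤-respˡ-≈ (solve 0 (con (+ 0) := con (+ 0) :+ con (+ 0)) ≈-refl) 0≤1))) (exp≥1 ≤-refl)

  exp-pos : ∀ x → 0# < exp x
  exp-pos x = [ (λ p → <-≤-trans 0<1 (exp≥1 p)) , (λ p → *-cancelˡ-< (<-≤-trans 0<1 (exp≥1 (0≤y-x p)))
      (<-respˡ-≈ (≈-sym (zeroʳ _)) (<-respʳ-≈ (≈-trans (≈-sym exp-0) (≈-trans (exp-split x 0#) (*-comm _ _))) 0<1))) ]′ (≤-total 0# x)

  exp-mono : ∀ {x y} → x ≤ y → exp x ≤ exp y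
  exp-mono {x} {y} p = ≤-respʳ-≈ (≈-sym (exp-split x y)) (≤-respˡ-≈ (*-identityʳ _)
    (*-monoˡ-≤ (<⇒≤ (exp-pos x)) (exp≥1 (0≤y-x p))))

  exp-cong : ∀ {x y} → x ≈ y → exp x ≈ exp y
  exp-cong eq = ≤-antisym (exp-mono (≤-reflexive eq)) (exp-mono (≤-reflexive (≈-sym eq)))

  exp>1 : ∀ {x} → 0# < x → 1# < exp x
  exp>1 {x} p = <-≤-trans (<-by p (lem x)) (exp≥1+x (<⇒≤ p))
    where
    lem : ∀ x → 1# + x - 1# ≈ x
    lem = solve 1 (λ x → con (+ 1) :+ x :- con (+ 1) := x) ≈-refl

  exp-mono-< : ∀ {x y} → x < y → exp x < exp y
  exp-mono-< {x} {y} p = <-respʳ-≈ (≈-sym (exp-split x y)) (<-respˡ-≈ (*-identityʳ _)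
    (*-monoˡ-< (exp-pos x) (exp>1 (0<y-x p))))

  exp-cancel-≤ : ∀ {x y} → exp x ≤ exp y → x ≤ y
  exp-cancel-≤ p = byContra λ ¬q → <⇒≱ (exp-mono-< (≰⇒> ¬q)) p

  exp-neg : ∀ x → exp x * exp (- x) ≈ 1#
  exp-neg x = ≈-trans (≈-sym (exp-+ x (- x))) (≈-trans (exp-cong (-‿inverseʳ x)) exp-0)

  small-step : ∀ c {d} → 0# < d → ∃ λ h → 0# < h × h + h ≤ 1# × c * h ≤ d
  small-step c {d} 0<d = go (archimedean (c * d ⁻¹))
    where
    lem : ∀ d i → c * i * d ≈ c * (d * i)
    lem d i = ≈-trans (*-assoc c i d) (*-congˡ (*-comm i d))
    lem₂ : ∀ i → i + i ≈ i * fromℕ 2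
    lem₂ = solve 1 (λ i → i :+ i := i :* con (+ 2)) ≈-refl
    lem₃ : ∀ n d i → n * d * i ≈ n * i * d
    lem₃ = solve 3 (λ n d i → n :* d :* i := n :* i :* d) ≈-refl
    go : (∃ λ n → c * d ⁻¹ < fromℕ n) → ∃ λ h → 0# < h × h + h ≤ 1# × c * h ≤ d
    go (n , p) = h , 0<h , ≤-respˡ-≈ (≈-sym (lem₂ h)) (≤-respʳ-≈ (≈-trans (*-comm h _) (⁻¹-inverse N≉0))
        (*-monoˡ-≤ (<⇒≤ 0<h) (fromℕ-mono {2} {N} (ℕ.s≤s (ℕ.s≤s ℕ.z≤n))))) ,
        ≤-respʳ-≈ (≈-trans (lem₃ _ d h) (≈-trans (*-congʳ (⁻¹-inverse N≉0)) (*-identityˡ d))) (*-monoʳ-≤ (<⇒≤ 0<h) c≤Nd)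
      where
      -- The two extra units make h = 1/N at most 1/2 whatever n is.
      N = suc (suc n)
      0<N : 0# < fromℕ N
      0<N = fromℕ-pos {N} (ℕ.s≤s ℕ.z≤n)
      N≉0 = pos⇒≉0 0<N
      h = fromℕ N ⁻¹
      0<h : 0# < h
      0<h = ⁻¹-pos 0<N
      c≤Nd : c ≤ fromℕ N * d
      c≤Nd = ≤-respˡ-≈ (≈-trans (lem d (d ⁻¹)) (≈-trans (*-congˡ (⁻¹-inverse (pos⇒≉0 0<d))) (*-identityʳ c)))
        (*-monoʳ-≤ (<⇒≤ 0<d) (≤-trans (<⇒≤ p) (fromℕ-mono (ℕₚ.≤-trans (ℕₚ.n≤1+n n) (ℕₚ.n≤1+n (suc n))))))

  -- An intermediate value argument at the supremum s, with the estimate exp h ≤ 1 + 2h in the place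
  -- of continuity. If exp s were less than y, then s + h would still qualify for a small h; if it
  -- were greater, s - h would already be an upper bound.
  exp-surjective≥1 : ∀ {y} → 1# ≤ y → ∃ λ x → exp x ≈ y
  exp-surjective≥1 {y} 1≤y = attained (lub (λ x → exp x ≤ y) (0# , ≤-respˡ-≈ (≈-sym exp-0) 1≤y)
      (y , λ x p → [ (λ 0≤x → ≤-trans (≤-by 0≤1 (lem₀ x)) (≤-trans (exp≥1+x 0≤x) p)) , (λ x≤0 → ≤-trans x≤0 (≤-trans 0≤1 1≤y)) ]′ (≤-total 0# x)))
    where
    lem₀ : ∀ x → 1# + x - x ≈ 1#
    lem₀ = solve 1 (λ x → con (+ 1) :+ x :- x := con (+ 1)) ≈-refl
    lem₁ : ∀ e h → e * (1# + (h + h)) ≈ e + (e + e) * h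
    lem₁ = solve 2 (λ e h → e :* (con (+ 1) :+ (h :+ h)) := e :+ (e :+ e) :* h) ≈-refl
    lem₂ : ∀ e y → e + (y - e) ≈ y
    lem₂ = solve 2 (λ e y → e :+ (y :- e) := y) ≈-refl
    lem₃ : ∀ s h → s + h - s ≈ h
    lem₃ = solve 2 (λ s h → s :+ h :- s := h) ≈-refl
    lem₄ : ∀ s h → s - (s - h) ≈ h
    lem₄ = solve 2 (λ s h → s :- (s :- h) := h) ≈-refl
    0<y : 0# < y
    0<y = <-≤-trans 0<1 1≤y
    attained : ∃ (IsLUB _≤_ (λ x → exp x ≤ y)) → ∃ λ x → exp x ≈ y
    attained (s , ub , least) = s , ≤-antisym
        (byContra λ ¬p → above (small-step (y + y) (0<y-x (≰⇒> ¬p))))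
        (byContra λ ¬p → below (small-step (exp s + exp s) (0<y-x (≰⇒> ¬p))))
      where
      below : ¬ ∃ λ h → 0# < h × h + h ≤ 1# × (exp s + exp s) * h ≤ y - exp s
      below (h , 0<h , 2h≤1 , small) = <⇒≱ (<-by 0<h (lem₃ s h)) (ub (s + h)
        (≤-respˡ-≈ (≈-sym (exp-+ s h)) (≤-trans (*-monoˡ-≤ (<⇒≤ (exp-pos s)) (exp-small (<⇒≤ 0<h) 2h≤1))
          (≤-respˡ-≈ (≈-sym (lem₁ (exp s) h)) (≤-respʳ-≈ (lem₂ (exp s) y) (+-monoʳ-≤ (exp s) small))))))
      above : ¬ ∃ λ h → 0# < h × h + h ≤ 1# × (y + y) * h ≤ exp s - y
      above (h , 0<h , 2h≤1 , small) = <⇒≱ (<-by 0<h (lem₄ s h)) (least (s - h) λ x p → exp-cancel-≤ (≤-trans p y≤))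
        where
        y≤ : y ≤ exp (s - h)
        y≤ = *-cancelˡ-≤ (exp-pos h) (≤-trans (≤-respˡ-≈ (*-comm y _) (*-monoˡ-≤ (<⇒≤ 0<y) (exp-small (<⇒≤ 0<h) 2h≤1)))
          (≤-respˡ-≈ (≈-sym (lem₁ y h)) (≤-respʳ-≈ (≈-trans (lem₂ y (exp s)) (exp-split h s)) (+-monoʳ-≤ y small))))

  exp-surjective : ∀ {y} → 0# < y → ∃ λ x → exp x ≈ y
  exp-surjective {y} 0<y = [ exp-surjective≥1 , (λ y≤1 → negate (exp-surjective≥1 (1≤y⁻¹ y≤1))) ]′ (≤-total 1# y)
    where
    y⁻¹-inv = ⁻¹-inverse (pos⇒≉0 0<y)
    1≤y⁻¹ : y ≤ 1# → 1# ≤ y ⁻¹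
    1≤y⁻¹ p = *-cancelˡ-≤ 0<y (≤-respʳ-≈ (≈-sym y⁻¹-inv) (≤-respˡ-≈ (≈-sym (*-identityʳ y)) p))
    negate : (∃ λ x → exp x ≈ y ⁻¹) → ∃ λ x → exp x ≈ y
    negate (x , eq) = - x , *-cancelˡ-≈ (exp-pos x) (≈-trans (exp-neg x)
      (≈-trans (≈-sym y⁻¹-inv) (≈-trans (*-comm y _) (*-congʳ (≈-sym eq)))))

  -- Logarithms and powers with real exponent

  exp-log : ∀ {x} → 0# < x → exp (log x) ≈ x
  exp-log p = the-spec 0# (exp-surjective p)

  log-mono : ∀ {x y} → 0# < x → x ≤ y → log x ≤ log y
  log-mono p q = exp-cancel-≤ (≤-respˡ-≈ (≈-sym (exp-log p)) (≤-respʳ-≈ (≈-sym (exp-log (<-≤-trans p q))) q))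

  exp-injective : ∀ {x y} → exp x ≈ exp y → x ≈ y
  exp-injective eq = ≤-antisym (exp-cancel-≤ (≤-reflexive eq)) (exp-cancel-≤ (≤-reflexive (≈-sym eq)))

  log-* : ∀ {x y} → 0# < x → 0# < y → log (x * y) ≈ log x + log y
  log-* {x} {y} p q = exp-injective (≈-trans (exp-log (*-pos p q))
    (≈-sym (≈-trans (exp-+ _ _) (*-cong (exp-log p) (exp-log q)))))

  log-1 : log 1# ≈ 0#
  log-1 = exp-injective (≈-trans (exp-log 0<1) (≈-sym exp-0))

  log2 : ℝ
  log2 = log (fromℕ 2)

  private
    0<2 : 0# < fromℕ 2
    0<2 = fromℕ-pos {2} (ℕ.s≤s ℕ.z≤n)

  log2-pos : 0# < log2
  log2-pos = ≰⇒> λ p → <⇒≱ (fromℕ-mono-< {1} {2} ℕₚ.≤-refl) (≤-respˡ-≈ (exp-log 0<2)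
    (≤-trans (exp-mono p) (≤-reflexive (≈-trans exp-0 (≈-sym (+-identityʳ 1#))))))

  log-pow2 : ∀ n → log (pow2 n) ≈ fromℕ n * log2
  log-pow2 zero    = ≈-trans (exp-injective (≈-trans (exp-log (pow2-pos 0)) (≈-trans (+-identityʳ 1#) (≈-sym exp-0)))) (≈-sym (zeroˡ _))
  log-pow2 (suc n) = ≈-trans (exp-injective (≈-trans (exp-log (pow2-pos (suc n))) (≈-trans (pow2-suc n) (≈-sym (exp-log (*-pos 0<2 (pow2-pos n)))))))
    (≈-trans (log-* 0<2 (pow2-pos n)) (≈-trans (+-congˡ (log-pow2 n)) (lem (fromℕ n) log2)))
    where
    lem : ∀ n l → l + n * l ≈ (1# + n) * l
    lem = solve 2 (λ n l → l :+ n :* l := (con (+ 1) :+ n) :* l) ≈-refl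

  exp-multiple : ∀ n z → exp (fromℕ n * z) ≈ exp z ^ n
  exp-multiple zero    z = ≈-trans (exp-cong (zeroˡ z)) exp-0
  exp-multiple (suc n) z = ≈-trans (exp-cong (lem (fromℕ n) z)) (≈-trans (exp-+ z _) (*-congˡ (exp-multiple n z)))
    where
    lem : ∀ n z → (1# + n) * z ≈ z + n * z
    lem = solve 2 (λ n z → (con (+ 1) :+ n) :* z := z :+ n :* z) ≈-refl

  -- 2^-s
  ratio : ℝ → ℝ
  ratio s = exp (- (s * log2))

  ratio-pos : ∀ s → 0# < ratio s
  ratio-pos s = exp-pos _

  ^ʳ-zero : ∀ {x} s → x ≈ 0# → x ^ʳ s ≡ 0#
  ^ʳ-zero {x} s eq with em 0ℓ {x ≈ 0#}
  ... | yes _ = ≡.refl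
  ... | no ¬p = contradiction eq ¬p

  ^ʳ-pos : ∀ {x} s → 0# < x → x ^ʳ s ≡ exp (s * log x)
  ^ʳ-pos {x} s 0<x with em 0ℓ {x ≈ 0#}
  ... | yes p = contradiction p (pos⇒≉0 0<x)
  ... | no _  = ≡.refl

  ^ʳ-nonNeg : ∀ x s → 0# ≤ x ^ʳ s
  ^ʳ-nonNeg x s with em 0ℓ {x ≈ 0#}
  ... | yes _ = ≤-refl
  ... | no _  = <⇒≤ (exp-pos _)

  private
    scale-exponent : ∀ s k l → s * (- (k * l)) ≈ k * - (s * l)
    scale-exponent = solve 3 (λ s k l → s :* (:- (k :* l)) := k :* :- (s :* l)) ≈-refl

    log-scale : ∀ {d} k → 0# < d → log (pow2 k * d) ≈ fromℕ k * log2 + log d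
    log-scale k 0<d = ≈-trans (log-* (pow2-pos k) 0<d) (+-congʳ (log-pow2 k))

  -- This and `^ʳ-upper` let the measure estimates work with integer powers of 2^-s in place of real
  -- powers of diameters.
  ^ʳ-lower : ∀ {d s} k → 0# < s → 0# < d → 1# ≤ pow2 k * d → ratio s ^ k ≤ d ^ʳ s
  ^ʳ-lower {d} {s} k 0<s 0<d p = ≤-respʳ-≈ (≈-reflexive (≡.sym (^ʳ-pos s 0<d))) (≤-respˡ-≈ (exp-multiple k _)
    (exp-mono (≤-respˡ-≈ (scale-exponent s (fromℕ k) log2) (*-monoˡ-≤ (<⇒≤ 0<s) log≥))))
    where
    lem : ∀ a b → b - - a ≈ a + b - 0#
    lem = solve 2 (λ a b → b :- :- a := a :+ b :- con (+ 0)) ≈-refl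
    log≥ : - (fromℕ k * log2) ≤ log d
    log≥ = ≤-by (0≤y-x (≤-respˡ-≈ log-1 (≤-respʳ-≈ (log-scale k 0<d) (log-mono 0<1 p)))) (lem _ _)

  ^ʳ-upper : ∀ {d s} k → 0# < s → 0# ≤ d → pow2 k * d ≤ 1# → d ^ʳ s ≤ ratio s ^ k
  ^ʳ-upper {d} {s} k 0<s 0≤d p = [ positive , (λ d≤0 → zero′ (≤-antisym d≤0 0≤d)) ]′ (swap (≤⊎> d 0#))
    where
    swap : ∀ {A B : Set} → A ⊎ B → B ⊎ A
    swap = [ inj₂ , inj₁ ]′
    lem : ∀ a b → - a - b ≈ 0# - (a + b)
    lem = solve 2 (λ a b → :- a :- b := con (+ 0) :- (a :+ b)) ≈-refl
    -- By convention 0 to the power s is 0, so degenerate sets obey the bound too.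
    zero′ : d ≈ 0# → d ^ʳ s ≤ ratio s ^ k
    zero′ eq = ≤-respˡ-≈ (≈-reflexive (≡.sym (^ʳ-zero s eq))) (≤-respʳ-≈ (exp-multiple k _) (<⇒≤ (exp-pos _)))
    positive : 0# < d → d ^ʳ s ≤ ratio s ^ k
    positive 0<d = ≤-respˡ-≈ (≈-reflexive (≡.sym (^ʳ-pos s 0<d))) (≤-respʳ-≈ (exp-multiple k _)
      (exp-mono (≤-respʳ-≈ (scale-exponent s (fromℕ k) log2) (*-monoˡ-≤ (<⇒≤ 0<s) log≤))))
      where
      log≤ : log d ≤ - (fromℕ k * log2)
      log≤ = ≤-by (0≤y-x (≤-respʳ-≈ log-1 (≤-respˡ-≈ (log-scale k 0<d) (log-mono (*-pos (pow2-pos k) 0<d) p)))) (lem _ _)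

  private
    2*ratio : ∀ s → fromℕ 2 * ratio s ≈ exp ((1# - s) * log2)
    2*ratio s = ≈-trans (*-congʳ (≈-sym (exp-log 0<2))) (≈-trans (≈-sym (exp-+ _ _)) (exp-cong (lem s log2)))
      where
      lem : ∀ s l → l + - (s * l) ≈ (1# - s) * l
      lem = solve 2 (λ s l → l :+ :- (s :* l) := (con (+ 1) :- s) :* l) ≈-refl

  -- The product is 2^(1-s), the growth rate that separates exponents below 1 from those above.
  1<2*ratio : ∀ {s} → s < 1# → 1# < fromℕ 2 * ratio s
  1<2*ratio {s} p = <-respʳ-≈ (≈-sym (2*ratio s)) (exp>1 (*-pos (0<y-x p) log2-pos))

  2*ratio<1 : ∀ {s} → 1# < s → fromℕ 2 * ratio s < 1#
  2*ratio<1 {s} p = <-respˡ-≈ (≈-sym (2*ratio s)) (<-respʳ-≈ exp-0 (exp-mono-<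
    (<-by (*-pos (0<y-x p) log2-pos) (lem s log2))))
    where
    lem : ∀ s l → 0# - (1# - s) * l ≈ (s - 1#) * l
    lem = solve 2 (λ s l → con (+ 0) :- (con (+ 1) :- s) :* l := (s :- con (+ 1)) :* l) ≈-refl

  ratio<1 : ∀ {s} → 0# < s → ratio s ≤ 1#
  ratio<1 {s} p = ≤-respʳ-≈ exp-0 (exp-mono (≤-by (<⇒≤ (*-pos p log2-pos)) (lem (s * log2))))
    where
    lem : ∀ x → 0# - - x ≈ x
    lem = solve 1 (λ x → con (+ 0) :- :- x := x) ≈-refl

  -- Extended reals

  open import Algebra.Properties.Semiring.Exp semiring using (^-assocʳ)

  private
    module E = NonStrict _≤_
    module ES = StrictExtrema _<_

  ≤±-trans : ∀ {x y z} → x ≤± y → y ≤± z → x ≤± z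
  ≤±-trans = E.≤±-trans ≤-trans

  ≤±-antisym : ∀ {x y} → x ≤± y → y ≤± x → x ≈± y
  ≤±-antisym = E.≤±-antisym ≤-antisym

  ≤±-reflexive : ∀ {x y} → x ≈± y → x ≤± y
  ≤±-reflexive = E.≤±-reflexive ≤-reflexive

  []-mono : ∀ {x y} → x ≤ y → [ x ] ≤± [ y ]
  []-mono p = E.[_] p

  []-cancel : ∀ {x y} → [ x ] ≤± [ y ] → x ≤ y
  []-cancel = E.[≤]-injective

  ⊤≰[] : ∀ {x} → ¬ ⊤± ≤± [ x ]
  ⊤≰[] ()

  []≰⊥ : ∀ {x} → ¬ [ x ] ≤± ⊥±
  []≰⊥ (Supremum.[_] ())

  ⊥±-least : ∀ x → ⊥± ≤± x
  ⊥±-least = E.⊥±≤_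

  lub± : ∀ {ℓ} (S : Pred ℝ± ℓ) → ∃ (IsLUB _≤±_ S)
  lub± {ℓ} S = byBound (em ℓ)
    where
    byPoint : ∀ b → (∀ x → x ∈ S → x ≤± [ b ]) → Dec (∃ λ x → [ x ] ∈ S) → ∃ (IsLUB _≤±_ S)
    byPoint b S≤b (no ¬x) = ⊥± , below , λ c _ → E.⊥±≤ c
      where
      below : ∀ x → x ∈ S → x ≤± ⊥±
      below ⊥±    _ = E.⊥±≤ ⊥±
      below [ x ] p = contradiction (x , p) ¬x
      below ⊤±    p = contradiction (S≤b ⊤± p) ⊤≰[]
    -- `lub` takes predicates of level 0 only; `True` of the excluded-middle decision brings `S`
    -- down to that level.
    byPoint b S≤b (yes (x₀ , x₀∈S)) = least (lub (λ x → True (em ℓ {[ x ] ∈ S})) (x₀ , fromWitness x₀∈S)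
        (b , λ x p → []-cancel (S≤b [ x ] (toWitness p))))
      where
      least : ∃ (IsLUB _≤_ (λ x → True (em ℓ {[ x ] ∈ S}))) → ∃ (IsLUB _≤±_ S)
      least (s , ub , min) = [ s ] , below , above
        where
        below : ∀ x → x ∈ S → x ≤± [ s ]
        below ⊥±    _ = E.⊥±≤ [ s ]
        below [ x ] p = []-mono (ub x (fromWitness p))
        below ⊤±    p = contradiction (S≤b ⊤± p) ⊤≰[]
        above : ∀ c → (∀ x → x ∈ S → x ≤± c) → [ s ] ≤± c
        above ⊥±    h = contradiction (h [ x₀ ] x₀∈S) []≰⊥
        above [ c ] h = []-mono (min c λ x p → []-cancel (h [ x ] (toWitness p)))
        above ⊤±    h = [ s ] E.≤⊤±
    byBound : Dec (∃ λ b → ∀ x → x ∈ S → x ≤± [ b ]) → ∃ (IsLUB _≤±_ S)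
    byBound (yes (b , S≤b)) = byPoint b S≤b (em ℓ)
    byBound (no unbounded)  = ⊤± , (λ x _ → x E.≤⊤±) , above
      where
      above : ∀ c → (∀ x → x ∈ S → x ≤± c) → ⊤± ≤± c
      above ⊥±    h = contradiction (0# , λ x p → ≤±-trans (h x p) (E.⊥±≤ [ 0# ])) unbounded
      above [ c ] h = contradiction (c , h) unbounded
      above ⊤±    h = ⊤± E.≤⊤±

  glb± : ∀ {ℓ} (S : Pred ℝ± ℓ) → ∃ (IsGLB _≤±_ S)
  glb± S = dual (lub± λ b → ∀ x → x ∈ S → b ≤± x)
    where
    dual : ∃ (IsLUB _≤±_ λ b → ∀ x → x ∈ S → b ≤± x) → ∃ (IsGLB _≤±_ S)
    dual (s , ub , least) = s , (λ x p → least x λ b h → h x p) , ub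

  sup±-spec : ∀ {ℓ} (S : Pred ℝ± ℓ) → IsLUB _≤±_ S (sup± S)
  sup±-spec S = the-spec [ 0# ] (lub± S)

  inf±-spec : ∀ {ℓ} (S : Pred ℝ± ℓ) → IsGLB _≤±_ S (inf± S)
  inf±-spec S = the-spec [ 0# ] (glb± S)

  series-upper : ∀ f {c} → (∀ n → partialSum f n ≤ c) → series f ≤± [ c ]
  series-upper f h = proj₂ (sup±-spec _) _ λ { _ (n , ≡.refl) → []-mono (h n) }

  series-lower : ∀ f n → [ partialSum f n ] ≤± series f
  series-lower f n = proj₁ (sup±-spec _) _ (n , ≡.refl)

  liminf-lower : ∀ {f c} N → (∀ q → 1 ℕ.≤ q → N ℕ.≤ q → c ≤ f q) → [ c ] ≤± liminf f
  liminf-lower {f} {c} N h = ≤±-trans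
    (proj₂ (inf±-spec _) [ c ] λ { _ (q , p , r , ≡.refl) → []-mono (h q p r) })
    (proj₁ (sup±-spec _) _ (N , ≡.refl))

  pos±⇒bound : ∀ {x} → [ 0# ] <± x → ∃ λ c → 0# < c × [ c ] ≤± x
  pos±⇒bound {⊥±}    (StrictSupremum.[_] ())
  pos±⇒bound {[ x ]} p = x , ES.[<]-injective p , []-mono ≤-refl
  pos±⇒bound {⊤±}    p = 1# , 0<1 , [ 1# ] E.≤⊤±

  bound⇒pos± : ∀ {x c} → 0# < c → [ c ] ≤± x → [ 0# ] <± x
  bound⇒pos± {⊥±}    0<c p = contradiction p []≰⊥
  bound⇒pos± {[ x ]} 0<c p = ES.[_] (<-≤-trans 0<c ([]-cancel p))
  bound⇒pos± {⊤±}    0<c p = ES.[_]<⊤± 0#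

  zero± : ∀ {x} → [ 0# ] ≤± x → (∀ ε → 0# < ε → x ≤± [ ε ]) → x ≈± [ 0# ]
  zero± {⊥±}    p h = contradiction p []≰⊥
  zero± {⊤±}    p h = contradiction (h 1# 0<1) ⊤≰[]
  zero± {[ x ]} p h = ≤±-antisym ([]-mono (byContra λ ¬q → squeeze (halve (≰⇒> ¬q)))) p
    where
    squeeze : ¬ ∃ λ ε → 0# < ε × ε + ε ≈ x
    squeeze (ε , 0<ε , eq) = <⇒≱ (<-respʳ-≈ eq (<-by 0<ε (lem ε))) ([]-cancel (h ε 0<ε))
      where
      lem : ∀ ε → ε + ε - ε ≈ ε
      lem = solve 1 (λ ε → ε :+ ε :- ε := ε) ≈-refl

  -- Diameters

  module _ (U : Pred ℝ 0ℓ) {δ : ℝ} (0≤δ : 0# ≤ δ) (small : ∀ x y → x ∈ U → y ∈ U → ∣ x - y ∣ ≤ δ) where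

    private
      Distances : Pred ℝ 0ℓ
      Distances d = d ≈ 0# ⊎ ∃₂ λ x y → x ∈ U × y ∈ U × d ≈ ∣ x - y ∣

      distance≤δ : ∀ d → d ∈ Distances → d ≤ δ
      distance≤δ d (inj₁ eq)                  = ≤-respˡ-≈ (≈-sym eq) 0≤δ
      distance≤δ d (inj₂ (x , y , p , q , eq)) = ≤-respˡ-≈ (≈-sym eq) (small x y p q)

      -- The bound δ guarantees that the distances have a supremum; without one, `diam` would be the
      -- default value 0.
      diam-spec : IsLUB _≤_ Distances (diam U)
      diam-spec = the-spec 0# (lub Distances (0# , inj₁ ≈-refl) (δ , distance≤δ))

    diam-nonNeg : 0# ≤ diam U
    diam-nonNeg = proj₁ diam-spec 0# (inj₁ ≈-refl)

    diam-upper : ∀ {b} → 0# ≤ b → (∀ x y → x ∈ U → y ∈ U → ∣ x - y ∣ ≤ b) → diam U ≤ b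
    diam-upper {b} 0≤b h = proj₂ diam-spec b λ
      { d (inj₁ eq)                  → ≤-respˡ-≈ (≈-sym eq) 0≤b
      ; d (inj₂ (x , y , p , q , eq)) → ≤-respˡ-≈ (≈-sym eq) (h x y p q) }

    diam-lower : ∀ x y → x ∈ U → y ∈ U → ∣ x - y ∣ ≤ diam U
    diam-lower x y p q = proj₁ diam-spec _ (inj₂ (x , y , p , q , ≈-refl))

  -- Growth of powers

  ^-nonNeg : ∀ {x} n → 0# ≤ x → 0# ≤ x ^ n
  ^-nonNeg zero    p = 0≤1
  ^-nonNeg (suc n) p = *-nonNeg p (^-nonNeg n p)

  ^-mono : ∀ {x y} n → 0# ≤ x → x ≤ y → x ^ n ≤ y ^ n
  ^-mono zero    p q = ≤-refl
  ^-mono (suc n) p q = *-mono-≤ p q (^-nonNeg n p) (^-mono n p q)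

  ^-grow : ∀ {x m n} → 1# ≤ x → m ℕ.≤ n → x ^ m ≤ x ^ n
  ^-grow {x} {n = zero}  1≤x ℕ.z≤n     = ≤-refl
  ^-grow {x} {n = suc n} 1≤x ℕ.z≤n     = ≤-trans (^-grow {x} {0} {n} 1≤x ℕ.z≤n)
    (≤-respˡ-≈ (*-identityˡ _) (*-monoʳ-≤ (^-nonNeg n (≤-trans 0≤1 1≤x)) 1≤x))
  ^-grow {x} 1≤x (ℕ.s≤s p) = *-monoˡ-≤ (≤-trans 0≤1 1≤x) (^-grow 1≤x p)

  bernoulli : ∀ {e} n → 0# ≤ e → 1# + fromℕ n * e ≤ (1# + e) ^ n
  bernoulli {e} zero    0≤e = ≤-reflexive (lem e)
    where
    lem : ∀ e → 1# + 0# * e ≈ 1#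
    lem = solve 1 (λ e → con (+ 1) :+ con (+ 0) :* e := con (+ 1)) ≈-refl
  bernoulli {e} (suc n) 0≤e = ≤-trans (≤-by (*-nonNeg (fromℕ-nonNeg n) (*-nonNeg 0≤e 0≤e)) (lem e (fromℕ n)))
    (*-monoˡ-≤ (+-nonNeg 0≤1 0≤e) (bernoulli n 0≤e))
    where
    lem : ∀ e n → (1# + e) * (1# + n * e) - (1# + (1# + n) * e) ≈ n * (e * e)
    lem = solve 2 (λ e n → (con (+ 1) :+ e) :* (con (+ 1) :+ n :* e) :- (con (+ 1) :+ (con (+ 1) :+ n) :* e) := n :* (e :* e)) ≈-refl

  third : ∀ l → ∃ λ n → n ℕ.* 3 ℕ.≤ l × l ℕ.≤ n ℕ.* 3 ℕ.+ 2
  third zero                = 0 , ℕ.z≤n , ℕ.z≤n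
  third (suc zero)          = 0 , ℕ.z≤n , ℕ.s≤s ℕ.z≤n
  third (suc (suc zero))    = 0 , ℕ.z≤n , ℕ.s≤s (ℕ.s≤s ℕ.z≤n)
  third (suc (suc (suc l))) = suc (proj₁ (third l)) , ℕ.s≤s (ℕ.s≤s (ℕ.s≤s (proj₁ (proj₂ (third l))))) ,
                                                      ℕ.s≤s (ℕ.s≤s (ℕ.s≤s (proj₂ (proj₂ (third l)))))

  -- By Bernoulli's inequality, h^(3n) = (h^n)^3 grows at least like n^3.
  growth : ∀ {h v} C → 1# < h → 0# < v → ∃ λ M → 1 ℕ.≤ M × ∀ l → M ℕ.≤ l → fromℕ (C ℕ.* (l ℕ.* l)) ≤ v * h ^ l
  growth {h} {v} C 1<h 0<v = choose (archimedean (fromℕ (36 ℕ.* C) * (v * e³) ⁻¹))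
    where
    open import Data.Nat.Tactic.RingSolver using (solve-∀)
    e = h - 1#
    e³ = e * (e * e)
    0<e : 0# < e
    0<e = 0<y-x 1<h
    0<ve³ : 0# < v * e³
    0<ve³ = *-pos 0<v (*-pos 0<e (*-pos 0<e 0<e))
    1+e : ∀ h → 1# + (h - 1#) ≈ h
    1+e = solve 1 (λ h → con (+ 1) :+ (h :- con (+ 1)) := h) ≈-refl
    power : ∀ n → fromℕ n * e ≤ h ^ n
    power n = ≤-trans (≤-by 0≤1 (lem (fromℕ n * e))) (≤-trans (bernoulli n (<⇒≤ 0<e))
      (^-mono n (+-nonNeg 0≤1 (<⇒≤ 0<e)) (≤-reflexive (1+e h))))
      where
      lem : ∀ x → 1# + x - x ≈ 1#
      lem = solve 1 (λ x → con (+ 1) :+ x :- x := con (+ 1)) ≈-refl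
    choose : (∃ λ n → fromℕ (36 ℕ.* C) * (v * e³) ⁻¹ < fromℕ n) →
             ∃ λ M → 1 ℕ.≤ M × ∀ l → M ℕ.≤ l → fromℕ (C ℕ.* (l ℕ.* l)) ≤ v * h ^ l
    choose (n₀ , n₀>) = suc n₀ ℕ.* 3 , ℕ.s≤s ℕ.z≤n , λ l M≤l → bound l M≤l (third l)
      where
      bound : ∀ l → suc n₀ ℕ.* 3 ℕ.≤ l → (∃ λ n → n ℕ.* 3 ℕ.≤ l × l ℕ.≤ n ℕ.* 3 ℕ.+ 2) →
              fromℕ (C ℕ.* (l ℕ.* l)) ≤ v * h ^ l
      bound l M≤l (n , 3n≤l , l≤) = ≤-trans (fromℕ-mono squares) (≤-respˡ-≈ (≈-sym (fromℕ-* (36 ℕ.* C) (n ℕ.* n)))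
          (≤-trans (*-monoʳ-≤ (fromℕ-nonNeg (n ℕ.* n)) coefficient≤) (≤-trans (≤-reflexive regroup)
            (*-monoˡ-≤ (<⇒≤ 0<v) (≤-trans cube (^-grow (<⇒≤ 1<h) 3n≤l))))))
        where
        1+n₀≤n : suc n₀ ℕ.≤ n
        1+n₀≤n = ℕₚ.≤-pred (ℕₚ.*-cancelʳ-< 3 (suc n₀) (suc n) (ℕₚ.≤-trans (ℕ.s≤s (ℕₚ.≤-trans M≤l l≤))
          (ℕₚ.≤-reflexive (≡.cong suc (ℕₚ.+-comm (n ℕ.* 3) 2)))))
        1≤n : 1 ℕ.≤ n
        1≤n = ℕₚ.≤-trans (ℕ.s≤s ℕ.z≤n) 1+n₀≤n
        -- The origin of the constant 36, the square of 6.
        l≤6n : l ℕ.≤ 6 ℕ.* n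
        l≤6n = ℕₚ.≤-trans l≤ (ℕₚ.≤-trans (ℕₚ.+-monoʳ-≤ (n ℕ.* 3) (ℕₚ.≤-trans (ℕₚ.n≤1+n 2) (ℕₚ.*-monoʳ-≤ 3 1≤n)))
          (ℕₚ.≤-reflexive (eq n)))
          where
          eq : ∀ n → n ℕ.* 3 ℕ.+ 3 ℕ.* n ≡ 6 ℕ.* n
          eq = solve-∀
        squares : C ℕ.* (l ℕ.* l) ℕ.≤ 36 ℕ.* C ℕ.* (n ℕ.* n)
        squares = ℕₚ.≤-trans (ℕₚ.*-monoʳ-≤ C (ℕₚ.*-mono-≤ l≤6n l≤6n)) (ℕₚ.≤-reflexive (eq C n))
          where
          eq : ∀ C n → C ℕ.* (6 ℕ.* n ℕ.* (6 ℕ.* n)) ≡ 36 ℕ.* C ℕ.* (n ℕ.* n)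
          eq = solve-∀
        lem₁ : ∀ c i w → c * i * w ≈ c * (w * i)
        lem₁ c i w = ≈-trans (*-assoc c i w) (*-congˡ (*-comm i w))
        coefficient≤ : fromℕ (36 ℕ.* C) ≤ fromℕ n * (v * e³)
        coefficient≤ = ≤-respˡ-≈ (≈-trans (lem₁ _ _ _) (≈-trans (*-congˡ (⁻¹-inverse (pos⇒≉0 0<ve³))) (*-identityʳ _)))
          (*-monoʳ-≤ (<⇒≤ 0<ve³) (≤-trans (<⇒≤ n₀>) (fromℕ-mono (ℕₚ.≤-trans (ℕₚ.n≤1+n n₀) 1+n₀≤n))))
        lem₂ : ∀ n v e → n * (v * (e * (e * e))) * (n * n) ≈ v * ((n * e) * ((n * e) * ((n * e) * 1#)))
        lem₂ = solve 3 (λ n v e → n :* (v :* (e :* (e :* e))) :* (n :* n) := v :* ((n :* e) :* ((n :* e) :* ((n :* e) :* con (+ 1))))) ≈-refl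
        regroup : fromℕ n * (v * e³) * fromℕ (n ℕ.* n) ≈ v * (fromℕ n * e) ^ 3
        regroup = ≈-trans (*-congˡ (fromℕ-* n n)) (lem₂ (fromℕ n) v e)
        cube : (fromℕ n * e) ^ 3 ≤ h ^ (n ℕ.* 3)
        cube = ≤-trans (^-mono 3 (*-nonNeg (fromℕ-nonNeg n) (<⇒≤ 0<e)) (power n)) (≤-reflexive (^-assocʳ h n 3))

  -- Hausdorff measure of exponent greater than 1

  -- A cover of the line in which the m-th block consists of 2^(M+m) intervals of length 2^-(M+m)
  -- and covers [i, i+1], where i is the m-th integer in the enumeration 0, -1, 1, -2, ...
  module LineCover (M : ℕ) where

    integer : ℕ → ℤ
    integer zero          = + 0
    integer (suc zero)    = -[1+ 0 ]
    integer (suc (suc m)) = away (integer m)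
      where
      away : ℤ → ℤ
      away (+ n)    = + suc n
      away -[1+ n ] = -[1+ suc n ]

    integer-surjective : ∀ i → ∃ λ m → integer m ≡ i
    integer-surjective (+ zero)      = 0 , ≡.refl
    integer-surjective (+ suc n)     = next (integer-surjective (+ n))
      where
      next : (∃ λ m → integer m ≡ + n) → ∃ λ m → integer m ≡ + suc n
      next (m , eq) = suc (suc m) , lem eq
        where
        lem : integer m ≡ + n → integer (suc (suc m)) ≡ + suc n
        lem eq rewrite eq = ≡.refl
    integer-surjective -[1+ zero ]   = 1 , ≡.refl
    integer-surjective -[1+ suc n ]  = next (integer-surjective -[1+ n ])
      where
      next : (∃ λ m → integer m ≡ -[1+ n ]) → ∃ λ m → integer m ≡ -[1+ suc n ]
      next (m , eq) = suc (suc m) , lem eq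
        where
        lem : integer m ≡ -[1+ n ] → integer (suc (suc m)) ≡ -[1+ suc n ]
        lem eq rewrite eq = ≡.refl

    -- Ever finer subdivisions make the costs of the infinitely many unit intervals summable.
    size : ℕ → ℕ
    size m = 2 ℕ.^ (M ℕ.+ m)

    -- A position is a block together with the number of intervals of the block still to come.
    advance : ℕ × ℕ → ℕ × ℕ
    advance (m , suc r) = m , r
    advance (m , zero)  = suc m , size (suc m) ℕ.∸ 1

    position : ℕ → ℕ × ℕ
    position zero    = 0 , size 0 ℕ.∸ 1
    position (suc i) = advance (position i)

    size-pos : ∀ m → suc (size m ℕ.∸ 1) ≡ size m
    size-pos m = ℕₚ.m+[n∸m]≡n (ℕₚ.m^n>0 2 (M ℕ.+ m))

    Visited : ℕ × ℕ → Set
    Visited p = ∃ λ i → position i ≡ p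

    visit-below : ∀ m r r′ → r′ ℕ.≤ r → Visited (m , r) → Visited (m , r′)
    visit-below m r r′ r′≤r v with ℕₚ.m≤n⇒m<n∨m≡n r′≤r
    ... | inj₂ ≡.refl = v
    visit-below m (suc r) r′ _ (i , eq) | inj₁ r′<r = visit-below m r r′ (ℕₚ.≤-pred r′<r) (suc i , ≡.cong advance eq)

    visit-block : ∀ m → Visited (m , size m ℕ.∸ 1)
    visit-block zero    = 0 , ≡.refl
    visit-block (suc m) = suc (proj₁ last) , ≡.cong advance (proj₂ last)
      where
      last : Visited (m , 0)
      last = visit-below m (size m ℕ.∸ 1) 0 ℕ.z≤n (visit-block m)

    visit : ∀ m r → r ℕ.< size m → Visited (m , r)
    visit m r r< = visit-below m (size m ℕ.∸ 1) r
      (ℕₚ.≤-pred (ℕₚ.≤-trans r< (ℕₚ.≤-reflexive (≡.sym (size-pos m))))) (visit-block m)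

    Interval : ℕ × ℕ → Pred ℝ 0ℓ
    Interval (m , r) x = fromℕ r ≤ fromℕ (size m) * (x - fromℤ (integer m))
                       × fromℕ (size m) * (x - fromℤ (integer m)) ≤ fromℕ (suc r)

    U : ℕ → Pred ℝ 0ℓ
    U i = Interval (position i)

    covers : ∀ x → ∃ λ i → x ∈ U i
    covers x = locate (floor x)
      where
      lem : ∀ x i → i + 1# - x ≈ 1# - (x - i)
      lem = solve 2 (λ x i → i :+ con (+ 1) :- x := con (+ 1) :- (x :- i)) ≈-refl
      locate : (∃ λ i → fromℤ i ≤ x × x < fromℤ i + 1#) → ∃ λ i → x ∈ U i
      locate (i , lo , hi) = block (integer-surjective i)
        where
        block : (∃ λ m → integer m ≡ i) → ∃ λ i → x ∈ U i
        block (m , ≡.refl) = cell (floorℕ y (*-nonNeg (fromℕ-nonNeg (size m)) (0≤y-x lo)))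
          where
          y = fromℕ (size m) * (x - fromℤ (integer m))
          y< : y < fromℕ (size m)
          y< = <-respʳ-≈ (*-identityʳ _) (*-monoˡ-< (pow2-pos (M ℕ.+ m)) (<-by (0<y-x hi) (≈-sym (lem x _))))
          cell : (∃ λ n → fromℕ n ≤ y × y < fromℕ (suc n)) → ∃ λ i → x ∈ U i
          cell (r , r≤y , y<r) = found (visit m r (fromℕ-cancel-< (≤-<-trans r≤y y<)))
            where
            found : Visited (m , r) → ∃ λ i → x ∈ U i
            found (k , eq) = k , ≡.subst (λ p → Interval p x) (≡.sym eq) (r≤y , <⇒≤ y<r)

    thin : ∀ p x y → Interval p x → Interval p y → fromℕ (size (proj₁ p)) * ∣ x - y ∣ ≤ 1#
    thin (m , r) x y (x≥ , x≤) (y≥ , y≤) = ≤-trans (∣∣-scale (x - y) (fromℕ-nonNeg (size m))) (∣∣-lub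
        (≤-by (+-nonNeg (0≤y-x x≤) (0≤y-x y≥)) (lem₁ n (fromℕ r) x y i))
        (≤-by (+-nonNeg (0≤y-x y≤) (0≤y-x x≥)) (lem₂ n (fromℕ r) x y i)))
      where
      n = fromℕ (size m)
      i = fromℤ (integer m)
      lem₁ : ∀ n r x y i → 1# - n * (x - y) ≈ (1# + r - n * (x - i)) + (n * (y - i) - r)
      lem₁ = solve 5 (λ n r x y i → con (+ 1) :- n :* (x :- y) := (con (+ 1) :+ r :- n :* (x :- i)) :+ (n :* (y :- i) :- r)) ≈-refl
      lem₂ : ∀ n r x y i → 1# - - (n * (x - y)) ≈ (1# + r - n * (y - i)) + (n * (x - i) - r)
      lem₂ = solve 5 (λ n r x y i → con (+ 1) :- :- (n :* (x :- y)) := (con (+ 1) :+ r :- n :* (y :- i)) :+ (n :* (x :- i) :- r)) ≈-refl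

    module _ {δ : ℝ} (1≤2^Mδ : 1# ≤ pow2 M * δ) where

      0≤δ : 0# ≤ δ
      0≤δ = *-cancelˡ-≤ (pow2-pos M) (≤-respˡ-≈ (≈-sym (zeroʳ _)) (≤-trans 0≤1 1≤2^Mδ))

      small : ∀ i x y → x ∈ U i → y ∈ U i → ∣ x - y ∣ ≤ δ
      small i x y p q = *-cancelˡ-≤ (pow2-pos (M ℕ.+ m)) (≤-trans (thin (position i) x y p q)
        (≤-trans 1≤2^Mδ (*-monoʳ-≤ 0≤δ (pow2-mono (ℕₚ.m≤m+n M m)))))
        where
        m = proj₁ (position i)

      diam-thin : ∀ i → fromℕ (size (proj₁ (position i))) * diam (U i) ≤ 1#
      diam-thin i = ≤-respʳ-≈ (⁻¹-inverse n≉0) (*-monoˡ-≤ (<⇒≤ 0<n) (diam-upper (U i) 0≤δ (small i) (<⇒≤ (⁻¹-pos 0<n))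
        λ x y p q → *-cancelˡ-≤ 0<n (≤-respʳ-≈ (≈-sym (⁻¹-inverse n≉0)) (thin (position i) x y p q))))
        where
        m = proj₁ (position i)
        0<n : 0# < fromℕ (size m)
        0<n = pow2-pos (M ℕ.+ m)
        n≉0 = pos⇒≉0 0<n

      module Cost (s : ℝ) (1<s : 1# < s) where

        v w c : ℝ
        v = ratio s
        w = fromℕ 2 * v
        c = (1# - w) ⁻¹

        cost : ℕ → ℝ
        cost i = diam (U i) ^ʳ s

        cost≤ : ∀ i → cost i ≤ v ^ (M ℕ.+ proj₁ (position i))
        cost≤ i = ^ʳ-upper (M ℕ.+ proj₁ (position i)) (<-trans 0<1 1<s) (diam-nonNeg (U i) 0≤δ (small i)) (diam-thin i)

        0<1-w : 0# < 1# - w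
        0<1-w = 0<y-x (2*ratio<1 1<s)

        0≤v : 0# ≤ v
        0≤v = <⇒≤ (ratio-pos s)

        0≤w : 0# ≤ w
        0≤w = *-nonNeg (fromℕ-nonNeg 2) 0≤v

        -- The total cost of the blocks from m on.
        rest : ℕ → ℝ
        rest m = w ^ (M ℕ.+ m) * c

        pow2*^ : ∀ n → pow2 n * v ^ n ≈ w ^ n
        pow2*^ zero    = solve 0 ((con (+ 1) :+ con (+ 0)) :* con (+ 1) := con (+ 1)) ≈-refl
        pow2*^ (suc n) = ≈-trans (*-congʳ (pow2-suc n)) (≈-trans (lem (fromℕ 2) (pow2 n) v (v ^ n)) (*-congˡ (pow2*^ n)))
          where
          lem : ∀ t p v x → t * p * (v * x) ≈ t * v * (p * x)
          lem = solve 4 (λ t p v x → t :* p :* (v :* x) := t :* v :* (p :* x)) ≈-refl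

        -- Block m has 2^(M+m) intervals of cost at most v^(M+m), together w^(M+m); the factor c =
        -- 1/(1 - w) sums the geometric series that starts with it.
        rest-suc : ∀ m → fromℕ (size m) * v ^ (M ℕ.+ m) + rest (suc m) ≈ rest m
        rest-suc m = ≈-trans (+-cong (pow2*^ (M ℕ.+ m)) (*-congʳ (≈-reflexive (≡.cong (w ^_) (ℕₚ.+-suc M m)))))
          (≈-trans (+-congʳ (≈-trans (≈-sym (*-identityʳ _)) (*-congˡ (≈-sym (⁻¹-inverse (pos⇒≉0 0<1-w)))))) (lem (w ^ (M ℕ.+ m)) w c))
          where
          lem : ∀ x w c → x * ((1# - w) * c) + w * x * c ≈ x * c
          lem = solve 3 (λ x w c → x :* ((con (+ 1) :- w) :* c) :+ w :* x :* c := x :* c) ≈-refl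

        -- An upper bound for the cost of the intervals from the given position on.
        potential : ℕ × ℕ → ℝ
        potential (m , r) = fromℕ (suc r) * v ^ (M ℕ.+ m) + rest (suc m)

        potential-nonNeg : ∀ p → 0# ≤ potential p
        potential-nonNeg (m , r) = +-nonNeg (*-nonNeg (fromℕ-nonNeg (suc r)) (^-nonNeg (M ℕ.+ m) 0≤v))
          (*-nonNeg (^-nonNeg (M ℕ.+ suc m) 0≤w) (<⇒≤ (⁻¹-pos 0<1-w)))

        potential-start : ∀ m → potential (m , size m ℕ.∸ 1) ≈ rest m
        potential-start m = ≈-trans (+-congʳ (*-congʳ (≈-reflexive (≡.cong fromℕ (size-pos m))))) (rest-suc m)

        descend : ∀ p → v ^ (M ℕ.+ proj₁ p) + potential (advance p) ≈ potential p
        descend (m , suc r) = lem (fromℕ r) (v ^ (M ℕ.+ m)) (rest (suc m))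
          where
          lem : ∀ r x y → x + ((1# + r) * x + y) ≈ (1# + (1# + r)) * x + y
          lem = solve 3 (λ r x y → x :+ ((con (+ 1) :+ r) :* x :+ y) := (con (+ 1) :+ (con (+ 1) :+ r)) :* x :+ y) ≈-refl
        descend (m , zero) = ≈-trans (+-congˡ (potential-start (suc m))) (+-congʳ (lem (v ^ (M ℕ.+ m))))
          where
          lem : ∀ x → x ≈ (1# + 0#) * x
          lem = solve 1 (λ x → x := (con (+ 1) :+ con (+ 0)) :* x) ≈-refl

        -- Every interval is paid for by the drop of the potential in `descend`. This bounds the
        -- partial sums in the middle of a block as well, with no double sum over blocks and
        -- intervals.
        total : ∀ n → partialSum cost n + potential (position n) ≤ rest 0
        total zero    = ≤-reflexive (≈-trans (+-identityˡ _) (potential-start 0))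
        total (suc n) = ≤-trans (≤-respˡ-≈ (≈-trans (≈-sym (+-assoc _ _ _)) (+-congʳ (≈-sym (ps-last cost n))))
          (+-monoʳ-≤ (partialSum cost n) (≤-trans (+-mono-≤ (cost≤ n) ≤-refl) (≤-reflexive (descend (position n)))))) (total n)

        total≤ : ∀ n → partialSum cost n ≤ rest 0
        total≤ n = ≤-trans (≤-by (potential-nonNeg (position n)) (lem (partialSum cost n) (potential (position n)))) (total n)
          where
          lem : ∀ a b → a + b - a ≈ b
          lem = solve 2 (λ a b → a :+ b :- a := b) ≈-refl

  -- For k above c/ε, `growth` applied to 1/w yields w^-n ≥ k n^2 ≥ k for large n.
  geometric-null : ∀ {w} → 0# < w → w < 1# → ∀ c {ε} → 0# < ε → ∃ λ M → ∀ n → M ℕ.≤ n → w ^ n * c ≤ ε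
  geometric-null {w} 0<w w<1 c {ε} 0<ε = choose (archimedean (c * ε ⁻¹))
    where
    open import Algebra.Properties.CommutativeSemiring.Exp (CommutativeRing.commutativeSemiring commutativeRing) using (^-distrib-*)
    h = w ⁻¹
    wh≈1 : w * h ≈ 1#
    wh≈1 = ⁻¹-inverse (pos⇒≉0 0<w)
    1<h : 1# < h
    1<h = *-cancelˡ-< 0<w (<-respʳ-≈ (≈-sym wh≈1) (<-respˡ-≈ (≈-sym (*-identityʳ w)) w<1))
    one^ : ∀ n → 1# ^ n ≈ 1#
    one^ zero    = ≈-refl
    one^ (suc n) = ≈-trans (*-identityˡ _) (one^ n)
    lem : ∀ c i e → c * i * e ≈ c * (e * i)
    lem c i e = ≈-trans (*-assoc c i e) (*-congˡ (*-comm i e))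
    choose : (∃ λ k → c * ε ⁻¹ < fromℕ k) → ∃ λ M → ∀ n → M ℕ.≤ n → w ^ n * c ≤ ε
    choose (k , k>) = finish (growth k 1<h 0<1)
      where
      c≤kε : c ≤ fromℕ k * ε
      c≤kε = ≤-respˡ-≈ (≈-trans (lem c (ε ⁻¹) ε) (≈-trans (*-congˡ (⁻¹-inverse (pos⇒≉0 0<ε))) (*-identityʳ c))) (*-monoʳ-≤ (<⇒≤ 0<ε) (<⇒≤ k>))
      finish : (∃ λ M → 1 ℕ.≤ M × ∀ l → M ℕ.≤ l → fromℕ (k ℕ.* (l ℕ.* l)) ≤ 1# * h ^ l) → ∃ λ M → ∀ n → M ℕ.≤ n → w ^ n * c ≤ ε
      finish (M , 1≤M , bound) = M , λ n M≤n → ≤-trans (*-monoˡ-≤ (^-nonNeg n (<⇒≤ 0<w)) (≤-trans c≤kε (*-monoʳ-≤ (<⇒≤ 0<ε)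
          (≤-trans (fromℕ-mono (k≤ n (ℕₚ.≤-trans 1≤M M≤n))) (≤-respʳ-≈ (*-identityˡ _) (bound n M≤n))))))
        (≤-reflexive (≈-trans (≈-sym (*-assoc _ _ ε)) (≈-trans (*-congʳ (≈-trans (≈-sym (^-distrib-* w h n))
          (≈-trans (^-congˡ n wh≈1) (one^ n)))) (*-identityˡ ε))))
        where
        open import Algebra.Properties.Semiring.Exp semiring using (^-congˡ)
        k≤ : ∀ n → 1 ℕ.≤ n → k ℕ.≤ k ℕ.* (n ℕ.* n)
        k≤ n 1≤n = ℕₚ.m≤m*n k (n ℕ.* n) {{ℕ.>-nonZero (ℕₚ.*-mono-≤ 1≤n 1≤n)}}

  module _ {ℓ} (s : ℝ) (E : Pred ℝ ℓ) where

    premeasure-nonNeg : ∀ δ → [ 0# ] ≤± hausdorffPremeasure s δ E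
    premeasure-nonNeg δ = proj₂ (inf±-spec _) [ 0# ] λ { _ (U , _ , ≡.refl) → series-lower (λ i → diam (U i) ^ʳ s) 0 }

    premeasure≤measure : ∀ {δ} → 0# < δ → hausdorffPremeasure s δ E ≤± hausdorffMeasure s E
    premeasure≤measure 0<δ = proj₁ (sup±-spec _) _ (_ , 0<δ , ≡.refl)

    premeasure-zero : 1# < s → ∀ {δ} → 0# < δ → hausdorffPremeasure s δ E ≈± [ 0# ]
    premeasure-zero 1<s {δ} 0<δ = zero± (premeasure-nonNeg δ) λ ε 0<ε → cheap 0<ε (pow2-unbounded 0<δ)
      (geometric-null (*-pos (fromℕ-pos {2} (ℕ.s≤s ℕ.z≤n)) (ratio-pos s)) (2*ratio<1 1<s) ((1# - fromℕ 2 * ratio s) ⁻¹) 0<ε)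
      where
      cheap : ∀ {ε} → 0# < ε → (∃ λ n → 1# < pow2 n * δ) →
              (∃ λ M → ∀ n → M ℕ.≤ n → (fromℕ 2 * ratio s) ^ n * (1# - fromℕ 2 * ratio s) ⁻¹ ≤ ε) →
              hausdorffPremeasure s δ E ≤± [ ε ]
      cheap {ε} 0<ε (n , 1<2ⁿδ) (n′ , bound) = ≤±-trans
          (proj₁ (inf±-spec _) _ (LC.U , record { covers = λ x _ → LC.covers x ; small = LC.small fine } , ≡.refl))
          (series-upper (Cost.cost) λ k → ≤-trans (Cost.total≤ k) (bound (M ℕ.+ 0) (ℕₚ.≤-trans (ℕₚ.m≤n+m n′ n) (ℕₚ.m≤m+n M 0))))
        where
        -- One summand makes the intervals no longer than δ, the other brings the cost below ε.
        M = n ℕ.+ n′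
        module LC = LineCover M
        fine : 1# ≤ pow2 M * δ
        fine = ≤-trans (<⇒≤ 1<2ⁿδ) (*-monoʳ-≤ (<⇒≤ 0<δ) (pow2-mono (ℕₚ.m≤m+n n n′)))
        module Cost = LC.Cost fine s 1<s

    measure-zero : 1# < s → hausdorffMeasure s E ≈± [ 0# ]
    measure-zero 1<s = ≤±-antisym
      (proj₂ (sup±-spec _) [ 0# ] λ { _ (δ , 0<δ , ≡.refl) → ≤±-reflexive (premeasure-zero 1<s 0<δ) })
      (≤±-trans (premeasure-nonNeg 1#) (premeasure≤measure 0<1))

  -- Badly approximable numbers

  module Badly (α : ℝ) (T : ℕ) (bad : ∀ q → 1 ℕ.≤ q → 1# ≤ pow2 T * (fromℕ q * ‖ fromℕ q * α ‖)) where

    dist : ℕ → ℝ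
    dist q = ‖ fromℕ q * α ‖

    dist-pos : ∀ q → 1 ℕ.≤ q → 0# < dist q
    dist-pos q 1≤q = ≰⇒> λ p → <⇒≱ 0<1 (≤-trans (bad q 1≤q) (≤-respʳ-≈ (zeroʳ (pow2 T))
      (*-monoˡ-≤ (<⇒≤ (pow2-pos T)) (≤-respʳ-≈ (zeroʳ (fromℕ q)) (*-monoˡ-≤ (fromℕ-nonNeg q) p)))))

    abstract
      t : ℕ → ℕ → ℕ
      t j r = proj₁ (scale (dist-pos (2 ℕ.^ j ℕ.+ r) (1≤2^+r j r)) (‖‖≤1 _))

      t-scale : ∀ j r → Scale (dist (2 ℕ.^ j ℕ.+ r)) (t j r)
      t-scale j r = proj₂ (scale (dist-pos (2 ℕ.^ j ℕ.+ r) (1≤2^+r j r)) (‖‖≤1 _))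

    -- Bad approximability gives ‖qα‖ ≥ 2^-T/q, and q is less than 2^(j+1).
    t≤ : ∀ j r → r ℕ.< 2 ℕ.^ j → t j r ℕ.≤ T ℕ.+ j
    t≤ j r r< = ℕₚ.≤-pred (ℕₚ.≤-trans (pow2-cancel-< (*-cancelʳ-< (dist-pos q (1≤2^+r j r)) (≤-<-trans
        (≤-trans (proj₁ (t-scale j r)) (bad q (1≤2^+r j r)))
        (<-respʳ-≈ (≈-trans (≈-sym (*-assoc _ _ _)) (*-congʳ (≈-sym (pow2-+ T (suc j)))))
          (*-monoˡ-< (pow2-pos T) (*-monoʳ-< (dist-pos q (1≤2^+r j r)) (fromℕ-mono-< (2^+r< j r r<))))))))
        (ℕₚ.≤-reflexive (ℕₚ.+-suc T j)))
      where
      q = 2 ℕ.^ j ℕ.+ r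
      *-cancelʳ-< : ∀ {x y z} → 0# < z → x * z < y * z → x < y
      *-cancelʳ-< {x} {y} {z} p h = *-cancelˡ-< p (<-respˡ-≈ (*-comm x z) (<-respʳ-≈ (*-comm y z) h))

    -- Distinct q, q′ < 2^(j+1) have q α and q′ α at distance at least 2^-(T+j) modulo 1.
    module Count (j s m : ℕ) (s+m : s ℕ.+ m ≡ T ℕ.+ suc j) where

      -- The signed distance from qα to p in units of 2^-(T+j), shifted to be positive. As m = T + j
      -- + 1 - s, distances below 2 * 2^-s fill the range from 0 to 2^(m+1).
      offset : ℕ → ℤ → ℝ
      offset r p = pow2 (T ℕ.+ j) * (fromℕ (2 ℕ.^ j ℕ.+ r) * α - fromℤ p) + pow2 m

      InBucket : ℕ → ℕ → Set
      InBucket b r = r ℕ.< 2 ℕ.^ j × ∃ λ p → fromℕ b ≤ offset r p × offset r p < fromℕ (suc b)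

      bucket : ∀ r → r ℕ.< 2 ℕ.^ j → t j r ≡ s → ∃ λ b → b ℕ.< 2 ℕ.^ suc m × InBucket b r
      -- Doubling 2^-s provides the strict inequality from which `‖‖-approx` produces an integer p.
      bucket r r< t≡s = fromNearest (‖‖-approx (fromℕ q * α) {fromℕ 2 * pow2 s ⁻¹} close)
        where
        q = 2 ℕ.^ j ℕ.+ r
        2ˢ≉0 = pos⇒≉0 (pow2-pos s)
        lem₁ : ∀ p t i → p * (t * i) ≈ t * (p * i)
        lem₁ = solve 3 (λ p t i → p :* (t :* i) := t :* (p :* i)) ≈-refl
        2ˢc : pow2 s * (fromℕ 2 * pow2 s ⁻¹) ≈ fromℕ 2
        2ˢc = ≈-trans (lem₁ _ _ _) (≈-trans (*-congˡ (⁻¹-inverse 2ˢ≉0)) (*-identityʳ _))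
        1<2 : 1# < fromℕ 2
        1<2 = <-respˡ-≈ (+-identityʳ 1#) (fromℕ-mono-< {1} {2} ℕₚ.≤-refl)
        close : dist q < fromℕ 2 * pow2 s ⁻¹
        close = *-cancelˡ-< (pow2-pos s) (<-respʳ-≈ (≈-sym 2ˢc) (≤-<-trans (≡.subst (λ t → pow2 t * dist q ≤ 1#) t≡s (proj₁ (t-scale j r))) 1<2))
        fromNearest : (∃ λ p → ∣ fromℕ q * α - fromℤ p ∣ < fromℕ 2 * pow2 s ⁻¹) →
                      ∃ λ b → b ℕ.< 2 ℕ.^ suc m × InBucket b r
        fromNearest (p , near) = fromFloor (floorℕ X (<⇒≤ 0<X))
          where
          y = fromℕ q * α - fromℤ p
          X = offset r p
          2^sm : fromℕ 2 * pow2 (T ℕ.+ j) ≈ pow2 m * pow2 s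
          2^sm = ≈-trans (≈-sym (pow2-suc (T ℕ.+ j))) (≈-trans (≈-reflexive (≡.cong pow2
            (≡.trans (≡.sym (ℕₚ.+-suc T j)) (≡.trans (≡.sym s+m) (ℕₚ.+-comm s m))))) (pow2-+ m s))
          lem₂ : ∀ t p a → t * (p * a) ≈ t * p * a
          lem₂ t p a = ≈-sym (*-assoc t p a)
          small : pow2 (T ℕ.+ j) * ∣ y ∣ < pow2 m
          small = *-cancelˡ-< (<-trans 0<1 1<2) (<-respˡ-≈ (≈-sym (≈-trans (lem₂ _ _ _) (≈-trans (*-congʳ 2^sm) (*-assoc _ _ _))))
            (<-respʳ-≈ (*-comm _ _) (*-monoˡ-< (pow2-pos m) (<-respʳ-≈ 2ˢc (*-monoˡ-< (pow2-pos s) near)))))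
          lem₃ : ∀ P y m → P * y + m - 0# ≈ m - P * - y
          lem₃ = solve 3 (λ P y m → P :* y :+ m :- con (+ 0) := m :- P :* (:- y)) ≈-refl
          lem₄ : ∀ P y m → fromℕ 2 * m - (P * y + m) ≈ m - P * y
          lem₄ = solve 3 (λ P y m → con (+ 2) :* m :- (P :* y :+ m) := m :- P :* y) ≈-refl
          0<X : 0# < X
          0<X = <-by (0<y-x (≤-<-trans (*-monoˡ-≤ (<⇒≤ (pow2-pos (T ℕ.+ j))) (-x≤∣x∣ y)) small)) (lem₃ (pow2 (T ℕ.+ j)) y (pow2 m))
          X< : X < pow2 (suc m)
          X< = <-respʳ-≈ (≈-sym (pow2-suc m)) (<-by (0<y-x (≤-<-trans (*-monoˡ-≤ (<⇒≤ (pow2-pos (T ℕ.+ j))) (x≤∣x∣ y)) small))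
            (lem₄ (pow2 (T ℕ.+ j)) y (pow2 m)))
          fromFloor : (∃ λ n → fromℕ n ≤ X × X < fromℕ (suc n)) → ∃ λ b → b ℕ.< 2 ℕ.^ suc m × InBucket b r
          fromFloor (b , lo , hi) = b , fromℕ-cancel-< (≤-<-trans lo X<) , r< , p , lo , hi

      -- The difference k + 1 of r and r′ is at most 2^j, while a common bucket forces ‖(k+1)α‖ <
      -- 2^-(T+j); this contradicts `bad`.
      separated : ∀ b r r′ → InBucket b r → InBucket b r′ → ¬ r′ ℕ.< r
      separated b r r′ (r< , p , lo , hi) (_ , p′ , lo′ , hi′) r′<r = gap (ℕₚ.m≤n⇒∃[o]m+o≡n r′<r)
        where
        P = pow2 (T ℕ.+ j)
        y y′ : ℝ
        y  = fromℕ (2 ℕ.^ j ℕ.+ r) * α - fromℤ p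
        y′ = fromℕ (2 ℕ.^ j ℕ.+ r′) * α - fromℤ p′
        lem₁ : ∀ P y y′ m b → 1# - P * (y - y′) ≈ (1# + b - (P * y + m)) + (P * y′ + m - b)
        lem₁ = solve 5 (λ P y y′ m b → con (+ 1) :- P :* (y :- y′) := (con (+ 1) :+ b :- (P :* y :+ m)) :+ (P :* y′ :+ m :- b)) ≈-refl
        lem₂ : ∀ P y y′ m b → 1# - - (P * (y - y′)) ≈ (1# + b - (P * y′ + m)) + (P * y + m - b)
        lem₂ = solve 5 (λ P y y′ m b → con (+ 1) :- :- (P :* (y :- y′)) := (con (+ 1) :+ b :- (P :* y′ :+ m)) :+ (P :* y :+ m :- b)) ≈-refl
        together : P * ∣ y - y′ ∣ < 1#
        together = ≤-<-trans (∣∣-scale (y - y′) (<⇒≤ (pow2-pos (T ℕ.+ j)))) (∣∣-lub-<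
          (<-by (+-pos-nonNeg (0<y-x hi) (0≤y-x lo′)) (lem₁ P y y′ (pow2 m) (fromℕ b)))
          (<-by (+-pos-nonNeg (0<y-x hi′) (0≤y-x lo)) (lem₂ P y y′ (pow2 m) (fromℕ b))))
        gap : (∃ λ k → suc r′ ℕ.+ k ≡ r) → _
        gap (k , eq) = <⇒≱ together (≤-trans (bad (suc k) (ℕ.s≤s ℕ.z≤n)) (≤-respʳ-≈ (≈-trans (≈-sym (*-assoc _ _ _)) (*-congʳ (≈-sym (pow2-+ T j))))
            (*-monoˡ-≤ (<⇒≤ (pow2-pos T)) (*-mono-≤ (fromℕ-nonNeg (suc k)) (fromℕ-mono k<) (‖‖-nonNeg _) norm≤))))
          where
          q′ = 2 ℕ.^ j ℕ.+ r′
          k< : suc k ℕ.≤ 2 ℕ.^ j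
          k< = ℕₚ.≤-trans (ℕ.s≤s (ℕₚ.m≤n+m k r′)) (ℕₚ.≤-trans (ℕₚ.≤-reflexive eq) (ℕₚ.<⇒≤ r<))
          q≡ : 2 ℕ.^ j ℕ.+ r ≡ q′ ℕ.+ suc k
          q≡ = ≡.trans (≡.cong (2 ℕ.^ j ℕ.+_) (≡.trans (≡.sym eq) (≡.sym (ℕₚ.+-suc r′ k)))) (≡.sym (ℕₚ.+-assoc (2 ℕ.^ j) r′ (suc k)))
          lem : ∀ k q a p p′ → k * a - (p + - p′) ≈ (q + k) * a - p - (q * a - p′)
          lem = solve 5 (λ k q a p p′ → k :* a :- (p :+ :- p′) := (q :+ k) :* a :- p :- (q :* a :- p′)) ≈-refl
          same : fromℕ (suc k) * α - fromℤ (p ℤ.- p′) ≈ y - y′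
          same = ≈-trans (+-congˡ (-‿cong (≈-trans (fromℤ-+ p (ℤ.- p′)) (+-congˡ (fromℤ-neg p′)))))
            (≈-trans (lem (fromℕ (suc k)) (fromℕ q′) α (fromℤ p) (fromℤ p′))
              (+-congʳ (+-congʳ (*-congʳ (≈-sym (≈-trans (≈-reflexive (≡.cong fromℕ q≡)) (fromℕ-+ q′ (suc k))))))))
          norm≤ : ‖ fromℕ (suc k) * α ‖ ≤ ∣ y - y′ ∣
          norm≤ = ≤-trans (‖‖-≤ _ (p ℤ.- p′)) (≤-reflexive (∣∣-cong same))

      bucket-count : count (2 ℕ.^ j) (λ r → t j r ≡ s) ℕ.≤ 2 ℕ.^ suc m
      -- The predicate `b ≡ b` always holds, so all 2^(m+1) buckets are counted, with at most one r
      -- in each.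
      bucket-count = ℕₚ.≤-trans (double-count (2 ℕ.^ j) (2 ℕ.^ suc m) 1 {λ r → t j r ≡ s} {λ b → b ≡ b} InBucket
          (λ r r< eq → proj₁ (bucket r r< eq) , proj₁ (proj₂ (bucket r r< eq)) , ≡.refl , proj₂ (proj₂ (bucket r r< eq)))
          (λ b _ _ → cluster (2 ℕ.^ j) 1 λ r r′ x x′ → ℕₚ.≰⇒> λ r′<r → separated b r r′ x x′ r′<r))
        (ℕₚ.≤-trans (ℕₚ.≤-reflexive (ℕₚ.*-identityˡ _)) (count≤n (2 ℕ.^ suc m) (λ b → b ≡ b)))

    t-count : ∀ j s → count (2 ℕ.^ j) (λ r → t j r ≡ s) ℕ.* 2 ℕ.^ s ℕ.≤ 2 ℕ.^ (T ℕ.+ 2 ℕ.+ j)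
    t-count j s with em 0ℓ {∃ λ r → r ℕ.< 2 ℕ.^ j × t j r ≡ s}
    ... | no none = ℕₚ.≤-trans (ℕₚ.≤-reflexive (≡.cong (ℕ._* 2 ℕ.^ s) (count-none (2 ℕ.^ j) λ r r< eq → none (r , r< , eq)))) ℕ.z≤n
    -- A value s that occurs is at most T + j, so that m = T + j + 1 - s exists.
    ... | yes (r , r< , eq) = bound (ℕₚ.m≤n⇒∃[o]m+o≡n (ℕₚ.≤-trans (ℕₚ.≤-trans (ℕₚ.≤-reflexive (≡.sym eq)) (t≤ j r r<)) (ℕₚ.+-monoʳ-≤ T (ℕₚ.n≤1+n j))))
      where
      bound : (∃ λ m → s ℕ.+ m ≡ T ℕ.+ suc j) → count (2 ℕ.^ j) (λ r → t j r ≡ s) ℕ.* 2 ℕ.^ s ℕ.≤ 2 ℕ.^ (T ℕ.+ 2 ℕ.+ j)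
      bound (m , s+m) = ℕₚ.≤-trans (ℕₚ.*-monoˡ-≤ (2 ℕ.^ s) (Count.bucket-count j s m s+m)) (ℕₚ.≤-reflexive
        (≡.trans (≡.sym (ℕₚ.^-distribˡ-+-* 2 (suc m) s)) (≡.cong (2 ℕ.^_) (≡.trans (≡.cong suc (≡.trans (ℕₚ.+-comm m s) s+m)) (lem T j)))))
        where
        lem : ∀ T j → suc (T ℕ.+ suc j) ≡ T ℕ.+ 2 ℕ.+ j
        lem = solve-∀

  -- The real number given by an infinite branch

  module BranchPoint (f : ℕ → ℕ) (f0 : f 0 ≡ 0) (child : ∀ l → f (suc l) ≡ f l ℕ.* 2 ⊎ f (suc l) ≡ suc (f l ℕ.* 2)) where

    lower : ∀ l d → f l ℕ.* 2 ℕ.^ d ℕ.≤ f (d ℕ.+ l)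
    lower l zero    = ℕₚ.≤-reflexive (ℕₚ.*-identityʳ (f l))
    lower l (suc d) = ℕₚ.≤-trans (ℕₚ.≤-reflexive (lem (f l) (2 ℕ.^ d))) (ℕₚ.≤-trans (ℕₚ.*-monoˡ-≤ 2 (lower l d)) (below {f (d ℕ.+ l)} (child (d ℕ.+ l))))
      where
      lem : ∀ a x → a ℕ.* (2 ℕ.* x) ≡ a ℕ.* x ℕ.* 2
      lem = solve-∀
      below : ∀ {a b} → b ≡ a ℕ.* 2 ⊎ b ≡ suc (a ℕ.* 2) → a ℕ.* 2 ℕ.≤ b
      below (inj₁ eq) = ℕₚ.≤-reflexive (≡.sym eq)
      below (inj₂ eq) = ℕₚ.≤-trans (ℕₚ.n≤1+n _) (ℕₚ.≤-reflexive (≡.sym eq))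

    upper : ∀ l d → suc (f (d ℕ.+ l)) ℕ.≤ suc (f l) ℕ.* 2 ℕ.^ d
    upper l zero    = ℕₚ.≤-reflexive (≡.sym (ℕₚ.*-identityʳ (suc (f l))))
    upper l (suc d) = ℕₚ.≤-trans (above {f (d ℕ.+ l)} (child (d ℕ.+ l))) (ℕₚ.≤-trans (ℕₚ.*-monoˡ-≤ 2 (upper l d)) (ℕₚ.≤-reflexive (lem (suc (f l)) (2 ℕ.^ d))))
      where
      lem : ∀ a x → a ℕ.* x ℕ.* 2 ≡ a ℕ.* (2 ℕ.* x)
      lem = solve-∀
      above : ∀ {a b} → b ≡ a ℕ.* 2 ⊎ b ≡ suc (a ℕ.* 2) → suc b ℕ.≤ suc a ℕ.* 2
      above (inj₁ eq) = ℕ.s≤s (ℕₚ.≤-trans (ℕₚ.≤-reflexive eq) (ℕₚ.n≤1+n _))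
      above (inj₂ eq) = ℕ.s≤s (ℕₚ.≤-reflexive eq)

    Below : Pred ℝ 0ℓ
    Below y = ∃ λ l → pow2 l * y ≤ fromℕ (f l)

    pow2-split : ∀ l d y → pow2 (d ℕ.+ l) * y ≈ pow2 d * (pow2 l * y)
    pow2-split l d y = ≈-trans (*-congʳ (pow2-+ d l)) (*-assoc _ _ y)

    nested : ∀ y → y ∈ Below → ∀ k → pow2 k * y ≤ fromℕ (suc (f k))
    nested y (l , y≤) k = [ later , earlier ]′ (ℕₚ.≤-total k l)
      where
      later : k ℕ.≤ l → pow2 k * y ≤ fromℕ (suc (f k))
      later k≤l = go (ℕₚ.m≤n⇒∃[o]m+o≡n k≤l)
        where
        go : (∃ λ d → k ℕ.+ d ≡ l) → pow2 k * y ≤ fromℕ (suc (f k))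
        go (d , ≡.refl) = *-cancelˡ-≤ (pow2-pos d) (≤-respˡ-≈ (pow2-split k d y) (≤-trans
          (≡.subst (λ n → pow2 n * y ≤ fromℕ (f n)) (ℕₚ.+-comm k d) y≤)
          (≤-trans (fromℕ-mono (ℕₚ.≤-trans (ℕₚ.n≤1+n _) (upper k d))) (≤-reflexive (≈-trans (fromℕ-* (suc (f k)) (2 ℕ.^ d)) (*-comm _ _))))))
      earlier : l ℕ.≤ k → pow2 k * y ≤ fromℕ (suc (f k))
      earlier l≤k = go (ℕₚ.m≤n⇒∃[o]m+o≡n l≤k)
        where
        go : (∃ λ d → l ℕ.+ d ≡ k) → pow2 k * y ≤ fromℕ (suc (f k))
        go (d , ≡.refl) = ≡.subst (λ n → pow2 n * y ≤ fromℕ (suc (f n))) (ℕₚ.+-comm d l) (≤-respˡ-≈ (≈-sym (pow2-split l d y))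
          (≤-trans (*-monoˡ-≤ (<⇒≤ (pow2-pos d)) y≤) (≤-trans (≤-reflexive (≈-trans (*-comm _ _) (≈-sym (fromℕ-* (f l) (2 ℕ.^ d)))))
            (fromℕ-mono (ℕₚ.≤-trans (lower l d) (ℕₚ.n≤1+n _))))))

    pow2-cancel : ∀ l y → pow2 l * (pow2 l ⁻¹ * y) ≈ y
    pow2-cancel l y = ≈-trans (≈-sym (*-assoc _ _ y)) (≈-trans (*-congʳ (⁻¹-inverse (pos⇒≉0 (pow2-pos l)))) (*-identityˡ y))

    bound : ∀ k y → y ∈ Below → y ≤ pow2 k ⁻¹ * fromℕ (suc (f k))
    bound k y p = *-cancelˡ-≤ (pow2-pos k) (≤-respʳ-≈ (≈-sym (pow2-cancel k _)) (nested y p k))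

    -- Nested closed intervals: x is the supremum of the left endpoints, and by `bound` every right
    -- endpoint is an upper bound of `Below`.
    point : ∃ λ x → ∀ l → fromℕ (f l) ≤ pow2 l * x × pow2 l * x ≤ fromℕ (suc (f l))
    point = limit (lub Below (0# , 0 , ≤-respˡ-≈ (≈-sym (zeroʳ _)) (fromℕ-nonNeg (f 0))) (_ , bound 0))
      where
      limit : ∃ (IsLUB _≤_ Below) → ∃ λ x → ∀ l → fromℕ (f l) ≤ pow2 l * x × pow2 l * x ≤ fromℕ (suc (f l))
      limit (x , ub , least) = x , λ l →
        ≤-respˡ-≈ (pow2-cancel l _) (*-monoˡ-≤ (<⇒≤ (pow2-pos l)) (ub _ (l , ≤-reflexive (pow2-cancel l (fromℕ (f l)))))) ,
        ≤-respʳ-≈ (pow2-cancel l _) (*-monoˡ-≤ (<⇒≤ (pow2-pos l)) (least _ (bound l)))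

  ‖‖-scaled : ∀ x {a c} → 0# < a → (∀ n → c ≤ a * ∣ x - fromℤ n ∣) → c ≤ a * ‖ x ‖
  ‖‖-scaled x {a} {c} 0<a h = ≤-respˡ-≈ (cancel c) (*-monoˡ-≤ (<⇒≤ 0<a) (‖‖-glb x λ n → *-cancelˡ-≤ 0<a (≤-respˡ-≈ (≈-sym (cancel c)) (h n))))
    where
    cancel : ∀ c → a * (a ⁻¹ * c) ≈ c
    cancel c = ≈-trans (≈-sym (*-assoc _ _ c)) (≈-trans (*-congʳ (⁻¹-inverse (pos⇒≉0 0<a))) (*-identityˡ c))

  -- An interval that is not hit lies at distance at least 2^-l from p/q, on one side or the other.
  -- `Hit` speaks of natural numerators only; a negative integer is farther from qx ≥ 0 than the
  -- integer 0 is.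
  avoid-hit : ∀ q l a x → 0# ≤ x → fromℕ a ≤ pow2 l * x → pow2 l * x ≤ fromℕ (suc a) → ¬ Hit q l a →
              fromℕ q ≤ pow2 l * ‖ fromℕ q * x ‖
  avoid-hit q l a x 0≤x x≥ x≤ ¬hit = ‖‖-scaled (fromℕ q * x) (pow2-pos l) away
    where
    P = pow2 l
    Q = fromℕ q
    toLeft : ∀ p → fromℕ (2 ℕ.^ l ℕ.* p ℕ.+ q) ≤ fromℕ (a ℕ.* q) → Q ≤ P * (Q * x - fromℕ p)
    toLeft p h = ≤-by (+-nonNeg (*-nonNeg (fromℕ-nonNeg q) (0≤y-x x≥)) (0≤y-x h′)) (lem P Q x (fromℕ p) (fromℕ a))
      where
      h′ : P * fromℕ p + Q ≤ fromℕ a * Q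
      h′ = ≤-respˡ-≈ (≈-trans (fromℕ-+ (2 ℕ.^ l ℕ.* p) q) (+-congʳ (fromℕ-* (2 ℕ.^ l) p))) (≤-respʳ-≈ (fromℕ-* a q) h)
      lem : ∀ P Q x p a → P * (Q * x - p) - Q ≈ Q * (P * x - a) + (a * Q - (P * p + Q))
      lem = solve 5 (λ P Q x p a → P :* (Q :* x :- p) :- Q := Q :* (P :* x :- a) :+ (a :* Q :- (P :* p :+ Q))) ≈-refl
    toRight : ∀ p → fromℕ ((a ℕ.+ 2) ℕ.* q) ≤ fromℕ (2 ℕ.^ l ℕ.* p) → Q ≤ P * - (Q * x - fromℕ p)
    toRight p h = ≤-by (+-nonNeg (*-nonNeg (fromℕ-nonNeg q) (0≤y-x x≤)) (0≤y-x h′)) (lem P Q x (fromℕ p) (fromℕ a))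
      where
      h′ : (fromℕ a + fromℕ 2) * Q ≤ P * fromℕ p
      h′ = ≤-respˡ-≈ (≈-trans (fromℕ-* (a ℕ.+ 2) q) (*-congʳ (fromℕ-+ a 2))) (≤-respʳ-≈ (fromℕ-* (2 ℕ.^ l) p) h)
      lem : ∀ P Q x p a → P * - (Q * x - p) - Q ≈ Q * (1# + a - P * x) + (P * p - (a + fromℕ 2) * Q)
      lem = solve 5 (λ P Q x p a → P :* (:- (Q :* x :- p)) :- Q := Q :* (con (+ 1) :+ a :- P :* x) :+ (P :* p :- (a :+ con (+ 2)) :* Q)) ≈-refl
    0≤P = <⇒≤ (pow2-pos l)
    natural : ∀ p → Q ≤ P * ∣ Q * x - fromℕ p ∣
    natural p = [ (λ yes₁ → ≤-trans (toRight p (fromℕ-mono (ℕₚ.≰⇒≥ λ yes₂ → ¬hit (p , yes₁ , yes₂)))) (*-monoˡ-≤ 0≤P (-x≤∣x∣ _)))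
                , (λ no₁ → ≤-trans (toLeft p (fromℕ-mono no₁)) (*-monoˡ-≤ 0≤P (x≤∣x∣ _))) ]′ (ℕₚ.≤-total (a ℕ.* q) (2 ℕ.^ l ℕ.* p ℕ.+ q))
    away : ∀ n → Q ≤ P * ∣ Q * x - fromℤ n ∣
    away (+ p)    = natural p
    away -[1+ p ] = ≤-trans (natural 0) (*-monoˡ-≤ 0≤P (≤-trans (∣∣-lub
        (≤-by (fromℕ-nonNeg (suc p)) (lem₁ (Q * x) (fromℕ (suc p))))
        (≤-by (+-nonNeg (+-nonNeg 0≤Qx 0≤Qx) (fromℕ-nonNeg (suc p))) (lem₂ (Q * x) (fromℕ (suc p))))) (x≤∣x∣ _)))
      where
      0≤Qx = *-nonNeg (fromℕ-nonNeg q) 0≤x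
      lem₁ : ∀ y p → y - - p - (y - 0#) ≈ p
      lem₁ = solve 2 (λ y p → y :- :- p :- (y :- con (+ 0)) := p) ≈-refl
      lem₂ : ∀ y p → y - - p - - (y - 0#) ≈ y + y + p
      lem₂ = solve 2 (λ y p → y :- :- p :- :- (y :- con (+ 0)) := y :+ y :+ p) ≈-refl

  -- If the count `suc B` is reached at n, no element from n on remains; otherwise B is a bound
  -- already. It makes a level of an infinite cover finite, as `double-count` requires.
  few⇒bounded : ∀ B (P : ℕ → Set) → (∀ n → count n P ℕ.≤ B) → ∃ λ N → ∀ i → P i → i ℕ.< N
  few⇒bounded zero    P few = 0 , λ i p → contradiction
    (ℕₚ.≤-trans (ℕₚ.≤-trans (ℕₚ.≤-reflexive (≡.sym (bit-yes p))) (ℕₚ.m≤n+m (bit (P i)) (count i P))) (few (suc i))) λ ()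
  few⇒bounded (suc B) P few with em 0ℓ {∃ λ n → count n P ≡ suc B}
  ... | no none = few⇒bounded B P λ n → ℕₚ.≤-pred (ℕₚ.≤∧≢⇒< (few n) λ eq → none (n , eq))
  ... | yes (n , eq) = n , λ i p → ℕₚ.≰⇒> λ n≤i → ℕₚ.<-irrefl ≡.refl (ℕₚ.≤-trans (ℕₚ.≤-reflexive (ℕₚ.+-comm 1 (suc B)))
      (ℕₚ.≤-trans (ℕₚ.+-mono-≤ (ℕₚ.≤-trans (ℕₚ.≤-reflexive (≡.sym eq)) (count-grow n≤i)) (ℕₚ.≤-reflexive (≡.sym (bit-yes p)))) (few (suc i))))
    where
    count-grow : ∀ {m n} → m ℕ.≤ n → count m P ℕ.≤ count n P
    count-grow m≤n with ℕₚ.m≤n⇒∃[o]m+o≡n m≤n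
    count-grow {m} _ | d , ≡.refl = go d
      where
      go : ∀ d → count m P ℕ.≤ count (m ℕ.+ d) P
      go zero    = ℕₚ.≤-reflexive (≡.cong (λ k → count k P) (≡.sym (ℕₚ.+-identityʳ m)))
      go (suc d) = ℕₚ.≤-trans (go d) (ℕₚ.≤-trans (ℕₚ.m≤m+n _ _) (ℕₚ.≤-reflexive (≡.cong (λ k → count k P) (≡.sym (ℕₚ.+-suc m d)))))

  -- Markov's inequality for partial sums.
  count≤sum : ∀ {f : ℕ → ℝ} {c} (P : ℕ → Set) → (∀ i → 0# ≤ f i) → (∀ i → P i → c ≤ f i) → ∀ n → fromℕ (count n P) * c ≤ partialSum f n
  count≤sum {f} {c} P 0≤f c≤f zero    = ≤-reflexive (zeroˡ c)
  count≤sum {f} {c} P 0≤f c≤f (suc n) = ≤-respˡ-≈ (≈-sym (≈-trans (*-congʳ (fromℕ-+ (count n P) (bit (P n)))) (distribʳ c _ _)))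
    (≤-respʳ-≈ (≈-sym (ps-last f n)) (+-mono-≤ (count≤sum P 0≤f c≤f n) one))
    where
    lem : ∀ c → (1# + 0#) * c ≈ c
    lem = solve 1 (λ c → (con (+ 1) :+ con (+ 0)) :* c := c) ≈-refl
    one : fromℕ (bit (P n)) * c ≤ f n
    one with em 0ℓ {P n}
    ... | yes p = ≤-respˡ-≈ (≈-sym (lem c)) (c≤f n p)
    ... | no _  = ≤-respˡ-≈ (≈-sym (zeroˡ c)) (0≤f n)

  -- Hausdorff measure of exponent less than 1

  module LowerBound (α : ℝ) (T : ℕ) (bad : ∀ q → 1 ℕ.≤ q → 1# ≤ pow2 T * (fromℕ q * ‖ fromℕ q * α ‖)) where

    open Badly α T bad
    open LogSquare

    K : ℕ
    K = T ℕ.+ 18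

    F : ℝ → ℕ → ℝ
    F β q = fromℕ q * log (fromℕ q) ^ 2 * ‖ fromℕ q * α ‖ * ‖ fromℕ q * β ‖

    -- Multiplying q ≤ 2^l ‖qβ‖ by 1 < 2^(t+1) ‖qα‖ gives q ≤ 2^(2j + logSquare j + K + 1) ‖qα‖
    -- ‖qβ‖. After multiplication by q (log q)^2, the left side has q^2 ≥ 2^(2j) and (log q)^2 ≥ (j
    -- log 2)^2 ≥ 2^(logSquare j) (log 2)^2, so all that depends on j cancels.
    product-bound : ∀ j r l β → 1 ℕ.≤ j → l ℕ.+ t j r ≡ j ℕ.+ j ℕ.+ logSquare j ℕ.+ K →
                    fromℕ (2 ℕ.^ j ℕ.+ r) ≤ pow2 l * ‖ fromℕ (2 ℕ.^ j ℕ.+ r) * β ‖ →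
                    log2 * log2 ≤ pow2 (suc K) * F β (2 ℕ.^ j ℕ.+ r)
    product-bound j r l β 1≤j on-level Q≤ = *-cancelˡ-≤ (*-pos (pow2-pos (j ℕ.+ j)) (pow2-pos (logSquare j)))
      (≤-trans (≤-reflexive (*-assoc _ _ _)) (≤-trans
        (*-mono-≤ (<⇒≤ (pow2-pos (j ℕ.+ j))) squares (*-nonNeg (<⇒≤ (pow2-pos (logSquare j))) 0≤L²) logs)
        (≤-trans (*-monoʳ-≤ 0≤Lg² (*-monoˡ-≤ 0≤Q Q≤Ayz)) (≤-reflexive regroup))))
      where
      q = 2 ℕ.^ j ℕ.+ r
      Q = fromℕ q
      Lg = log Q
      y = ‖ Q * α ‖
      z = ‖ Q * β ‖
      A = pow2 l * pow2 (suc (t j r))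
      0≤Q = fromℕ-nonNeg q
      0≤L² = *-nonNeg (<⇒≤ log2-pos) (<⇒≤ log2-pos)
      2^j≤Q : pow2 j ≤ Q
      2^j≤Q = fromℕ-mono (ℕₚ.m≤m+n (2 ℕ.^ j) r)
      jL≤Lg : fromℕ j * log2 ≤ Lg
      jL≤Lg = ≤-respˡ-≈ (log-pow2 j) (log-mono (pow2-pos j) 2^j≤Q)
      0≤jL = *-nonNeg (fromℕ-nonNeg j) (<⇒≤ log2-pos)
      0≤Lg² = *-nonNeg (≤-trans 0≤jL jL≤Lg) (≤-trans 0≤jL jL≤Lg)
      squares : pow2 (j ℕ.+ j) ≤ Q * Q
      squares = ≤-respˡ-≈ (≈-sym (pow2-+ j j)) (*-mono-≤ (<⇒≤ (pow2-pos j)) 2^j≤Q (<⇒≤ (pow2-pos j)) 2^j≤Q)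
      lem₁ : ∀ j l → j * j * (l * l) ≈ j * l * (j * l)
      lem₁ = solve 2 (λ j l → j :* j :* (l :* l) := j :* l :* (j :* l)) ≈-refl
      logs : pow2 (logSquare j) * (log2 * log2) ≤ Lg * Lg
      logs = ≤-trans (*-monoʳ-≤ 0≤L² (≤-respʳ-≈ (fromℕ-* j j) (fromℕ-mono (2^logSquare≤ j 1≤j))))
        (≤-respˡ-≈ (≈-sym (lem₁ (fromℕ j) log2)) (*-mono-≤ 0≤jL jL≤Lg 0≤jL jL≤Lg))
      lem₂ : ∀ a z b y → a * z * (b * y) ≈ a * b * (y * z)
      lem₂ = solve 4 (λ a z b y → a :* z :* (b :* y) := a :* b :* (y :* z)) ≈-refl
      Q≤Ayz : Q ≤ A * (y * z)
      Q≤Ayz = ≤-respˡ-≈ (*-identityʳ Q) (≤-respʳ-≈ (lem₂ _ _ _ _)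
        (*-mono-≤ 0≤Q Q≤ 0≤1 (<⇒≤ (proj₂ (t-scale j r)))))
      exponents : l ℕ.+ suc (t j r) ≡ j ℕ.+ j ℕ.+ logSquare j ℕ.+ suc K
      exponents = ≡.trans (ℕₚ.+-suc l (t j r)) (≡.trans (≡.cong suc on-level) (≡.sym (ℕₚ.+-suc (j ℕ.+ j ℕ.+ logSquare j) K)))
      A≈ : A ≈ pow2 (j ℕ.+ j) * pow2 (logSquare j) * pow2 (suc K)
      A≈ = ≈-trans (≈-sym (pow2-+ l (suc (t j r)))) (≈-trans (≈-reflexive (≡.cong pow2 exponents))
        (≈-trans (pow2-+ (j ℕ.+ j ℕ.+ logSquare j) (suc K)) (*-congʳ (pow2-+ (j ℕ.+ j) (logSquare j)))))
      lem₃ : ∀ q B k y z g → q * (B * k * (y * z)) * (g * g) ≈ B * (k * (q * (g * (g * 1#)) * y * z))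
      lem₃ = solve 6 (λ q B k y z g → q :* (B :* k :* (y :* z)) :* (g :* g) := B :* (k :* (q :* (g :* (g :* con (+ 1))) :* y :* z))) ≈-refl
      regroup : Q * (A * (y * z)) * (Lg * Lg) ≈ pow2 (j ℕ.+ j) * pow2 (logSquare j) * (pow2 (suc K) * F β q)
      regroup = ≈-trans (*-congʳ (*-congˡ (*-congʳ A≈))) (lem₃ Q (pow2 (j ℕ.+ j) * pow2 (logSquare j)) (pow2 (suc K)) y z Lg)

    1≤K : 1 ℕ.≤ K
    1≤K = ℕₚ.≤-trans (ℕ.s≤s ℕ.z≤n) (ℕₚ.m≤n+m 18 T)

    sifted : (Z : ℕ → ℕ → Set) → (∀ l a → l ℕ.≤ K → ¬ Z l a) → (∀ l → count (2 ℕ.^ l) (Z l) ℕ.* (2 ℕ.* (l ℕ.* l)) ℕ.≤ 2 ℕ.^ l) →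
             ∃ λ x → [ 0# ] <± liminf (F x) × ∀ l → ∃ λ a → ¬ Z l a × fromℕ a ≤ pow2 l * x × pow2 l * x ≤ fromℕ (suc a)
    sifted Z Z-late Z-few = place S.surviving-branch
      where
      -- The starting level `j₀` is K itself, the least value that `K≤j₀` permits.
      module S = Sieve T K t logSquare Z t≤ t-count logSquare≤ 2^logSquare≥ 1≤K ℕₚ.≤-refl Z-late Z-few
      place : Tree.Branch S.Bad → ∃ λ x → [ 0# ] <± liminf (F x) × ∀ l → ∃ λ a → ¬ Z l a × fromℕ a ≤ pow2 l * x × pow2 l * x ≤ fromℕ (suc a)
      place (f , f0 , child , good) = result (BranchPoint.point f f0 child)
        where
        result : (∃ λ x → ∀ l → fromℕ (f l) ≤ pow2 l * x × pow2 l * x ≤ fromℕ (suc (f l))) →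
                 ∃ λ x → [ 0# ] <± liminf (F x) × ∀ l → ∃ λ a → ¬ Z l a × fromℕ a ≤ pow2 l * x × pow2 l * x ≤ fromℕ (suc a)
        result (x , inside) = x , bound⇒pos± 0<c (liminf-lower (2 ℕ.^ K) bound) ,
                              λ l → f l , (λ z → good l (inj₁ z)) , inside l
          where
          c = pow2 (suc K) ⁻¹ * (log2 * log2)
          0<c : 0# < c
          0<c = *-pos (⁻¹-pos (pow2-pos (suc K))) (*-pos log2-pos log2-pos)
          cancel : pow2 (suc K) * c ≈ log2 * log2
          cancel = ≈-trans (≈-sym (*-assoc _ _ _)) (≈-trans (*-congʳ (⁻¹-inverse (pos⇒≉0 (pow2-pos (suc K))))) (*-identityˡ _))
          lem : ∀ x → (1# + 0#) * x ≈ x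
          lem = solve 1 (λ x → (con (+ 1) :+ con (+ 0)) :* x := x) ≈-refl
          0≤x : 0# ≤ x
          0≤x = ≤-trans (fromℕ-nonNeg (f 0)) (≤-respʳ-≈ (lem x) (proj₁ (inside 0)))
          bound : ∀ q → 1 ℕ.≤ q → 2 ℕ.^ K ℕ.≤ q → c ≤ F x q
          bound q 1≤q 2^K≤q = split (dyadic q 1≤q)
            where
            split : (∃ λ j → ∃ λ r → r ℕ.< 2 ℕ.^ j × 2 ℕ.^ j ℕ.+ r ≡ q) → c ≤ F x q
            split (j , r , r< , ≡.refl) = atLevel (ℕₚ.m≤n⇒∃[o]m+o≡n t-small)
              where
              K≤j : K ℕ.≤ j
              K≤j = ℕₚ.≮⇒≥ λ j<K → ℕₚ.<⇒≱ (2^+r< j r r<) (ℕₚ.≤-trans (ℕₚ.^-monoʳ-≤ 2 j<K) 2^K≤q)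
              lem₂ : ∀ T j m → T ℕ.+ j ℕ.+ (j ℕ.+ m ℕ.+ 18) ≡ j ℕ.+ j ℕ.+ m ℕ.+ (T ℕ.+ 18)
              lem₂ = solve-∀
              t-small : t j r ℕ.≤ j ℕ.+ j ℕ.+ logSquare j ℕ.+ K
              t-small = ℕₚ.≤-trans (t≤ j r r<) (ℕₚ.≤-trans (ℕₚ.m≤m+n (T ℕ.+ j) (j ℕ.+ logSquare j ℕ.+ 18)) (ℕₚ.≤-reflexive (lem₂ T j (logSquare j))))
              atLevel : (∃ λ l → t j r ℕ.+ l ≡ j ℕ.+ j ℕ.+ logSquare j ℕ.+ K) → c ≤ F x q
              atLevel (l , eq) = *-cancelˡ-≤ (pow2-pos (suc K)) (≤-respˡ-≈ (≈-sym cancel)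
                (product-bound j r l x (ℕₚ.≤-trans 1≤K K≤j) on (avoid-hit q l (f l) x 0≤x (proj₁ (inside l)) (proj₂ (inside l))
                  λ hit → good l (inj₂ (j , S.onLevel-< l j r r< on , K≤j , r , r< , on , hit)))))
                where
                on : l ℕ.+ t j r ≡ j ℕ.+ j ℕ.+ logSquare j ℕ.+ K
                on = ≡.trans (ℕₚ.+-comm l (t j r)) eq

    module Dimension (s : ℝ) (0<s : 0# < s) (s<1 : s < 1#) where

      v : ℝ
      v = ratio s

      private
        grown : ∃ λ M → 1 ℕ.≤ M × ∀ l → M ℕ.≤ l → fromℕ (12 ℕ.* (l ℕ.* l)) ≤ v * (fromℕ 2 * v) ^ l
        -- The constant is 3 * 2 * 2: a set of the cover meets at most 3 intervals, `Z-few` asks for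
        -- a factor 2, and proper and degenerate sets share the bound equally.
        grown = growth 12 (1<2*ratio s<1) (ratio-pos s)

      abstract
        M : ℕ
        -- The summand `suc K` keeps the cover out of the first K levels, on which the sieve lets
        -- every interval survive.
        M = proj₁ grown ℕ.+ suc K

        K<M : K ℕ.< M
        K<M = ℕₚ.m≤n+m (suc K) (proj₁ grown)

        M-large : ∀ l → M ℕ.≤ l → fromℕ (12 ℕ.* (l ℕ.* l)) ≤ v * (fromℕ 2 * v) ^ l
        M-large l M≤l = proj₂ (proj₂ grown) l (ℕₚ.≤-trans (ℕₚ.m≤m+n _ (suc K)) M≤l)

      δ : ℝ
      δ = pow2 M ⁻¹

      0<δ : 0# < δ
      0<δ = ⁻¹-pos (pow2-pos M)

      2^Mδ : pow2 M * δ ≈ 1#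
      2^Mδ = ⁻¹-inverse (pos⇒≉0 (pow2-pos M))

      2^l*v^ : ∀ l → v * (fromℕ 2 * v) ^ l ≈ pow2 l * v ^ suc l
      2^l*v^ zero    = lem v
        where
        lem : ∀ v → v * 1# ≈ (1# + 0#) * (v * 1#)
        lem = solve 1 (λ v → v :* con (+ 1) := (con (+ 1) :+ con (+ 0)) :* (v :* con (+ 1))) ≈-refl
      2^l*v^ (suc l) = ≈-trans (lem₁ v (fromℕ 2) _) (≈-trans (*-congˡ (2^l*v^ l)) (≈-trans (lem₂ v (fromℕ 2) (pow2 l) (v ^ l)) (*-congʳ (≈-sym (pow2-suc l)))))
        where
        lem₁ : ∀ v w x → v * (w * v * x) ≈ v * w * (v * x)
        lem₁ = solve 3 (λ v w x → v :* (w :* v :* x) := v :* w :* (v :* x)) ≈-refl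
        lem₂ : ∀ v w p x → v * w * (p * (v * x)) ≈ w * p * (v * (v * x))
        lem₂ = solve 4 (λ v w p x → v :* w :* (p :* (v :* x)) := w :* p :* (v :* (v :* x))) ≈-refl

      module Cover (U : ℕ → Pred ℝ 0ℓ) (small : ∀ i x y → x ∈ U i → y ∈ U i → ∣ x - y ∣ ≤ δ)
                   (cheap : ∀ n → partialSum (λ i → diam (U i) ^ʳ s) n ≤ 1#) where

        d : ℕ → ℝ
        d i = diam (U i)

        d-nonNeg : ∀ i → 0# ≤ d i
        d-nonNeg i = diam-nonNeg (U i) (<⇒≤ 0<δ) (small i)

        2^Md≤1 : ∀ i → pow2 M * d i ≤ 1#
        2^Md≤1 i = ≤-respʳ-≈ 2^Mδ (*-monoˡ-≤ (<⇒≤ (pow2-pos M)) (diam-upper (U i) (<⇒≤ 0<δ) (small i) (<⇒≤ 0<δ) (small i)))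

        Proper Point : ℕ → ℕ → Set
        Proper l i = 0# < d i × Scale (d i) l
        Point  l i = d i ≈ 0# × l ≡ M ℕ.+ i

        -- Degenerate sets have no scale of their own and get one level each.
        OnScale : ℕ → ℕ → Set
        OnScale l i = Proper l i ⊎ Point l i

        scale-exists : ∀ i → ∃ λ l → OnScale l i
        scale-exists i = [ (λ d≤0 → M ℕ.+ i , inj₂ (≤-antisym d≤0 (d-nonNeg i) , ≡.refl)) , (λ 0<d → proper 0<d (scale 0<d d≤1)) ]′ (≤⊎> (d i) 0#)
          where
          d≤1 : d i ≤ 1#
          d≤1 = ≤-trans (≤-respˡ-≈ (lem (d i)) (*-monoʳ-≤ (d-nonNeg i) (pow2-mono {0} {M} ℕ.z≤n))) (2^Md≤1 i)
            where
            lem : ∀ x → (1# + 0#) * x ≈ x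
            lem = solve 1 (λ x → (con (+ 1) :+ con (+ 0)) :* x := x) ≈-refl
          proper : 0# < d i → ∃ (Scale (d i)) → ∃ λ l → OnScale l i
          proper 0<d (l , sc) = l , inj₁ (0<d , sc)

        scale-late : ∀ l i → OnScale l i → M ℕ.≤ l
        scale-late l i (inj₂ (_ , ≡.refl))     = ℕₚ.m≤m+n M i
        scale-late l i (inj₁ (0<d , _ , 1<2d)) = ℕₚ.≤-pred (pow2-cancel-< (*-cancelˡ-< 0<d
          (<-respˡ-≈ (*-comm _ _) (<-respʳ-≈ (*-comm _ _) (≤-<-trans (2^Md≤1 i) 1<2d)))))

        scale-small : ∀ l i → OnScale l i → pow2 l * d i ≤ 1#
        scale-small l i (inj₁ (_ , p , _)) = p
        scale-small l i (inj₂ (eq , _))    = ≤-respˡ-≈ (≈-sym (≈-trans (*-congˡ eq) (zeroʳ _))) 0≤1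

        -- Each set is an obstacle on its own level only, since avoiding it once is enough. The
        -- intervals are closed, as in `point`, because the branch point may be an endpoint.
        Z : ℕ → ℕ → Set
        Z l a = ∃ λ i → OnScale l i × ∃ λ y → y ∈ U i × fromℕ a ≤ pow2 l * y × pow2 l * y ≤ fromℕ (suc a)

        Z-late : ∀ l a → l ℕ.≤ K → ¬ Z l a
        Z-late l a l≤K (i , on , _) = ℕₚ.<⇒≱ K<M (ℕₚ.≤-trans (scale-late l i on) l≤K)

        -- A set on scale l has diameter above 2^-(l+1) and costs at least v^(l+1), with v = 2^-s,
        -- while the whole cover costs at most 1. So there are at most 2^(s(l+1)) such sets, few
        -- compared with 2^l by the choice of M.
        proper-count : ∀ l → M ℕ.≤ l → ∀ n → count n (Proper l) ℕ.* (12 ℕ.* (l ℕ.* l)) ℕ.≤ 2 ℕ.^ l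
        proper-count l M≤l n = fromℕ-cancel (≤-respˡ-≈ (≈-sym (fromℕ-* (count n (Proper l)) (12 ℕ.* (l ℕ.* l))))
          (≤-trans (*-monoˡ-≤ (fromℕ-nonNeg (count n (Proper l))) (≤-respʳ-≈ (2^l*v^ l) (M-large l M≤l)))
            (≤-respˡ-≈ (lem _ _ _) (≤-respʳ-≈ (*-identityʳ _) (*-monoˡ-≤ (<⇒≤ (pow2-pos l))
              (≤-trans (count≤sum (Proper l) (λ i → ^ʳ-nonNeg (d i) s) expensive n) (cheap n)))))))
          where
          lem : ∀ p n x → p * (n * x) ≈ n * (p * x)
          lem = solve 3 (λ p n x → p :* (n :* x) := n :* (p :* x)) ≈-refl
          expensive : ∀ i → Proper l i → v ^ suc l ≤ d i ^ʳ s
          expensive i (0<d , _ , 1<2d) = ^ʳ-lower (suc l) 0<s 0<d (<⇒≤ 1<2d)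

        -- Leaves room for the single degenerate set that level l may receive.
        level-large : ∀ l → M ℕ.≤ l → 12 ℕ.* (l ℕ.* l) ℕ.≤ 2 ℕ.^ l
        level-large l M≤l = fromℕ-cancel (≤-trans (≤-respʳ-≈ (2^l*v^ l) (M-large l M≤l))
          (≤-respʳ-≈ (*-identityʳ _) (*-monoˡ-≤ (<⇒≤ (pow2-pos l)) (v^≤1 (suc l)))))
          where
          v^≤1 : ∀ n → v ^ n ≤ 1#
          v^≤1 zero    = ≤-refl
          v^≤1 (suc n) = ≤-respʳ-≈ (*-identityʳ 1#) (*-mono-≤ (<⇒≤ (ratio-pos s)) (ratio<1 0<s) (^-nonNeg n (<⇒≤ (ratio-pos s))) (v^≤1 n))

        scale-count : ∀ l → M ℕ.≤ l → ∀ n → count n (OnScale l) ℕ.* (6 ℕ.* (l ℕ.* l)) ℕ.≤ 2 ℕ.^ l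
        scale-count l M≤l n = ℕₚ.*-cancelˡ-≤ 2 (begin
          2 ℕ.* (count n (OnScale l) ℕ.* (6 ℕ.* L))         ≡⟨ lem₁ (count n (OnScale l)) L ⟩
          count n (OnScale l) ℕ.* (12 ℕ.* L)                ≤⟨ ℕₚ.*-monoˡ-≤ (12 ℕ.* L) (ℕₚ.≤-trans (count-⊎ n (λ _ _ p → p)) (ℕₚ.+-monoʳ-≤ (count n (Proper l)) points)) ⟩
          (count n (Proper l) ℕ.+ 1) ℕ.* (12 ℕ.* L)         ≡⟨ lem₂ (count n (Proper l)) (12 ℕ.* L) ⟩
          count n (Proper l) ℕ.* (12 ℕ.* L) ℕ.+ 12 ℕ.* L    ≤⟨ ℕₚ.+-mono-≤ (proper-count l M≤l n) (level-large l M≤l) ⟩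
          2 ℕ.^ l ℕ.+ 2 ℕ.^ l                           ≡⟨ ≡.cong (2 ℕ.^ l ℕ.+_) (≡.sym (ℕₚ.+-identityʳ (2 ℕ.^ l))) ⟩
          2 ℕ.* 2 ℕ.^ l                                 ∎)
          where
          open ℕₚ.≤-Reasoning
          L = l ℕ.* l
          lem₁ : ∀ x y → 2 ℕ.* (x ℕ.* (6 ℕ.* y)) ≡ x ℕ.* (12 ℕ.* y)
          lem₁ = solve-∀
          lem₂ : ∀ x y → (x ℕ.+ 1) ℕ.* y ≡ x ℕ.* y ℕ.+ y
          lem₂ = solve-∀
          points : count n (Point l) ℕ.≤ 1
          points = cluster n 1 λ { i i′ (_ , eq) (_ , eq′) →
            ℕ.s≤s (ℕₚ.≤-reflexive (ℕₚ.+-cancelˡ-≡ M i i′ (≡.trans (≡.sym eq) eq′))) }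

        -- The diameter is at most the length of an interval. A set that reaches from one endpoint
        -- of an interval to the other touches both neighbours too, hence 3.
        meets-few : ∀ l i → OnScale l i → count (2 ℕ.^ l) (λ a → ∃ λ y → y ∈ U i × fromℕ a ≤ pow2 l * y × pow2 l * y ≤ fromℕ (suc a)) ℕ.≤ 3
        meets-few l i on = cluster (2 ℕ.^ l) 3 near
          where
          P = pow2 l
          lem : ∀ P y y′ D a a′ → 1# + (1# + a′) - a ≈ (P * y - a) + (1# + a′ - P * y′) + (1# - P * D) + P * (D - (y - y′))
          lem = solve 6 (λ P y y′ D a a′ → con (+ 1) :+ (con (+ 1) :+ a′) :- a :=
            (P :* y :- a) :+ (con (+ 1) :+ a′ :- P :* y′) :+ (con (+ 1) :- P :* D) :+ P :* (D :- (y :- y′))) ≈-refl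
          near : ∀ a a′ → (∃ λ y → y ∈ U i × fromℕ a ≤ P * y × P * y ≤ fromℕ (suc a)) →
                 (∃ λ y → y ∈ U i × fromℕ a′ ≤ P * y × P * y ≤ fromℕ (suc a′)) → a ℕ.< 3 ℕ.+ a′
          near a a′ (y , y∈ , a≤ , _) (y′ , y′∈ , _ , ≤a′) = ℕ.s≤s (fromℕ-cancel {a} {2 ℕ.+ a′} (≤-by
            (+-nonNeg (+-nonNeg (+-nonNeg (0≤y-x a≤) (0≤y-x ≤a′)) (0≤y-x (scale-small l i on)))
              (*-nonNeg (<⇒≤ (pow2-pos l)) (0≤y-x (≤-trans (x≤∣x∣ (y - y′)) (diam-lower (U i) (<⇒≤ 0<δ) (small i) y y′ y∈ y′∈)))))
            (lem P y y′ (d i) (fromℕ a) (fromℕ a′))))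

        Z-few : ∀ l → count (2 ℕ.^ l) (Z l) ℕ.* (2 ℕ.* (l ℕ.* l)) ℕ.≤ 2 ℕ.^ l
        Z-few l = [ late , early ]′ (ℕₚ.≤-total M l)
          where
          L = l ℕ.* l
          none : (∀ i → ¬ OnScale l i) → count (2 ℕ.^ l) (Z l) ℕ.* (2 ℕ.* L) ℕ.≤ 2 ℕ.^ l
          none ¬on = ℕₚ.≤-trans (ℕₚ.≤-reflexive (≡.cong (ℕ._* (2 ℕ.* L)) (count-none (2 ℕ.^ l) λ { a _ (i , on , _) → ¬on i on }))) ℕ.z≤n
          late : M ℕ.≤ l → count (2 ℕ.^ l) (Z l) ℕ.* (2 ℕ.* L) ℕ.≤ 2 ℕ.^ l
          late M≤l = fromBound (few⇒bounded (2 ℕ.^ l) (OnScale l) λ n →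
              ℕₚ.≤-trans (ℕₚ.m≤m*n (count n (OnScale l)) (6 ℕ.* L) {{ℕ.>-nonZero (ℕₚ.*-mono-≤ {1} {6} (ℕ.s≤s ℕ.z≤n) (ℕₚ.*-mono-≤ 1≤l 1≤l))}}) (scale-count l M≤l n))
            where
            1≤l : 1 ℕ.≤ l
            1≤l = ℕₚ.≤-trans (ℕₚ.≤-trans (ℕ.s≤s ℕ.z≤n) K<M) M≤l
            fromBound : (∃ λ N → ∀ i → OnScale l i → i ℕ.< N) → count (2 ℕ.^ l) (Z l) ℕ.* (2 ℕ.* L) ℕ.≤ 2 ℕ.^ l
            fromBound (N , i<N) = begin
              count (2 ℕ.^ l) (Z l) ℕ.* (2 ℕ.* L)           ≤⟨ ℕₚ.*-monoˡ-≤ (2 ℕ.* L) (double-count (2 ℕ.^ l) N 3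
                (λ i a → ∃ λ y → y ∈ U i × fromℕ a ≤ pow2 l * y × pow2 l * y ≤ fromℕ (suc a))
                (λ { a _ (i , on , m) → i , i<N i on , on , m }) (λ i _ on → meets-few l i on)) ⟩
              3 ℕ.* count N (OnScale l) ℕ.* (2 ℕ.* L)       ≡⟨ lem (count N (OnScale l)) L ⟩
              count N (OnScale l) ℕ.* (6 ℕ.* L)             ≤⟨ scale-count l M≤l N ⟩
              2 ℕ.^ l                                   ∎
              where
              open ℕₚ.≤-Reasoning
              lem : ∀ x y → 3 ℕ.* x ℕ.* (2 ℕ.* y) ≡ x ℕ.* (6 ℕ.* y)
              lem = solve-∀
          early : l ℕ.≤ M → count (2 ℕ.^ l) (Z l) ℕ.* (2 ℕ.* L) ℕ.≤ 2 ℕ.^ l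
          early l≤M = [ (λ l<M → none λ i on → ℕₚ.<⇒≱ l<M (scale-late l i on)) , (λ l≡M → late (ℕₚ.≤-reflexive (≡.sym l≡M))) ]′ (ℕₚ.m≤n⇒m<n∨m≡n l≤M)

        -- Every set of the cover has a level, and on that level x lies in an interval that the set
        -- does not meet.
        uncovered : ∃ λ x → [ 0# ] <± liminf (F x) × ∀ i → ¬ x ∈ U i
        uncovered = avoid (sifted Z Z-late Z-few)
          where
          avoid : (∃ λ x → [ 0# ] <± liminf (F x) × ∀ l → ∃ λ a → ¬ Z l a × fromℕ a ≤ pow2 l * x × pow2 l * x ≤ fromℕ (suc a)) →
                  ∃ λ x → [ 0# ] <± liminf (F x) × ∀ i → ¬ x ∈ U i
          avoid (x , x∈E , outside) = x , x∈E , λ i x∈U → clash i x∈U (scale-exists i)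
            where
            clash : ∀ i → x ∈ U i → ¬ ∃ λ l → OnScale l i
            clash i x∈U (l , on) = proj₁ (proj₂ (outside l)) (i , on , x , x∈U , proj₂ (proj₂ (outside l)))

      -- A cheaper cover would have all partial sums at most 1, and `uncovered` would find a point
      -- of the exceptional set that it misses.
      premeasure≥1 : [ 1# ] ≤± hausdorffPremeasure s δ (λ β → [ 0# ] <± liminf (F β))
      premeasure≥1 = proj₂ (inf±-spec _) [ 1# ] λ { _ (U , cover , ≡.refl) → expensive U (IsCover.covers cover) (IsCover.small cover) }
        where
        expensive : ∀ (U : ℕ → Pred ℝ 0ℓ) → (∀ x → [ 0# ] <± liminf (F x) → ∃ λ i → x ∈ U i) →
                    (∀ i x y → x ∈ U i → y ∈ U i → ∣ x - y ∣ ≤ δ) → [ 1# ] ≤± series (λ i → diam (U i) ^ʳ s)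
        expensive U covers small = byContra λ ¬p → missed (Cover.uncovered U small λ n → ≮⇒≥ λ q →
            ¬p (≤±-trans ([]-mono (<⇒≤ q)) (series-lower (λ i → diam (U i) ^ʳ s) n)))
          where
          missed : ¬ ∃ λ x → [ 0# ] <± liminf (F x) × ∀ i → ¬ x ∈ U i
          missed (x , x∈E , x∉U) = x∉U (proj₁ (covers x x∈E)) (proj₂ (covers x x∈E))

      measure-nonzero : ¬ hausdorffMeasure s (λ β → [ 0# ] <± liminf (F β)) ≈± [ 0# ]
      measure-nonzero eq = <⇒≱ 0<1 ([]-cancel (≤±-trans premeasure≥1
        (≤±-trans (premeasure≤measure s (λ β → [ 0# ] <± liminf (F β)) 0<δ) (≤±-reflexive eq))))

  -- The dimension

  badly-constant : ∀ {α} → BadlyApproximable α → ∃ λ T → ∀ q → 1 ℕ.≤ q → 1# ≤ pow2 T * (fromℕ q * ‖ fromℕ q * α ‖)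
  badly-constant {α} bad = fromBound (pos±⇒bound bad)
    where
    I : ℝ±
    I = inf± (λ t → ∃ λ q → 1 ℕ.≤ q × t ≡ [ fromℕ q * ‖ fromℕ q * α ‖ ])
    fromBound : (∃ λ c → 0# < c × [ c ] ≤± I) → ∃ λ T → ∀ q → 1 ℕ.≤ q → 1# ≤ pow2 T * (fromℕ q * ‖ fromℕ q * α ‖)
    fromBound (c , 0<c , c≤) = rescale (pow2-unbounded 0<c)
      where
      rescale : (∃ λ n → 1# < pow2 n * c) → ∃ λ T → ∀ q → 1 ℕ.≤ q → 1# ≤ pow2 T * (fromℕ q * ‖ fromℕ q * α ‖)
      rescale (T , p) = T , λ q 1≤q → ≤-trans (<⇒≤ p) (*-monoˡ-≤ (<⇒≤ (pow2-pos T))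
        ([]-cancel (≤±-trans c≤ (proj₁ (inf±-spec _) _ (q , 1≤q , ≡.refl)))))

  -- `measure-zero` is about exponents strictly above 1, so the bound 1 is reached only as a limit.
  ≤1-from-above : ∀ {x} → (∀ s → 1# < s → x ≤± [ s ]) → x ≤± [ 1# ]
  ≤1-from-above {⊥±}    h = ⊥±-least [ 1# ]
  ≤1-from-above {⊤±}    h = contradiction (h (1# + 1#) (<-by 0<1 (lem 1#))) ⊤≰[]
    where
    lem : ∀ x → 1# + x - 1# ≈ x
    lem = solve 1 (λ x → con (+ 1) :+ x :- con (+ 1) := x) ≈-refl
  ≤1-from-above {[ x ]} h = []-mono (byContra λ ¬p → squeeze (≰⇒> ¬p) (halve (0<y-x (≰⇒> ¬p))))
    where
    lem : ∀ x → 1# + x - 1# ≈ x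
    lem = solve 1 (λ x → con (+ 1) :+ x :- con (+ 1) := x) ≈-refl
    lem₂ : ∀ x y → x - (1# + y) ≈ x - 1# - y
    lem₂ = solve 2 (λ x y → x :- (con (+ 1) :+ y) := x :- con (+ 1) :- y) ≈-refl
    lem₃ : ∀ ε → ε + ε - ε ≈ ε
    lem₃ = solve 1 (λ ε → ε :+ ε :- ε := ε) ≈-refl
    squeeze : 1# < x → ¬ ∃ λ ε → 0# < ε × ε + ε ≈ x - 1#
    squeeze 1<x (ε , 0<ε , eq) = <⇒≱ (<-by 0<ε (≈-trans (lem₂ x ε) (≈-trans (+-congʳ (≈-sym eq)) (lem₃ ε))))
      ([]-cancel (h (1# + ε) (<-by 0<ε (lem ε))))

  dimension-one : ∀ α → BadlyApproximable α →
    hausdorffDimension (λ β → [ 0# ] <± liminf (λ q →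
      fromℕ q * log (fromℕ q) ^ 2 * ‖ fromℕ q * α ‖ * ‖ fromℕ q * β ‖)) ≈± [ 1# ]
  dimension-one α bad = fromConstant (badly-constant bad)
    where
    E : Pred ℝ 0ℓ
    E β = [ 0# ] <± liminf (λ q → fromℕ q * log (fromℕ q) ^ 2 * ‖ fromℕ q * α ‖ * ‖ fromℕ q * β ‖)
    fromConstant : (∃ λ T → ∀ q → 1 ℕ.≤ q → 1# ≤ pow2 T * (fromℕ q * ‖ fromℕ q * α ‖)) → hausdorffDimension E ≈± [ 1# ]
    fromConstant (T , bad′) = ≤±-antisym
      (≤1-from-above λ s 1<s → proj₁ (inf±-spec _) [ s ] (s , <-trans 0<1 1<s , measure-zero s E 1<s , ≡.refl))
      (proj₂ (inf±-spec _) [ 1# ] λ { _ (s , 0<s , null , ≡.refl) → []-mono (≮⇒≥ λ s<1 →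
        LowerBound.Dimension.measure-nonzero α T bad′ s 0<s s<1 null) })

theorem1 : (em : ∀ ℓ → ExcludedMiddle ℓ) (𝓡 : CompleteOrderedField) →
    let open RealAnalysis em 𝓡 in
    (α : ℝ) → BadlyApproximable α →
    hausdorffDimension
    (λ β → [ 0# ] <± liminf (λ q →
    fromℕ q * log (fromℕ q) ^ 2 * ‖ fromℕ q * α ‖ * ‖ fromℕ q * β ‖))
    ≈± [ 1# ]
theorem1 em 𝓡 = Analysis.dimension-one em 𝓡
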